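{- Let $k\geq 1$ and let $n_1,n_2,\ldots,n_k$ be composite positive integers. Suppose that $\Gamma$ is a group isomorphic to $\bigoplus_{i=1}^k\mathbb{Z}_{n_i}$. Then there exists a spherical latin bitrade whose canonical group is isomorphic to $\Gamma$.
   Context: Partial latin square: given finite, pairwise disjoint sets $R$ (rows), $C$ (columns), $S$ (symbols), a partial latin square is a subset $P\subseteq R\times C\times S$ such that any two distinct triples of $P$ agree in at most one coordinate; it is assumed that every element of $R$, $C$ and $S$ occurs in some triple of $P$. Latin bitrade: an ordered pair $(W,B)$ of non-empty partial latin squares (with common sets $R,C,S$) such that for each triple $(r,c,s)\in W$ (respectively $B$) there exist unique $r'\neq r$, $c'\neq c$, $s'\neq s$ with $\{(r',c,s),(r,c',s),(r,c,s')\}\subset B$ (respectively $W$). Its size is $|W|=|B|$. It is connected if there is no latin bitrade $(W',B')$ with $W'\subsetneq W$ and $B'\subsetneq B$. Separated: for each row $r$, define a permutation $\rho_r$ of the symbols in row $r$ by $\rho_r(s)=s'$ if and only if $(r,c,s)\in W$ and $(r,c,s')\in B$ for some $c\in C$; the row $r$ is separated if $\rho_r$ is a single cycle. Separated columns and symbols are defined analogously. The bitrade is separated if every row, column and symbol is separated. Spherical: from a connected separated latin bitrade $(W,B)$ construct a face two-coloured triangulation of a closed orientable surface with vertex set $R\sqcup C\sqcup S$, with an edge between two vertices if and only if they occur together in a triple of $W$ (equivalently of $B$), a white triangular face with vertices $r,c,s$ for each $(r,c,s)\in W$, and a black triangular face with vertices $r,c,s$ for each $(r,c,s)\in B$. A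 spherical latin bitrade is a connected separated latin bitrade for which this surface is the sphere (equivalently, a connected latin bitrade with $|R|+|C|+|S|=|W|+2$). Canonical group: for a partial latin square $P$ with sets $R,C,S$, let $\mathcal{A}_P$ be the abelian group with generating set $R\cup C\cup S$ subject to the relations $r+c+s=0$ for all $(r,c,s)\in P$. It is known that for a spherical latin bitrade $(W,B)$ one has $\mathcal{A}_W\cong\mathcal{A}_B\cong\mathbb{Z}\oplus\mathbb{Z}\oplus\mathcal{C}$ with $\mathcal{C}$ finite. The group $\mathcal{C}$ (the torsion subgroup of $\mathcal{A}_W$) is called the canonical group of $(W,B)$. $\mathbb{Z}_n$ denotes the cyclic group of order $n$. -}

module Defs where

open import Level using (Level; 0ℓ; _⊔_)
open import Algebra.Bundles using (Group; AbelianGroup)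
open import Algebra.Morphism.Structures using (module GroupMorphisms)
import Algebra.Construct.DirectProduct as DirectProduct
import Algebra.Construct.Terminal as Terminal
import Algebra.Properties.CommutativeMonoid.Mult as Multiples
open import Data.Bool.Base using (Bool; T)
open import Data.Bool.ListAction using (any)
open import Data.Fin.Base using (Fin)
open import Data.Fin.Subset using (Subset; _∈_; ⊤)
open import Data.Integer.Base as ℤ using (ℤ; +_)
import Data.Integer.Properties as ℤ
open import Data.Integer.Divisibility.Signed as ℤ∣ using (_∣_)
open import Data.Integer.Tactic.RingSolver using (solve-∀)
open import Data.List.Base using (List; length; filterᵇ; allFin; cartesianProduct)
open import Data.Nat.Base as ℕ using (ℕ; NonZero)
import Data.Nat.Properties as ℕ
open import Data.Product using (Σ; ∃; ∃₂; ∃!; _×_; _,_; proj₁)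
open import Data.Vec.Functional using (Vector; foldr)
open import Function.Base using (_on_)
open import Relation.Binary.Core using (Rel)
open import Relation.Binary.Construct.Closure.ReflexiveTransitive using (Star)
open import Relation.Binary.PropositionalEquality using (_≡_; _≢_; subst)
open import Relation.Nullary.Negation using (¬_)

private
  variable
    a b ℓ ℓ₁ ℓ₂ : Level
    l m n : ℕ

Triple : (l m n : ℕ) → Set
Triple l m n = Fin l × Fin m × Fin n

TripleSet : (l m n : ℕ) → Set
TripleSet l m n = Triple l m n → Bool

infix 4 _∈ₜ_ _⊊_

_∈ₜ_ : Triple l m n → TripleSet l m n → Set
t ∈ₜ P = T (P t)

_⊊_ : TripleSet l m n → TripleSet l m n → Set
P ⊊ Q = (∀ {t} → t ∈ₜ P → t ∈ₜ Q) × ∃ λ t → t ∈ₜ Q × ¬ t ∈ₜ P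

-- The three index types play the part of disjoint finite universes; the
-- row, column and symbol sets are subsets of them, since a bitrade inside
-- another one may use fewer rows, columns and symbols.
record IsPartialLatinSquare
  (R : Subset l) (C : Subset m) (S : Subset n) (P : TripleSet l m n) : Set where
  field
    contained    : ∀ {r c s} → (r , c , s) ∈ₜ P → r ∈ R × c ∈ C × s ∈ S
    agree≤1      : ∀ {r c s r′ c′ s′} →
                   (r , c , s) ∈ₜ P → (r′ , c′ , s′) ∈ₜ P →
                   (r , c , s) ≢ (r′ , c′ , s′) →
                   ¬ (r ≡ r′ × c ≡ c′) × ¬ (r ≡ r′ × s ≡ s′) × ¬ (c ≡ c′ × s ≡ s′)
    rowsOccur    : ∀ {r} → r ∈ R → ∃₂ λ c s → (r , c , s) ∈ₜ P
    colsOccur    : ∀ {c} → c ∈ C → ∃₂ λ r s → (r , c , s) ∈ₜ P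
    symbolsOccur : ∀ {s} → s ∈ S → ∃₂ λ r c → (r , c , s) ∈ₜ P

NonEmpty : TripleSet l m n → Set
NonEmpty P = ∃ λ t → t ∈ₜ P

HasUniqueMates : TripleSet l m n → TripleSet l m n → Set
HasUniqueMates P Q = ∀ {r c s} → (r , c , s) ∈ₜ P →
  ∃! _≡_ (λ r′ → r′ ≢ r × (r′ , c , s) ∈ₜ Q) ×
  ∃! _≡_ (λ c′ → c′ ≢ c × (r , c′ , s) ∈ₜ Q) ×
  ∃! _≡_ (λ s′ → s′ ≢ s × (r , c , s′) ∈ₜ Q)

record IsLatinBitrade
  (R : Subset l) (C : Subset m) (S : Subset n) (W B : TripleSet l m n) : Set where
  field
    white-isPLS    : IsPartialLatinSquare R C S W
    black-isPLS    : IsPartialLatinSquare R C S B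
    white-nonEmpty : NonEmpty W
    black-nonEmpty : NonEmpty B
    white-mates    : HasUniqueMates W B
    black-mates    : HasUniqueMates B W

record ProperSubBitrade (W B : TripleSet l m n) : Set where
  field
    {R′}     : Subset l
    {C′}     : Subset m
    {S′}     : Subset n
    {W′ B′}  : TripleSet l m n
    isLatinBitrade : IsLatinBitrade R′ C′ S′ W′ B′
    W′⊊W     : W′ ⊊ W
    B′⊊B     : B′ ⊊ B

Connected : TripleSet l m n → TripleSet l m n → Set
Connected W B = ¬ ProperSubBitrade W B

-- The graphs of the permutations attached to a row (acting on its symbols),
-- a column (acting on its rows) and a symbol (acting on its columns).
module _ (W B : TripleSet l m n) where

  ρ-row : Fin l → Rel (Fin n) 0ℓ
  ρ-row r s s′ = ∃ λ c → (r , c , s) ∈ₜ W × (r , c , s′) ∈ₜ B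

  ρ-col : Fin m → Rel (Fin l) 0ℓ
  ρ-col c r r′ = ∃ λ s → (r , c , s) ∈ₜ W × (r′ , c , s) ∈ₜ B

  ρ-sym : Fin n → Rel (Fin m) 0ℓ
  ρ-sym s c c′ = ∃ λ r → (r , c , s) ∈ₜ W × (r , c′ , s) ∈ₜ B

-- For the graph ρ of a permutation of the (finite) set X this says that
-- any two points of X are related by a power of the permutation.
IsSingleCycle : {A : Set} → (A → Set) → Rel A 0ℓ → Set
IsSingleCycle X ρ = ∀ {x y} → X x → X y → Star ρ x y

record Separated (W B : TripleSet l m n) : Set where
  field
    rows    : ∀ r → IsSingleCycle (λ s → ∃ λ c → (r , c , s) ∈ₜ W) (ρ-row W B r)
    cols    : ∀ c → IsSingleCycle (λ r → ∃ λ s → (r , c , s) ∈ₜ W) (ρ-col W B c)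
    symbols : ∀ s → IsSingleCycle (λ c → ∃ λ r → (r , c , s) ∈ₜ W) (ρ-sym W B s)

count : {A : Set} → (A → Bool) → List A → ℕ
count p xs = length (filterᵇ p xs)

size : TripleSet l m n → ℕ
size {l} {m} {n} P =
  count P (cartesianProduct (allFin l) (cartesianProduct (allFin m) (allFin n)))

-- An edge joins two vertices occurring together in a triple of W; it is of
-- type row-column, row-symbol or column-symbol.
edgeCount : TripleSet l m n → ℕ
edgeCount {l} {m} {n} W =
    count (λ (r , c) → any (λ s → W (r , c , s)) (allFin n))
          (cartesianProduct (allFin l) (allFin m))
  ℕ.+ count (λ (r , s) → any (λ c → W (r , c , s)) (allFin m))
          (cartesianProduct (allFin l) (allFin n))
  ℕ.+ count (λ (c , s) → any (λ r → W (r , c , s)) (allFin l))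
          (cartesianProduct (allFin m) (allFin n))

-- V − E + F = 2 for the face two-coloured triangulation with vertex set
-- R ⊔ C ⊔ S and a face for each triple of W and of B.  For a connected
-- separated bitrade this triangulates a closed connected orientable surface,
-- which is therefore the sphere exactly when its Euler characteristic is 2.
EulerCharacteristic2 : TripleSet l m n → TripleSet l m n → Set
EulerCharacteristic2 {l} {m} {n} W B =
  (l ℕ.+ m ℕ.+ n) ℕ.+ (size W ℕ.+ size B) ≡ edgeCount W ℕ.+ 2

record SphericalLatinBitrade : Set where
  field
    {#rows #cols #symbols} : ℕ
    W B            : TripleSet #rows #cols #symbols
    isLatinBitrade : IsLatinBitrade ⊤ ⊤ ⊤ W B
    connected      : Connected W B
    separated      : Separated W B
    sphere         : EulerCharacteristic2 W B

module Presentation (X : Set) where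

  infixl 6 _⊕_
  infix  8 ⊝_

  data Term : Set where
    gen : X → Term
    𝟎   : Term
    _⊕_ : Term → Term → Term
    ⊝_  : Term → Term

  -- The least congruence satisfying the abelian group laws and making every
  -- relator zero.
  data Provable (Relator : Term → Set) : Rel Term 0ℓ where
    relator   : ∀ {t} → Relator t → Provable Relator t 𝟎
    ≈-refl    : ∀ {t} → Provable Relator t t
    ≈-sym     : ∀ {t u} → Provable Relator t u → Provable Relator u t
    ≈-trans   : ∀ {t u v} → Provable Relator t u → Provable Relator u v →
                Provable Relator t v
    ⊕-cong    : ∀ {t t′ u u′} → Provable Relator t t′ → Provable Relator u u′ →
                Provable Relator (t ⊕ u) (t′ ⊕ u′)
    ⊝-cong    : ∀ {t u} → Provable Relator t u → Provable Relator (⊝ t) (⊝ u)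
    ⊕-assoc   : ∀ t u v → Provable Relator ((t ⊕ u) ⊕ v) (t ⊕ (u ⊕ v))
    ⊕-comm    : ∀ t u → Provable Relator (t ⊕ u) (u ⊕ t)
    ⊕-identity : ∀ t → Provable Relator (𝟎 ⊕ t) t
    ⊕-inverse : ∀ t → Provable Relator ((⊝ t) ⊕ t) 𝟎

  presented : (Term → Set) → AbelianGroup 0ℓ 0ℓ
  presented Relator = record
    { Carrier = Term
    ; _≈_     = Provable Relator
    ; _∙_     = _⊕_
    ; ε       = 𝟎
    ; _⁻¹     = ⊝_
    ; isAbelianGroup = record
      { isGroup = record
        { isMonoid = record
          { isSemigroup = record
            { isMagma = record
              { isEquivalence = record
                { refl = ≈-refl ; sym = ≈-sym ; trans = ≈-trans }
              ; ∙-cong = ⊕-cong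
              }
            ; assoc = ⊕-assoc
            }
          ; identity = ⊕-identity
                     , (λ t → ≈-trans (⊕-comm t 𝟎) (⊕-identity t))
          }
        ; inverse = ⊕-inverse
                  , (λ t → ≈-trans (⊕-comm t (⊝ t)) (⊕-inverse t))
        ; ⁻¹-cong = ⊝-cong
        }
      ; comm = ⊕-comm
      }
    }

data Vertex (l m n : ℕ) : Set where
  row    : Fin l → Vertex l m n
  column : Fin m → Vertex l m n
  symbol : Fin n → Vertex l m n

module _ {l m n : ℕ} where

  open Presentation (Vertex l m n)

  data TripleRelator (P : TripleSet l m n) : Term → Set where
    r+c+s : ∀ {r c s} → (r , c , s) ∈ₜ P →
            TripleRelator P (gen (row r) ⊕ gen (column c) ⊕ gen (symbol s))

  𝒜 : TripleSet l m n → AbelianGroup 0ℓ 0ℓ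
  𝒜 P = presented (TripleRelator P)

module Torsion (G : AbelianGroup a ℓ) where

  open AbelianGroup G
  open Multiples commutativeMonoid using (×-congʳ; ×-distrib-+; ×-assocˡ; ×-congˡ)
    renaming (_×_ to _·_)
  open import Relation.Binary.Reasoning.Setoid setoid

  IsTorsion : Carrier → Set ℓ
  IsTorsion x = ∃ λ k → NonZero k × k · x ≈ ε

  private
    ·-ε : ∀ k → k · ε ≈ ε
    ·-ε ℕ.zero    = refl
    ·-ε (ℕ.suc k) = trans (identityˡ _) (·-ε k)

    ·-multiple : ∀ j k {x} → k · x ≈ ε → (j ℕ.* k) · x ≈ ε
    ·-multiple j k {x} eq = begin
      (j ℕ.* k) · x ≈⟨ ×-assocˡ x j k ⟨
      j · (k · x)   ≈⟨ ×-congʳ j eq ⟩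
      j · ε         ≈⟨ ·-ε j ⟩
      ε             ∎

    torsion-∙ : ∀ {x y} → IsTorsion x → IsTorsion y → IsTorsion (x ∙ y)
    torsion-∙ {x} {y} (j , j≢0 , jx) (k , k≢0 , ky) =
      j ℕ.* k , ℕ.m*n≢0 j k {{j≢0}} {{k≢0}} , (begin
        (j ℕ.* k) · (x ∙ y)               ≈⟨ ×-distrib-+ x y (j ℕ.* k) ⟩
        (j ℕ.* k) · x ∙ (j ℕ.* k) · y     ≈⟨ ∙-congʳ (×-congˡ (ℕ.*-comm j k)) ⟩
        (k ℕ.* j) · x ∙ (j ℕ.* k) · y     ≈⟨ ∙-cong (·-multiple k j jx) (·-multiple j k ky) ⟩
        ε ∙ ε                             ≈⟨ identityˡ ε ⟩
        ε                                 ∎)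

    torsion-⁻¹ : ∀ {x} → IsTorsion x → IsTorsion (x ⁻¹)
    torsion-⁻¹ {x} (k , k≢0 , kx) = k , k≢0 , (begin
      k · (x ⁻¹)           ≈⟨ identityˡ _ ⟨
      ε ∙ k · (x ⁻¹)       ≈⟨ ∙-congʳ kx ⟨
      k · x ∙ k · (x ⁻¹)   ≈⟨ ×-distrib-+ x (x ⁻¹) k ⟨
      k · (x ∙ x ⁻¹)       ≈⟨ ×-congʳ k (inverseʳ x) ⟩
      k · ε                ≈⟨ ·-ε k ⟩
      ε                    ∎)

  torsionSubgroup : AbelianGroup (a ⊔ ℓ) ℓ
  torsionSubgroup = record
    { Carrier = Σ Carrier IsTorsion
    ; _≈_     = _≈_ on proj₁
    ; _∙_     = λ (x , p) (y , q) → x ∙ y , torsion-∙ p q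
    ; ε       = ε , 1 , _ , ·-ε 1
    ; _⁻¹     = λ (x , p) → x ⁻¹ , torsion-⁻¹ p
    ; isAbelianGroup = record
      { isGroup = record
        { isMonoid = record
          { isSemigroup = record
            { isMagma = record
              { isEquivalence = record { refl = refl ; sym = sym ; trans = trans }
              ; ∙-cong = ∙-cong
              }
            ; assoc = λ x y z → assoc (proj₁ x) (proj₁ y) (proj₁ z)
            }
          ; identity = (λ x → identityˡ (proj₁ x)) , (λ x → identityʳ (proj₁ x))
          }
        ; inverse = (λ x → inverseˡ (proj₁ x)) , (λ x → inverseʳ (proj₁ x))
        ; ⁻¹-cong = ⁻¹-cong
        }
      ; comm = λ x y → comm (proj₁ x) (proj₁ y)
      }
    }

open Torsion public using (torsionSubgroup)

canonicalGroup : SphericalLatinBitrade → AbelianGroup 0ℓ 0ℓ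
canonicalGroup T = torsionSubgroup (𝒜 (SphericalLatinBitrade.W T))

infix 4 _≡_[mod_]

_≡_[mod_] : ℤ → ℤ → ℕ → Set
x ≡ y [mod k ] = + k ∣ x ℤ.- y

-- The integers modulo k (cyclic of order k when k is positive).
ℤ/_ : ℕ → AbelianGroup 0ℓ 0ℓ
ℤ/ k = record
  { Carrier = ℤ
  ; _≈_     = _≡_[mod k ]
  ; _∙_     = ℤ._+_
  ; ε       = + 0
  ; _⁻¹     = ℤ.-_
  ; isAbelianGroup = record
    { isGroup = record
      { isMonoid = record
        { isSemigroup = record
          { isMagma = record
            { isEquivalence = record
              { refl  = λ {x} → ≡⇒≈ {x} _≡_.refl
              ; sym   = λ {x} {y} p → subst (+ k ∣_) (neg-diff x y) (ℤ∣.∣m⇒∣-m p)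
              ; trans = λ {x} {y} {z} p q →
                          subst (+ k ∣_) (telescope x y z) (ℤ∣.∣m∣n⇒∣m+n p q)
              }
            ; ∙-cong = λ {x} {y} {u} {v} p q →
                         subst (+ k ∣_) (sum-diff x y u v) (ℤ∣.∣m∣n⇒∣m+n p q)
            }
          ; assoc = λ x y z → ≡⇒≈ (ℤ.+-assoc x y z)
          }
        ; identity = (λ x → ≡⇒≈ (ℤ.+-identityˡ x)) , (λ x → ≡⇒≈ (ℤ.+-identityʳ x))
        }
      ; inverse = (λ x → ≡⇒≈ (ℤ.+-inverseˡ x)) , (λ x → ≡⇒≈ (ℤ.+-inverseʳ x))
      ; ⁻¹-cong = λ {x} {y} p → subst (+ k ∣_) (diff-neg x y) (ℤ∣.∣m⇒∣-m p)
      }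
    ; comm = λ x y → ≡⇒≈ (ℤ.+-comm x y)
    }
  }
  where
  ≡⇒≈ : ∀ {x y} → x ≡ y → x ≡ y [mod k ]
  ≡⇒≈ {x} _≡_.refl = ℤ∣.divides (+ 0) (ℤ.+-inverseʳ x)

  neg-diff : ∀ x y → ℤ.- (x ℤ.- y) ≡ y ℤ.- x
  neg-diff = solve-∀

  diff-neg : ∀ x y → ℤ.- (x ℤ.- y) ≡ ℤ.- x ℤ.- ℤ.- y
  diff-neg = solve-∀

  telescope : ∀ x y z → (x ℤ.- y) ℤ.+ (y ℤ.- z) ≡ x ℤ.- z
  telescope = solve-∀

  sum-diff : ∀ x y u v → (x ℤ.- y) ℤ.+ (u ℤ.- v) ≡ (x ℤ.+ u) ℤ.- (y ℤ.+ v)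
  sum-diff = solve-∀

⨁ : ∀ {k} → Vector (AbelianGroup 0ℓ 0ℓ) k → AbelianGroup 0ℓ 0ℓ
⨁ = foldr DirectProduct.abelianGroup Terminal.abelianGroup

infix 4 _≅_

_≅_ : Group a ℓ₁ → Group b ℓ₂ → Set (a ⊔ b ⊔ ℓ₁ ⊔ ℓ₂)
G ≅ H = ∃ (GroupMorphisms.IsGroupIsomorphism (Group.rawGroup G) (Group.rawGroup H))

{-# OPTIONS --safe #-}
module Submission where

-- A white triple of one spherical bitrade and a black triple of another can be cut out and the
-- boundaries identified: the connected sum of two spherical bitrades is spherical.  If the removed
-- black triple has value g = r + c + s in the group of the first bitrade, then the relation of the
-- removed white triple turns into r + c + s = g.  If q g = 0, and the second bitrade admits an
-- integral labelling with sum 1 on the removed white triple and 0 modulo q on the other ones, this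
-- twist can be undone and the canonical group is a direct sum.
--
-- For n = a b with a, b ≥ 2, the connected sum of two dipoles (two rows joined through a cycle of
-- columns and symbols) with b and a columns has canonical group ℤ/n, generated by U with V = a U.
-- It keeps a black triple of value − V, of order b, and a white triple at which the labelling of
-- the required kind amounts to a U + 1 ≡ V and b V ≡ 0 modulo q.  This is solvable with b prime
-- for any prime q, and so the blocks can be chained.

open import Defs
open import Level using (Level; 0ℓ)
open import Algebra.Bundles using (Group; AbelianGroup)
import Algebra.Construct.DirectProduct as DirectProduct
import Algebra.Construct.Terminal as Terminal
import Algebra.Morphism.Construct.Composition as Composition
open import Algebra.Morphism.Structures using (module GroupMorphisms)
import Algebra.Properties.AbelianGroup as AbelianGroupProperties
import Algebra.Properties.CommutativeMonoid.Mult as Multiples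
import Algebra.Properties.CommutativeSemigroup as CommutativeSemigroupProperties
import Algebra.Properties.Loop as LoopProperties
open import Data.Bool.Base using (Bool; T)
open import Data.Bool.ListAction using (any)
open import Data.Bool.Properties using (T?)
open import Data.Empty using (⊥; ⊥-elim)
open import Data.Fin.Base as Fin
  using (Fin; zero; suc; toℕ; fromℕ; inject₁; _↑ˡ_; _↑ʳ_; punchIn; punchOut; splitAt; join)
open import Data.Fin.Induction using (<-weakInduction; >-weakInduction)
open import Data.Fin.Patterns
import Data.Fin.Properties as Fin
open import Data.Fin.Relation.Unary.Top using (view; ‵fromℕ; ‵inject₁; view-fromℕ; view-inject₁)
open import Data.Fin.Subset using (⊤)
open import Data.Fin.Subset.Properties using (∈⊤)
open import Data.Integer.Base as ℤ using (ℤ; +_; -[1+_]; 0ℤ; 1ℤ; -1ℤ)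
open import Data.Integer.Divisibility.Signed as ℤ∣ using (divides)
import Data.Integer.Properties as ℤ
open import Data.Integer.Tactic.RingSolver using (solve-∀)
open import Data.List.Base
  using (List; []; _∷_; map; _++_; length; filter; allFin; cartesianProduct)
open import Data.List.Membership.Propositional using (_∈_; find; lose)
import Data.List.Membership.DecPropositional as DecMembership
open import Data.List.Membership.Propositional.Properties
  using (∈-map⁺; ∈-map⁻; ∈-++⁺ˡ; ∈-++⁺ʳ; ∈-++⁻; ∈-filter⁺; ∈-filter⁻; ∈-allFin; ∈-cartesianProduct⁺)
open import Data.List.Membership.Propositional.Properties.WithK using (unique∧set⇒bag)
open import Data.List.Properties using (length-map; length-++; length-tabulate)
open import Data.List.Relation.Binary.BagAndSetEquality using (∼bag⇒↭)
open import Data.List.Relation.Binary.Permutation.Propositional.Properties using (↭-length)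
open import Data.List.Relation.Unary.All as All using (_∷_)
open import Data.List.Relation.Unary.AllPairs using ([]; _∷_)
open import Data.List.Relation.Unary.Any using (here; there)
open import Data.List.Relation.Unary.Any.Properties using (any⁺; any⁻)
open import Data.List.Relation.Unary.Unique.Propositional using (Unique)
import Data.List.Relation.Unary.Unique.Propositional.Properties as Unique
open import Data.Nat.Base as ℕ using (ℕ; zero; suc; NonZero; _≥_)
open import Data.Nat.Coprimality using (Coprime; coprime-Bézout)
open import Data.Nat.Divisibility as ℕ∣ using (_∣?_)
open import Data.Nat.GCD using (module Bézout)
open import Data.Nat.Primality
  using (Prime; Composite; composite⇒nonZero; composite⇒¬prime; prime⇒nonTrivial; prime⇒irreducible;
         prime[2]; ¬composite[1])
open import Data.Nat.Primality.Factorisation using (factorise)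
import Data.Nat.Properties as ℕ
import Data.Nat.Tactic.RingSolver as ℕ-Solver
open import Data.Product using (∃; ∃₂; _×_; _,_; proj₁; proj₂; map₂)
open import Data.Product.Properties using (≡-dec)
open import Data.Sum.Base as Sum using (_⊎_; inj₁; inj₂; [_,_]′; map₁)
import Data.Unit.Base as Unit
open import Data.Vec.Base as Vec using (Vec; []; _∷_)
open import Function.Base using (_∘_; id)
open import Function.Bundles using (mk⇔)
open import Relation.Binary.Bundles using (Setoid)
open import Relation.Binary.Construct.Closure.ReflexiveTransitive as Star using (Star; _◅_; _◅◅_)
open import Relation.Binary.Definitions using (DecidableEquality)
open import Relation.Binary.PropositionalEquality as ≡ using (_≡_; _≢_; cong; cong₂; subst; subst₂)
import Relation.Binary.Reasoning.Setoid as SetoidReasoning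
open import Relation.Nullary.Decidable using (Dec; yes; no; _×-dec_; ¬?; ⌊_⌋; toWitness; fromWitness)
open import Relation.Nullary.Negation using (¬_; contradiction)

-- Trades and their connected sums

-- Why blocks and not single dipoles: a dipole with n columns already has canonical group ℤ/n, but
-- each of its black triples has value U or - U, where U is the difference of the rows and has order
-- n. Summing its white relations with a defect e at one of them gives n U = ± e, so a defect 1
-- modulo q requires n to be invertible modulo q. Two dipoles of the same order can therefore not be
-- joined without a twist in this way. In a block the condition splits into a U + 1 ≡ V and b V ≡ 0,
-- and U = 0, V = 1 is a solution when b = q. Both factors must be at least 2, since a dipole with
-- one column would have equal white and black triples; this is where compositeness enters. Taking b
-- prime keeps q prime at every joint. Then either q divides n, and b can be chosen equal to q, or q
-- is coprime to every factor of n, and a can be inverted.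

Rel3 : (X Y Z : Set) → Set₁
Rel3 X Y Z = X → Y → Z → Set

rot : ∀ {X Y Z} → Rel3 X Y Z → Rel3 Y Z X
rot W y z x = W x y z

_∖_ : ∀ {X Y Z} → Rel3 X Y Z → X × Y × Z → Rel3 X Y Z
(P ∖ (p , q , r)) x y z = P x y z × ¬ (x ≡ p × y ≡ q × z ≡ r)

Image : ∀ {X Y Z X′ Y′ Z′} → (X → X′) → (Y → Y′) → (Z → Z′) → Rel3 X Y Z → Rel3 X′ Y′ Z′
Image f g h P x y z = ∃ λ a → ∃₂ λ b c → P a b c × f a ≡ x × g b ≡ y × h c ≡ z

Rotation : ∀ {X Y Z} → (W B : Rel3 X Y Z) → X → Z → Z → Set
Rotation W B x z z′ = ∃ λ y → W x y z × B x y z′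

-- Instantiated at the row axis, Rotation is ρ-row; rotating the coordinates turns it into ρ-col
-- and ρ-sym, so that statements about one axis cover all three.
record Axis {X Y Z : Set} (W B : Rel3 X Y Z) : Set where
  field
    white-unique : ∀ {x y z z′} → W x y z → W x y z′ → z ≡ z′
    black-unique : ∀ {x y z z′} → B x y z → B x y z′ → z ≡ z′
    white-mate   : ∀ {x y z} → W x y z → ∃ λ z′ → B x y z′
    black-mate   : ∀ {x y z} → B x y z → ∃ λ z′ → W x y z′
    cycle        : ∀ {x y z y′ z′} → W x y z → W x y′ z′ → Star (Rotation W B x) z z′
    occurs       : ∀ x → ∃₂ λ y z → W x y z

-- The cyclic implications make membership of the three corners of a white triple equivalent, so
-- `P`, `Q` and `S` together form a union of components. The cyclic shape is preserved by rotating
-- the coordinates.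
IsConnected : ∀ {X Y Z} → Rel3 X Y Z → Set₁
IsConnected {X} {Y} {Z} W = ∀ (P : X → Set) (Q : Y → Set) (S : Z → Set) →
  (∀ {x y z} → W x y z → (P x → Q y) × (Q y → S z) × (S z → P x)) →
  ∀ x x′ → P x → P x′

record Trade {X Y Z : Set} (W B : Rel3 X Y Z) : Set₁ where
  field
    axis₁     : Axis W B
    axis₂     : Axis (rot W) (rot B)
    axis₃     : Axis (rot (rot W)) (rot (rot B))
    disjoint  : ∀ {x y z} → W x y z → B x y z → ⊥
    connected : IsConnected W

rotTrade : ∀ {X Y Z} {W B : Rel3 X Y Z} → Trade W B → Trade (rot W) (rot B)
rotTrade {W = W} T = record
  { axis₁     = axis₂
  ; axis₂     = axis₃
  ; axis₃     = axis₁
  ; disjoint  = disjoint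
  -- Connectivity is given for the first coordinate: a triple through `y` leads to some `x`, and a
  -- triple through `y′` leads back from `x′`.
  ; connected = λ P Q S closed y y′ Py →
      let z , x , w = Axis.occurs axis₂ y
          z′ , x′ , w′ = Axis.occurs axis₂ y′
          Py⇒Qz , Qz⇒Sx , _ = closed w
          _ , _ , Sx′⇒Py′ = closed w′
      in Sx′⇒Py′ (connected S P Q (λ u → let f , g , h = closed u in h , f , g)
                    x x′ (Qz⇒Sx (Py⇒Qz Py)))
  }
  where open Trade T

-- The disjoint union of X₁ and X₂ with the points o₁ and o₂ identified.
record Amalgam {X₁ X₂ : Set} (o₁ : X₁) (o₂ : X₂) (X : Set) : Set where
  field
    ι₁     : X₁ → X
    ι₂     : X₂ → X
    ι₁-inj : ∀ {a b} → ι₁ a ≡ ι₁ b → a ≡ b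
    ι₂-inj : ∀ {a b} → ι₂ a ≡ ι₂ b → a ≡ b
    meet   : ∀ {a b} → ι₁ a ≡ ι₂ b → a ≡ o₁ × b ≡ o₂
    glued  : ι₁ o₁ ≡ ι₂ o₂
    cover  : ∀ x → (∃ λ a → ι₁ a ≡ x) ⊎ (∃ λ b → ι₂ b ≡ x)

  -- At the glued point the value depends on the side that `cover` happens to pick, so both
  -- computation rules ask for `f o₁` and `g o₂` to agree up to the equality of the target.
  copair : ∀ {c} {A : Set c} → (X₁ → A) → (X₂ → A) → X → A
  copair f g x = [ f ∘ proj₁ , g ∘ proj₁ ]′ (cover x)

  module _ {c ℓ : Level} (A : Setoid c ℓ) where

    private module A = Setoid A

    module _ {f : X₁ → A.Carrier} {g : X₂ → A.Carrier} (f≈g : f o₁ A.≈ g o₂) where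

      copair-ι₁ : ∀ a → copair f g (ι₁ a) A.≈ f a
      copair-ι₁ a with cover (ι₁ a)
      ... | inj₁ (a′ , eq) = A.reflexive (cong f (ι₁-inj eq))
      ... | inj₂ (b , eq) with ≡.refl , ≡.refl ← meet (≡.sym eq) = A.sym f≈g

      copair-ι₂ : ∀ b → copair f g (ι₂ b) A.≈ g b
      copair-ι₂ b with cover (ι₂ b)
      ... | inj₂ (b′ , eq) = A.reflexive (cong g (ι₂-inj eq))
      ... | inj₁ (a , eq) with ≡.refl , ≡.refl ← meet eq = f≈g

Fin-amalgam : ∀ {m n} (o₁ : Fin m) (o₂ : Fin (suc n)) → Amalgam o₁ o₂ (Fin (m ℕ.+ n))
Fin-amalgam {m} {n} o₁ o₂ = record
  { ι₁ = _↑ˡ n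
  ; ι₂ = ι₂
  ; ι₁-inj = λ {a} {b} → Fin.↑ˡ-injective n a b
  ; ι₂-inj = λ {a} {b} → ι₂-inj a b
  ; meet = λ {a} {b} → meet a b
  ; glued = ≡.sym ι₂-o₂
  ; cover = cover
  }
  where
  ι₂ : Fin (suc n) → Fin (m ℕ.+ n)
  ι₂ b with o₂ Fin.≟ b
  ... | yes _  = o₁ ↑ˡ n
  ... | no ne = m ↑ʳ punchOut ne

  ι₂-o₂ : ι₂ o₂ ≡ o₁ ↑ˡ n
  ι₂-o₂ with o₂ Fin.≟ o₂
  ... | yes _ = ≡.refl
  ... | no ne = contradiction ≡.refl ne

  left≢right : ∀ {a : Fin m} {b : Fin n} → a ↑ˡ n ≢ m ↑ʳ b
  left≢right {a} {b} eq
    with () ← ≡.trans (≡.sym (Fin.splitAt-↑ˡ m a n)) (≡.trans (cong (splitAt m) eq) (Fin.splitAt-↑ʳ m n b))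

  ι₂-inj : ∀ a b → ι₂ a ≡ ι₂ b → a ≡ b
  ι₂-inj a b eq with o₂ Fin.≟ a | o₂ Fin.≟ b
  ... | yes ≡.refl | yes ≡.refl = ≡.refl
  ... | yes _    | no _     = contradiction eq left≢right
  ... | no _     | yes _    = contradiction (≡.sym eq) left≢right
  ... | no p     | no q     = Fin.punchOut-injective p q (Fin.↑ʳ-injective m _ _ eq)

  meet : ∀ a b → a ↑ˡ n ≡ ι₂ b → a ≡ o₁ × b ≡ o₂
  meet a b eq with o₂ Fin.≟ b
  ... | yes ≡.refl = Fin.↑ˡ-injective n a o₁ eq , ≡.refl
  ... | no _     = contradiction eq left≢right

  ι₂-punchIn : ∀ j → ι₂ (punchIn o₂ j) ≡ m ↑ʳ j
  ι₂-punchIn j with o₂ Fin.≟ punchIn o₂ j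
  ... | yes eq = contradiction (≡.sym eq) (Fin.punchInᵢ≢i o₂ j)
  ... | no ne = cong (m ↑ʳ_) (≡.trans (Fin.punchOut-cong o₂ ≡.refl) (Fin.punchOut-punchIn o₂))

  cover : ∀ x → (∃ λ a → a ↑ˡ n ≡ x) ⊎ (∃ λ b → ι₂ b ≡ x)
  cover x with splitAt m x in eq
  ... | inj₁ a = inj₁ (a , ≡.trans (cong (join m n) (≡.sym eq)) (Fin.join-splitAt m n x))
  ... | inj₂ j = inj₂ (punchIn o₂ j ,
                   ≡.trans (ι₂-punchIn j) (≡.trans (cong (join m n) (≡.sym eq)) (Fin.join-splitAt m n x)))

module _ {X₁ X₂ X Y₁ Y₂ Y Z₁ Z₂ Z : Set}
         {x₁ : X₁} {x₂ : X₂} {y₁ : Y₁} {y₂ : Y₂} {z₁ : Z₁} {z₂ : Z₂}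
         (𝒳 : Amalgam x₁ x₂ X) (𝒴 : Amalgam y₁ y₂ Y) (𝒵 : Amalgam z₁ z₂ Z) where

  private
    module X = Amalgam 𝒳
    module Y = Amalgam 𝒴
    module Z = Amalgam 𝒵

  -- (W , B) is the connected sum of (W₁ , B₁) and (W₂ , B₂): the black triple
  -- (x₁ , y₁ , z₁) is cut out of the first sphere and the white triple
  -- (x₂ , y₂ , z₂) out of the second one.
  record IsSum (W₁ B₁ : Rel3 X₁ Y₁ Z₁) (W₂ B₂ : Rel3 X₂ Y₂ Z₂) (W B : Rel3 X Y Z) : Set where
    field
      black-mark : B₁ x₁ y₁ z₁
      white-mark : W₂ x₂ y₂ z₂
      white₁ : ∀ {x y z} → W₁ x y z → W (X.ι₁ x) (Y.ι₁ y) (Z.ι₁ z)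
      white₂ : ∀ {x y z} → W₂ x y z →
               (x ≡ x₂ × y ≡ y₂ × z ≡ z₂) ⊎ W (X.ι₂ x) (Y.ι₂ y) (Z.ι₂ z)
      black₁ : ∀ {x y z} → B₁ x y z →
               (x ≡ x₁ × y ≡ y₁ × z ≡ z₁) ⊎ B (X.ι₁ x) (Y.ι₁ y) (Z.ι₁ z)
      black₂ : ∀ {x y z} → B₂ x y z → B (X.ι₂ x) (Y.ι₂ y) (Z.ι₂ z)
      white⁻ : ∀ {x y z} → W x y z →
               Image X.ι₁ Y.ι₁ Z.ι₁ W₁ x y z ⊎ Image X.ι₂ Y.ι₂ Z.ι₂ (W₂ ∖ (x₂ , y₂ , z₂)) x y z
      black⁻ : ∀ {x y z} → B x y z →
               Image X.ι₁ Y.ι₁ Z.ι₁ (B₁ ∖ (x₁ , y₁ , z₁)) x y z ⊎ Image X.ι₂ Y.ι₂ Z.ι₂ B₂ x y z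

rotSum : ∀ {X₁ X₂ X Y₁ Y₂ Y Z₁ Z₂ Z : Set}
         {x₁ : X₁} {x₂ : X₂} {y₁ : Y₁} {y₂ : Y₂} {z₁ : Z₁} {z₂ : Z₂}
         {𝒳 : Amalgam x₁ x₂ X} {𝒴 : Amalgam y₁ y₂ Y} {𝒵 : Amalgam z₁ z₂ Z}
         {W₁ B₁ W₂ B₂ W B} → IsSum 𝒳 𝒴 𝒵 W₁ B₁ W₂ B₂ W B →
         IsSum 𝒴 𝒵 𝒳 (rot W₁) (rot B₁) (rot W₂) (rot B₂) (rot W) (rot B)
rotSum S = record
  { black-mark = black-mark
  ; white-mark = white-mark
  ; white₁ = white₁
  ; white₂ = λ w → Sum.map₁ (λ (p , q , r) → q , r , p) (white₂ w)
  ; black₁ = λ b → Sum.map₁ (λ (p , q , r) → q , r , p) (black₁ b)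
  ; black₂ = black₂
  ; white⁻ = λ w → Sum.map
      (λ (a , b , c , w , p , q , r) → b , c , a , w , q , r , p)
      (λ (a , b , c , (w , ne) , p , q , r) → b , c , a , (w , λ (q , r , p) → ne (p , q , r)) , q , r , p)
      (white⁻ w)
  ; black⁻ = λ w → Sum.map
      (λ (a , b , c , (w , ne) , p , q , r) → b , c , a , (w , λ (q , r , p) → ne (p , q , r)) , q , r , p)
      (λ (a , b , c , w , p , q , r) → b , c , a , w , q , r , p)
      (black⁻ w)
  }
  where open IsSum S

module _ {X₁ X₂ X Y₁ Y₂ Y Z₁ Z₂ Z : Set}
         {x₁ : X₁} {x₂ : X₂} {y₁ : Y₁} {y₂ : Y₂} {z₁ : Z₁} {z₂ : Z₂}
         {𝒳 : Amalgam x₁ x₂ X} {𝒴 : Amalgam y₁ y₂ Y} {𝒵 : Amalgam z₁ z₂ Z}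
         {W₁ B₁ W₂ B₂ W B} (T₁ : Trade W₁ B₁) (T₂ : Trade W₂ B₂)
         (S : IsSum 𝒳 𝒴 𝒵 W₁ B₁ W₂ B₂ W B) where

  private
    module X = Amalgam 𝒳
    module Y = Amalgam 𝒴
    module Z = Amalgam 𝒵
    module T₁ = Trade T₁
    module T₂ = Trade T₂
    module A₁ = Axis T₁.axis₁
    module A₂ = Axis T₂.axis₁
    open IsSum S

    ρ₁ = Rotation W₁ B₁
    ρ₂ = Rotation W₂ B₂
    ρ = Rotation W B

    step₂ : ∀ {x z z′} → ρ₂ x z z′ → (x ≡ x₂ × z ≡ z₂) ⊎ ρ (X.ι₂ x) (Z.ι₂ z) (Z.ι₂ z′)
    step₂ (y , w , b) with white₂ w
    ... | inj₁ (p , _ , r) = inj₁ (p , r)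
    ... | inj₂ w′          = inj₂ (Y.ι₂ y , w′ , black₂ b)

    -- The only step lost in the second sphere starts at `z₂`, so a walk towards `z₂` can stop when
    -- it would need that step.
    back : ∀ {z} → Star (ρ₂ x₂) z z₂ → Star (ρ (X.ι₂ x₂)) (Z.ι₂ z) (Z.ι₂ z₂)
    back Star.ε = Star.ε
    back (s ◅ ss) with step₂ s
    ... | inj₁ (_ , ≡.refl) = Star.ε
    ... | inj₂ s′         = s′ ◅ back ss

    -- In the marked row the permutation of the sum splices two cycles. Where the first cycle used
    -- the removed black triple, it now enters the second sphere at the black mate of the white mark
    -- and runs round to `z₂`, which is glued to `z₁`.
    detour : ∃ λ z → B₂ x₂ y₂ z × Star (ρ (X.ι₂ x₂)) (Z.ι₂ z) (Z.ι₂ z₂)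
    detour =
      let z , b = A₂.white-mate white-mark
          _ , w = Axis.black-mate T₂.axis₃ b
      in z , b , back (A₂.cycle w white-mark)

    step₁ : ∀ {x z z′} → ρ₁ x z z′ → Star (ρ (X.ι₁ x)) (Z.ι₁ z) (Z.ι₁ z′)
    step₁ (y , w , b) with black₁ b
    ... | inj₂ b′ = (Y.ι₁ y , white₁ w , b′) ◅ Star.ε
    ... | inj₁ (≡.refl , ≡.refl , ≡.refl) =
      let z , b₂ , ss = detour in
      (Y.ι₁ y₁ , white₁ w , subst₂ (λ x y → B x y (Z.ι₂ z)) (≡.sym X.glued) (≡.sym Y.glued) (black₂ b₂))
      ◅ subst₂ (λ x z′ → Star (ρ x) (Z.ι₂ z) z′) (≡.sym X.glued) (≡.sym Z.glued) ss

    path₁ : ∀ {x z z′} → Star (ρ₁ x) z z′ → Star (ρ (X.ι₁ x)) (Z.ι₁ z) (Z.ι₁ z′)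
    path₁ Star.ε        = Star.ε
    path₁ (s ◅ ss) = step₁ s ◅◅ path₁ ss

    path₂ : ∀ {x z z′} → Star (ρ₂ x) z z′ → Star (ρ (X.ι₂ x)) (Z.ι₂ z) (Z.ι₂ z′)
    path₂ Star.ε = Star.ε
    path₂ {x} {z} (_◅_ {j = z″} (y , w , b) ss) with white₂ w
    ... | inj₂ w′ = (Y.ι₂ y , w′ , black₂ b) ◅ path₂ ss
    -- The step left `z₂` through the removed white triple. Instead the cycle of the first sphere is
    -- run from `z₁` to the symbol `p` of the white mate of the black mark, whose triple is now
    -- paired with `b`.
    ... | inj₁ (≡.refl , ≡.refl , ≡.refl) =
      let p , w₁ = A₁.black-mate black-mark
          _ , w₂ = Axis.black-mate T₁.axis₃ black-mark
      in subst₂ (λ x z → Star (ρ x) z (Z.ι₁ p)) X.glued Z.glued (path₁ (A₁.cycle w₂ w₁))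
         ◅◅ (Y.ι₂ y₂ , subst₂ (λ x y → W x y (Z.ι₁ p)) X.glued Y.glued (white₁ w₁) , black₂ b)
         ◅ path₂ ss

    mark-cycle₁ : ∀ {y z} → W₁ x₁ y z → Star (ρ (X.ι₁ x₁)) (Z.ι₁ z) (Z.ι₁ z₁) ×
                                        Star (ρ (X.ι₁ x₁)) (Z.ι₁ z₁) (Z.ι₁ z)
    mark-cycle₁ w = let _ , w₁ = Axis.black-mate T₁.axis₃ black-mark in
      path₁ (A₁.cycle w w₁) , path₁ (A₁.cycle w₁ w)

    mark-cycle₂ : ∀ {y z} → W₂ x₂ y z → Star (ρ (X.ι₂ x₂)) (Z.ι₂ z) (Z.ι₂ z₂) ×
                                        Star (ρ (X.ι₂ x₂)) (Z.ι₂ z₂) (Z.ι₂ z)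
    mark-cycle₂ w = path₂ (A₂.cycle w white-mark) , path₂ (A₂.cycle white-mark w)

    -- Triples of different halves can share only an edge of the seam, and the white triple of the
    -- second sphere on that edge is the removed one.
    unmarked : ∀ {a b c x y z} → W₁ a b c → W₂ x y z → ¬ (x ≡ x₂ × y ≡ y₂ × z ≡ z₂) →
               X.ι₁ a ≡ X.ι₂ x → Y.ι₁ b ≡ Y.ι₂ y → ⊥
    unmarked w w′ ne p q with ≡.refl , ≡.refl ← X.meet p | ≡.refl , ≡.refl ← Y.meet q =
      ne (≡.refl , ≡.refl , A₂.white-unique w′ white-mark)

    unmarkedᵇ : ∀ {a b c x y z} → B₁ a b c → ¬ (a ≡ x₁ × b ≡ y₁ × c ≡ z₁) → B₂ x y z →
                X.ι₁ a ≡ X.ι₂ x → Y.ι₁ b ≡ Y.ι₂ y → ⊥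
    unmarkedᵇ w ne w′ p q with ≡.refl , ≡.refl ← X.meet p | ≡.refl , ≡.refl ← Y.meet q =
      ne (≡.refl , ≡.refl , A₁.black-unique w black-mark)

  sum-axis : Axis W B
  sum-axis = record
    { white-unique = λ w w′ → white-unique (white⁻ w) (white⁻ w′)
    ; black-unique = λ b b′ → black-unique (black⁻ b) (black⁻ b′)
    ; white-mate   = λ w → white-mate (white⁻ w)
    ; black-mate   = λ b → black-mate (black⁻ b)
    ; cycle        = λ w w′ → cycle (white⁻ w) (white⁻ w′)
    ; occurs       = occurs
    }
    where
    I₁ = Image X.ι₁ Y.ι₁ Z.ι₁
    I₂ = Image X.ι₂ Y.ι₂ Z.ι₂
    W₂° = W₂ ∖ (x₂ , y₂ , z₂)
    B₁° = B₁ ∖ (x₁ , y₁ , z₁)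

    white-unique : ∀ {x y z z′} → I₁ W₁ x y z ⊎ I₂ W₂° x y z → I₁ W₁ x y z′ ⊎ I₂ W₂° x y z′ → z ≡ z′
    white-unique (inj₁ (a , b , c , w , p , q , ≡.refl)) (inj₁ (a′ , b′ , c′ , w′ , p′ , q′ , ≡.refl))
      with ≡.refl ← X.ι₁-inj (≡.trans p (≡.sym p′)) | ≡.refl ← Y.ι₁-inj (≡.trans q (≡.sym q′)) =
      cong Z.ι₁ (A₁.white-unique w w′)
    white-unique (inj₂ (a , b , c , (w , _) , p , q , ≡.refl)) (inj₂ (a′ , b′ , c′ , (w′ , _) , p′ , q′ , ≡.refl))
      with ≡.refl ← X.ι₂-inj (≡.trans p (≡.sym p′)) | ≡.refl ← Y.ι₂-inj (≡.trans q (≡.sym q′)) =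
      cong Z.ι₂ (A₂.white-unique w w′)
    white-unique (inj₁ (_ , _ , _ , w , p , q , _)) (inj₂ (_ , _ , _ , (w′ , ne) , p′ , q′ , _)) =
      ⊥-elim (unmarked w w′ ne (≡.trans p (≡.sym p′)) (≡.trans q (≡.sym q′)))
    white-unique (inj₂ (_ , _ , _ , (w′ , ne) , p′ , q′ , _)) (inj₁ (_ , _ , _ , w , p , q , _)) =
      ⊥-elim (unmarked w w′ ne (≡.trans p (≡.sym p′)) (≡.trans q (≡.sym q′)))

    black-unique : ∀ {x y z z′} → I₁ B₁° x y z ⊎ I₂ B₂ x y z → I₁ B₁° x y z′ ⊎ I₂ B₂ x y z′ → z ≡ z′
    black-unique (inj₁ (a , b , c , (w , _) , p , q , ≡.refl)) (inj₁ (a′ , b′ , c′ , (w′ , _) , p′ , q′ , ≡.refl))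
      with ≡.refl ← X.ι₁-inj (≡.trans p (≡.sym p′)) | ≡.refl ← Y.ι₁-inj (≡.trans q (≡.sym q′)) =
      cong Z.ι₁ (A₁.black-unique w w′)
    black-unique (inj₂ (a , b , c , w , p , q , ≡.refl)) (inj₂ (a′ , b′ , c′ , w′ , p′ , q′ , ≡.refl))
      with ≡.refl ← X.ι₂-inj (≡.trans p (≡.sym p′)) | ≡.refl ← Y.ι₂-inj (≡.trans q (≡.sym q′)) =
      cong Z.ι₂ (A₂.black-unique w w′)
    black-unique (inj₁ (_ , _ , _ , (w , ne) , p , q , _)) (inj₂ (_ , _ , _ , w′ , p′ , q′ , _)) =
      ⊥-elim (unmarkedᵇ w ne w′ (≡.trans p (≡.sym p′)) (≡.trans q (≡.sym q′)))
    black-unique (inj₂ (_ , _ , _ , w′ , p′ , q′ , _)) (inj₁ (_ , _ , _ , (w , ne) , p , q , _)) =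
      ⊥-elim (unmarkedᵇ w ne w′ (≡.trans p (≡.sym p′)) (≡.trans q (≡.sym q′)))

    white-mate : ∀ {x y z} → I₁ W₁ x y z ⊎ I₂ W₂° x y z → ∃ λ z′ → B x y z′
    white-mate (inj₂ (_ , _ , _ , (w , _) , ≡.refl , ≡.refl , _)) = _ , black₂ (proj₂ (A₂.white-mate w))
    white-mate (inj₁ (_ , _ , _ , w , ≡.refl , ≡.refl , _)) with black₁ (proj₂ (A₁.white-mate w))
    ... | inj₂ b = _ , b
    ... | inj₁ (≡.refl , ≡.refl , _) = let z , b = A₂.white-mate white-mark in
      Z.ι₂ z , subst₂ (λ x y → B x y (Z.ι₂ z)) (≡.sym X.glued) (≡.sym Y.glued) (black₂ b)

    black-mate : ∀ {x y z} → I₁ B₁° x y z ⊎ I₂ B₂ x y z → ∃ λ z′ → W x y z′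
    black-mate (inj₁ (_ , _ , _ , (b , _) , ≡.refl , ≡.refl , _)) = _ , white₁ (proj₂ (A₁.black-mate b))
    black-mate (inj₂ (_ , _ , _ , b , ≡.refl , ≡.refl , _)) with white₂ (proj₂ (A₂.black-mate b))
    ... | inj₂ w = _ , w
    ... | inj₁ (≡.refl , ≡.refl , _) = let z , w = A₁.black-mate black-mark in
      Z.ι₁ z , subst₂ (λ x y → W x y (Z.ι₁ z)) X.glued Y.glued (white₁ w)

    cycle : ∀ {x y z y′ z′} → I₁ W₁ x y z ⊎ I₂ W₂° x y z → I₁ W₁ x y′ z′ ⊎ I₂ W₂° x y′ z′ →
            Star (ρ x) z z′
    cycle (inj₁ (_ , _ , _ , w , ≡.refl , _ , ≡.refl)) (inj₁ (_ , _ , _ , w′ , p , _ , ≡.refl))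
      with ≡.refl ← X.ι₁-inj p = path₁ (A₁.cycle w w′)
    cycle (inj₂ (_ , _ , _ , (w , _) , ≡.refl , _ , ≡.refl)) (inj₂ (_ , _ , _ , (w′ , _) , p , _ , ≡.refl))
      with ≡.refl ← X.ι₂-inj p = path₂ (A₂.cycle w w′)
    cycle (inj₁ (_ , _ , c , w , ≡.refl , _ , ≡.refl)) (inj₂ (_ , _ , c′ , (w′ , _) , p , _ , ≡.refl))
      with ≡.refl , ≡.refl ← X.meet (≡.sym p) =
      proj₁ (mark-cycle₁ w) ◅◅
      subst₂ (λ x z → Star (ρ x) z (Z.ι₂ c′)) (≡.sym X.glued) (≡.sym Z.glued) (proj₂ (mark-cycle₂ w′))
    cycle (inj₂ (_ , _ , c′ , (w′ , _) , ≡.refl , _ , ≡.refl)) (inj₁ (_ , _ , c , w , p , _ , ≡.refl))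
      with ≡.refl , ≡.refl ← X.meet p =
      proj₁ (mark-cycle₂ w′) ◅◅
      subst₂ (λ x z → Star (ρ x) z (Z.ι₁ c)) X.glued Z.glued (proj₂ (mark-cycle₁ w))

    occurs : ∀ x → ∃₂ λ y z → W x y z
    occurs x with X.cover x
    ... | inj₁ (a , ≡.refl) = let _ , _ , w = A₁.occurs a in _ , _ , white₁ w
    ... | inj₂ (b , ≡.refl) with A₂.occurs b
    ...   | _ , _ , w with white₂ w
    ...     | inj₂ w′ = _ , _ , w′
    ...     | inj₁ (≡.refl , _) = let y , z , w = A₁.occurs x₁ in
      Y.ι₁ y , Z.ι₁ z , subst (λ x → W x (Y.ι₁ y) (Z.ι₁ z)) X.glued (white₁ w)

sum : ∀ {X₁ X₂ X Y₁ Y₂ Y Z₁ Z₂ Z : Set}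
      {x₁ : X₁} {x₂ : X₂} {y₁ : Y₁} {y₂ : Y₂} {z₁ : Z₁} {z₂ : Z₂}
      {𝒳 : Amalgam x₁ x₂ X} {𝒴 : Amalgam y₁ y₂ Y} {𝒵 : Amalgam z₁ z₂ Z}
      {W₁ B₁ W₂ B₂ W B} → Trade W₁ B₁ → Trade W₂ B₂ →
      IsSum 𝒳 𝒴 𝒵 W₁ B₁ W₂ B₂ W B → Trade W B
sum {x₁ = x₁} {x₂} {y₁} {y₂} {z₁} {z₂} {𝒳} {𝒴} {𝒵} {W₁} {B₁} {W₂} {B₂} {W} {B} T₁ T₂ S = record
  { axis₁     = sum-axis T₁ T₂ S
  ; axis₂     = sum-axis (rotTrade T₁) (rotTrade T₂) (rotSum S)
  ; axis₃     = sum-axis (rotTrade (rotTrade T₁)) (rotTrade (rotTrade T₂)) (rotSum (rotSum S))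
  ; disjoint  = λ w b → disjoint (white⁻ w) (black⁻ b)
  ; connected = connected
  }
  where
  open IsSum S
  module X = Amalgam 𝒳
  module Y = Amalgam 𝒴
  module Z = Amalgam 𝒵
  module T₁ = Trade T₁
  module T₂ = Trade T₂

  disjoint : ∀ {x y z} →
    Image X.ι₁ Y.ι₁ Z.ι₁ W₁ x y z ⊎ Image X.ι₂ Y.ι₂ Z.ι₂ (W₂ ∖ (x₂ , y₂ , z₂)) x y z →
    Image X.ι₁ Y.ι₁ Z.ι₁ (B₁ ∖ (x₁ , y₁ , z₁)) x y z ⊎ Image X.ι₂ Y.ι₂ Z.ι₂ B₂ x y z → ⊥
  disjoint (inj₁ (_ , _ , _ , w , ≡.refl , ≡.refl , ≡.refl)) (inj₁ (_ , _ , _ , (b , _) , p , q , r))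
    with ≡.refl ← X.ι₁-inj p | ≡.refl ← Y.ι₁-inj q | ≡.refl ← Z.ι₁-inj r = T₁.disjoint w b
  disjoint (inj₂ (_ , _ , _ , (w , _) , ≡.refl , ≡.refl , ≡.refl)) (inj₂ (_ , _ , _ , b , p , q , r))
    with ≡.refl ← X.ι₂-inj p | ≡.refl ← Y.ι₂-inj q | ≡.refl ← Z.ι₂-inj r = T₂.disjoint w b
  disjoint (inj₁ (_ , _ , _ , w , ≡.refl , ≡.refl , ≡.refl)) (inj₂ (_ , _ , _ , b , p , q , r))
    with ≡.refl , ≡.refl ← X.meet (≡.sym p) | ≡.refl , ≡.refl ← Y.meet (≡.sym q) | ≡.refl , ≡.refl ← Z.meet (≡.sym r) =
    T₁.disjoint w black-mark
  disjoint (inj₂ (_ , _ , _ , (w , ne) , ≡.refl , ≡.refl , ≡.refl)) (inj₁ (_ , _ , _ , b , p , q , r))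
    with ≡.refl , ≡.refl ← X.meet p | ≡.refl , ≡.refl ← Y.meet q | ≡.refl , ≡.refl ← Z.meet r =
    ne (≡.refl , ≡.refl , ≡.refl)

  connected : IsConnected W
  connected P Q R closed x x′ Px = from-mark x′ (to-mark x Px)
    where
    conn₁ : ∀ a b → P (X.ι₁ a) → P (X.ι₁ b)
    conn₁ = T₁.connected (P ∘ X.ι₁) (Q ∘ Y.ι₁) (R ∘ Z.ι₁) (λ w → closed (white₁ w))

    -- The removed white triple related the three corners of the seam. The first sphere relates them
    -- as well: a white triple on the edge of `y₁` and `z₁` does it for two of them, and
    -- connectivity joins its row to `x₁`.
    around : (P (X.ι₁ x₁) → Q (Y.ι₁ y₁)) × (Q (Y.ι₁ y₁) → R (Z.ι₁ z₁)) × (R (Z.ι₁ z₁) → P (X.ι₁ x₁))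
    around =
      let a , w = Axis.black-mate T₁.axis₂ black-mark
          f , g , h = closed (white₁ w)
      in (λ p → f (conn₁ x₁ a p)) , g , (λ r → conn₁ a x₁ (h r))

    closed₂ : ∀ {a b c} → W₂ a b c → (P (X.ι₂ a) → Q (Y.ι₂ b)) × (Q (Y.ι₂ b) → R (Z.ι₂ c)) ×
                                     (R (Z.ι₂ c) → P (X.ι₂ a))
    closed₂ w with white₂ w
    ... | inj₂ w′ = closed w′
    ... | inj₁ (≡.refl , ≡.refl , ≡.refl) = let f , g , h = around in
      subst₂ (λ x y → P x → Q y) X.glued Y.glued f ,
      subst₂ (λ x y → Q x → R y) Y.glued Z.glued g ,
      subst₂ (λ x y → R x → P y) Z.glued X.glued h

    conn₂ : ∀ a b → P (X.ι₂ a) → P (X.ι₂ b)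
    conn₂ = T₂.connected (P ∘ X.ι₂) (Q ∘ Y.ι₂) (R ∘ Z.ι₂) closed₂

    to-mark : ∀ x → P x → P (X.ι₁ x₁)
    to-mark x p with X.cover x
    ... | inj₁ (a , ≡.refl) = conn₁ a x₁ p
    ... | inj₂ (b , ≡.refl) = subst P (≡.sym X.glued) (conn₂ b x₂ p)

    from-mark : ∀ x → P (X.ι₁ x₁) → P x
    from-mark x p with X.cover x
    ... | inj₁ (a , ≡.refl) = conn₁ x₁ a p
    ... | inj₂ (b , ≡.refl) = conn₂ x₂ b (subst P X.glued p)

private variable
  A A′ : Set

-- Enumerations and spherical bitrades

-- The relations are predicates without a chosen decision procedure. A duplicate-free list supplies
-- both the Boolean triple sets, through decidable membership, and the cardinalities.
record Enumeration {A : Set} (P : A → Set) (N : ℕ) : Set where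
  field
    list     : List A
    unique   : Unique list
    sound    : ∀ {x} → x ∈ list → P x
    complete : ∀ {x} → P x → x ∈ list
    length≡  : length list ≡ N

same-length : {xs ys : List A} → Unique xs → Unique ys →
              (∀ {x} → x ∈ xs → x ∈ ys) → (∀ {x} → x ∈ ys → x ∈ xs) → length xs ≡ length ys
same-length u v f g = ↭-length (∼bag⇒↭ (unique∧set⇒bag u v (mk⇔ f g)))

enum-cong : ∀ {P Q : A → Set} {N} → (∀ {x} → P x → Q x) → (∀ {x} → Q x → P x) →
            Enumeration P N → Enumeration Q N
enum-cong f g E = record
  { list = list ; unique = unique ; sound = f ∘ sound ; complete = complete ∘ g ; length≡ = length≡ }
  where open Enumeration E

unique-map : {xs : List A} (f : A → A′) → (∀ {x y} → x ∈ xs → y ∈ xs → f x ≡ f y → x ≡ y) →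
             Unique xs → Unique (map f xs)
unique-map f f-inj []       = []
unique-map f f-inj (x∉ ∷ u) =
  All.tabulate (λ y∈ fx≡y → let z , z∈ , y≡fz = ∈-map⁻ f y∈ in
    All.lookup x∉ z∈ (f-inj (here ≡.refl) (there z∈) (≡.trans fx≡y y≡fz)))
  ∷ unique-map f (λ x∈ y∈ → f-inj (there x∈) (there y∈)) u

enum-image : ∀ {P : A → Set} {N} (f : A → A′) → (∀ {x y} → P x → P y → f x ≡ f y → x ≡ y) →
             Enumeration P N → Enumeration (λ y → ∃ λ x → P x × f x ≡ y) N
enum-image f f-inj E = record
  { list     = map f list
  ; unique   = unique-map f (λ x∈ y∈ → f-inj (sound x∈) (sound y∈)) unique
  ; sound    = λ y∈ → let x , x∈ , eq = ∈-map⁻ f y∈ in x , sound x∈ , ≡.sym eq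
  ; complete = λ { (x , p , ≡.refl) → ∈-map⁺ f (complete p) }
  ; length≡  = ≡.trans (length-map f list) length≡
  }
  where open Enumeration E

enum-⊎ : ∀ {P Q : A → Set} {M N} → (∀ {x} → P x → Q x → ⊥) →
         Enumeration P M → Enumeration Q N → Enumeration (λ x → P x ⊎ Q x) (M ℕ.+ N)
enum-⊎ P∩Q=∅ E F = record
  { list     = E.list ++ F.list
  ; unique   = Unique.++⁺ E.unique F.unique (λ (p , q) → P∩Q=∅ (E.sound p) (F.sound q))
  ; sound    = λ x∈ → Sum.map E.sound F.sound (∈-++⁻ E.list x∈)
  ; complete = λ { (inj₁ p) → ∈-++⁺ˡ (E.complete p) ; (inj₂ q) → ∈-++⁺ʳ E.list (F.complete q) }
  ; length≡  = ≡.trans (length-++ E.list) (cong₂ ℕ._+_ E.length≡ F.length≡)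
  }
  where
  module E = Enumeration E
  module F = Enumeration F

enum-delete : ∀ {P : A → Set} {N} → DecidableEquality A → (a : A) → P a →
              Enumeration P (suc N) → Enumeration (λ x → P x × x ≢ a) N
enum-delete {P = P} _≟_ a Pa E = record
  { list     = rest
  ; unique   = rest-unique
  ; sound    = λ x∈ → let x∈list , x≢a = ∈-filter⁻ ≢a? {xs = list} x∈ in sound x∈list , x≢a
  ; complete = λ (p , x≢a) → ∈-filter⁺ ≢a? (complete p) x≢a
  ; length≡  = ℕ.suc-injective (≡.trans (same-length a∷rest-unique unique to from) length≡)
  }
  where
  open Enumeration E
  ≢a? : ∀ x → Dec (x ≢ a)
  ≢a? x = ¬? (x ≟ a)
  rest : List _
  rest = filter ≢a? list
  rest-unique : Unique rest
  rest-unique = Unique.filter⁺ ≢a? unique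
  a∷rest-unique : Unique (a ∷ rest)
  a∷rest-unique = All.tabulate (λ x∈ a≡x → proj₂ (∈-filter⁻ ≢a? {xs = list} x∈) (≡.sym a≡x)) ∷ rest-unique
  to : ∀ {x} → x ∈ a ∷ rest → x ∈ list
  to (here ≡.refl) = complete Pa
  to (there x∈)  = proj₁ (∈-filter⁻ ≢a? {xs = list} x∈)
  from : ∀ {x} → x ∈ list → x ∈ a ∷ rest
  from {x} x∈ with x ≟ a
  ... | yes ≡.refl = here ≡.refl
  ... | no x≢a   = there (∈-filter⁺ ≢a? x∈ x≢a)

enum-nonzero : ∀ {P : A → Set} → Enumeration P 0 → ∀ {x} → P x → ⊥
enum-nonzero record { list = [] ; complete = complete } p with () ← complete p

length-cartesianProduct : ∀ (xs : List A) (ys : List A′) →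
                          length (cartesianProduct xs ys) ≡ length xs ℕ.* length ys
length-cartesianProduct []       ys = ≡.refl
length-cartesianProduct (x ∷ xs) ys = ≡.trans (length-++ (map (x ,_) ys))
  (cong₂ ℕ._+_ (length-map (x ,_) ys) (length-cartesianProduct xs ys))

enum-Fin² : ∀ m n → Enumeration {Fin m × Fin n} (λ _ → Unit.⊤) (m ℕ.* n)
enum-Fin² m n = record
  { list     = cartesianProduct (allFin m) (allFin n)
  ; unique   = Unique.cartesianProduct⁺ (Unique.allFin⁺ m) (Unique.allFin⁺ n)
  ; sound    = _
  ; complete = λ _ → ∈-cartesianProduct⁺ (∈-allFin _) (∈-allFin _)
  ; length≡  = ≡.trans (length-cartesianProduct (allFin m) (allFin n))
                     (cong₂ ℕ._*_ (length-tabulate {n = m} id) (length-tabulate {n = n} id))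
  }

count-enum : ∀ {P : A → Set} {N} (p : A → Bool) (xs : List A) →
             Unique xs → (∀ x → x ∈ xs) → (∀ {x} → T (p x) → P x) → (∀ {x} → P x → T (p x)) →
             Enumeration P N → count p xs ≡ N
count-enum p xs u all f g E = ≡.trans (same-length (Unique.filter⁺ (T? ∘ p) u) unique
    (λ x∈ → complete (f (proj₂ (∈-filter⁻ (T? ∘ p) {xs = xs} x∈))))
    (λ x∈ → ∈-filter⁺ (T? ∘ p) (all _) (g (sound x∈)))) length≡
  where open Enumeration E

⟪_⟫ : ∀ {X Y Z : Set} → Rel3 X Y Z → X × Y × Z → Set
⟪ W ⟫ (x , y , z) = W x y z

_≟ₜ_ : ∀ {l m n} → DecidableEquality (Triple l m n)
_≟ₜ_ = ≡-dec Fin._≟_ (≡-dec Fin._≟_ Fin._≟_)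

tripleSet : ∀ {l m n N} {W : Rel3 (Fin l) (Fin m) (Fin n)} → Enumeration ⟪ W ⟫ N → TripleSet l m n
tripleSet E t = ⌊ DecMembership._∈?_ _≟ₜ_ t (Enumeration.list E) ⌋

module _ {l m n N : ℕ} {W : Rel3 (Fin l) (Fin m) (Fin n)} (E : Enumeration ⟪ W ⟫ N) where

  ∈-tripleSet⁺ : ∀ {r c s} → W r c s → (r , c , s) ∈ₜ tripleSet E
  ∈-tripleSet⁺ w = fromWitness (Enumeration.complete E w)

  ∈-tripleSet⁻ : ∀ {r c s} → (r , c , s) ∈ₜ tripleSet E → W r c s
  ∈-tripleSet⁻ t = Enumeration.sound E (toWitness t)

count-triples : ∀ {l m n N} {W : Rel3 (Fin l) (Fin m) (Fin n)} (E : Enumeration ⟪ W ⟫ N) →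
                size (tripleSet E) ≡ N
count-triples {l} {m} {n} E = count-enum (tripleSet E) _
  (Unique.cartesianProduct⁺ (Unique.allFin⁺ l) (Unique.cartesianProduct⁺ (Unique.allFin⁺ m) (Unique.allFin⁺ n)))
  (λ (x , y , z) → ∈-cartesianProduct⁺ (∈-allFin x) (∈-cartesianProduct⁺ (∈-allFin y) (∈-allFin z)))
  (∈-tripleSet⁻ E) (∈-tripleSet⁺ E) E

any-Fin⁺ : ∀ {n} {p : Fin n → Bool} i → T (p i) → T (any p (allFin n))
any-Fin⁺ i t = any⁺ _ (lose (∈-allFin i) t)

any-Fin⁻ : ∀ {n} {p : Fin n → Bool} → T (any p (allFin n)) → ∃ λ i → T (p i)
any-Fin⁻ {n} {p} t = let i , _ , t′ = find (any⁻ p (allFin n) t) in i , t′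

-- Mates taken inside the subtrade coincide with those of the whole trade by uniqueness, so the
-- subtrade is carried along the rotation at `x`; this is a single cycle and meets every white
-- triple at `x`.
subtrade-closed : ∀ {X Y Z : Set} {W B : Rel3 X Y Z} (A : Axis W B) →
  (∀ {x y y′ z} → W x y z → W x y′ z → y ≡ y′) →
  (W′ B′ : Rel3 X Y Z) →
  (∀ {x y z} → W′ x y z → W x y z) → (∀ {x y z} → B′ x y z → B x y z) →
  (∀ {x y z} → W′ x y z → ∃ λ z′ → B′ x y z′) → (∀ {x y z} → B′ x y z → ∃ λ y′ → W′ x y′ z) →
  ∀ {x y z y′ z′} → W′ x y z → W x y′ z′ → W′ x y′ z′
subtrade-closed {W = W} {B} A unique W′ B′ W′⊆W B′⊆B mateʷ mateᵇ w′ w =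
  let y , u = walk (cycle (W′⊆W w′) w) w′ in subst (λ y → W′ _ y _) (unique (W′⊆W u) w) u
  where
  open Axis A
  walk : ∀ {x y z z′} → Star (Rotation W B x) z z′ → W′ x y z → ∃ λ y′ → W′ x y′ z′
  walk Star.ε w = _ , w
  walk ((y , w , b) ◅ ss) w′ with ≡.refl ← unique w (W′⊆W w′) =
    let _ , b′ = mateʷ w′
        _ , w″ = mateᵇ b′
    in walk ss (subst (W′ _ _) (black-unique (B′⊆B b′) b) w″)

module _ {l m n N : ℕ} {W B : Rel3 (Fin l) (Fin m) (Fin n)}
         (𝕋 : Trade W B) (w₀ : ∃ λ r → ∃₂ λ c s → W r c s)
         (E : Enumeration ⟪ W ⟫ N) (F : Enumeration ⟪ B ⟫ N)
         (euler : l ℕ.+ m ℕ.+ n ≡ N ℕ.+ 2) where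

  private
    open Trade 𝕋
    module R = Axis axis₁
    module C = Axis axis₂
    module S = Axis axis₃

    W♭ B♭ : TripleSet l m n
    W♭ = tripleSet E
    B♭ = tripleSet F

    W⁺ : ∀ {r c s} → W r c s → (r , c , s) ∈ₜ W♭
    W⁺ = ∈-tripleSet⁺ E
    W⁻ : ∀ {r c s} → (r , c , s) ∈ₜ W♭ → W r c s
    W⁻ = ∈-tripleSet⁻ E
    B⁺ : ∀ {r c s} → B r c s → (r , c , s) ∈ₜ B♭
    B⁺ = ∈-tripleSet⁺ F
    B⁻ : ∀ {r c s} → (r , c , s) ∈ₜ B♭ → B r c s
    B⁻ = ∈-tripleSet⁻ F

    latinBitrade : IsLatinBitrade ⊤ ⊤ ⊤ W♭ B♭
    latinBitrade = record
      { white-isPLS = record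
        { contained = λ _ → ∈⊤ , ∈⊤ , ∈⊤
        ; agree≤1 = λ t t′ t≢t′ →
            (λ { (≡.refl , ≡.refl) → t≢t′ (cong (λ s → _ , _ , s) (R.white-unique (W⁻ t) (W⁻ t′))) }) ,
            (λ { (≡.refl , ≡.refl) → t≢t′ (cong (λ c → _ , c , _) (S.white-unique (W⁻ t) (W⁻ t′))) }) ,
            (λ { (≡.refl , ≡.refl) → t≢t′ (cong (λ r → r , _ , _) (C.white-unique (W⁻ t) (W⁻ t′))) })
        ; rowsOccur = λ {r} _ → let c , s , w = R.occurs r in c , s , W⁺ w
        ; colsOccur = λ {c} _ → let s , r , w = C.occurs c in r , s , W⁺ w
        ; symbolsOccur = λ {s} _ → let r , c , w = S.occurs s in r , c , W⁺ w
        }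
      ; black-isPLS = record
        { contained = λ _ → ∈⊤ , ∈⊤ , ∈⊤
        ; agree≤1 = λ t t′ t≢t′ →
            (λ { (≡.refl , ≡.refl) → t≢t′ (cong (λ s → _ , _ , s) (R.black-unique (B⁻ t) (B⁻ t′))) }) ,
            (λ { (≡.refl , ≡.refl) → t≢t′ (cong (λ c → _ , c , _) (S.black-unique (B⁻ t) (B⁻ t′))) }) ,
            (λ { (≡.refl , ≡.refl) → t≢t′ (cong (λ r → r , _ , _) (C.black-unique (B⁻ t) (B⁻ t′))) })
        ; rowsOccur = λ {r} _ → let c , s , w = R.occurs r ; s′ , b = R.white-mate w in c , s′ , B⁺ b
        ; colsOccur = λ {c} _ → let s , r , w = C.occurs c ; r′ , b = C.white-mate w in r′ , s , B⁺ b
        ; symbolsOccur = λ {s} _ → let r , c , w = S.occurs s ; c′ , b = S.white-mate w in r , c′ , B⁺ b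
        }
      ; white-nonEmpty = let r , c , s , w = w₀ in (r , c , s) , W⁺ w
      ; black-nonEmpty = let r , c , s , w = w₀ ; s′ , b = R.white-mate w in (r , c , s′) , B⁺ b
      ; white-mates = λ t → let w = W⁻ t
                                r′ , br = C.white-mate w
                                c′ , bc = S.white-mate w
                                s′ , bs = R.white-mate w in
          (r′ , ((λ eq → disjoint w (subst (λ r → B r _ _) eq br)) , B⁺ br) , λ (_ , b) → C.black-unique br (B⁻ b)) ,
          (c′ , ((λ eq → disjoint w (subst (λ c → B _ c _) eq bc)) , B⁺ bc) , λ (_ , b) → S.black-unique bc (B⁻ b)) ,
          (s′ , ((λ eq → disjoint w (subst (λ s → B _ _ s) eq bs)) , B⁺ bs) , λ (_ , b) → R.black-unique bs (B⁻ b))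
      ; black-mates = λ t → let b = B⁻ t
                                r′ , wr = C.black-mate b
                                c′ , wc = S.black-mate b
                                s′ , ws = R.black-mate b in
          (r′ , ((λ eq → disjoint (subst (λ r → W r _ _) eq wr) b) , W⁺ wr) , λ (_ , w) → C.white-unique wr (W⁻ w)) ,
          (c′ , ((λ eq → disjoint (subst (λ c → W _ c _) eq wc) b) , W⁺ wc) , λ (_ , w) → S.white-unique wc (W⁻ w)) ,
          (s′ , ((λ eq → disjoint (subst (λ s → W _ _ s) eq ws) b) , W⁺ ws) , λ (_ , w) → R.white-unique ws (W⁻ w))
      }

    separatedBitrade : Separated W♭ B♭
    separatedBitrade = record
      { rows    = λ r (_ , t) (_ , t′) → Star.map (map₂ both) (R.cycle (W⁻ t) (W⁻ t′))
      ; cols    = λ c (_ , t) (_ , t′) → Star.map (map₂ both) (C.cycle (W⁻ t) (W⁻ t′))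
      ; symbols = λ s (_ , t) (_ , t′) → Star.map (map₂ both) (S.cycle (W⁻ t) (W⁻ t′))
      }
      where
      both : ∀ {r c s r′ c′ s′} → W r c s × B r′ c′ s′ → (r , c , s) ∈ₜ W♭ × (r′ , c′ , s′) ∈ₜ B♭
      both (w , b) = W⁺ w , B⁺ b

    -- The rows, columns and symbols met by a subtrade are closed under white triples by
    -- `subtrade-closed` on each axis. Connectivity makes this all of them, and then `row-closed`
    -- captures the triple supposed to be missing.
    connectedBitrade : Connected W♭ B♭
    connectedBitrade sub =
      let (r , c , s) , r,c,s∈W , r,c,s∉W′ = proj₂ W′⊊W
          (r₀ , c₀ , s₀) , t₀ = white-nonEmpty
          _ , _ , t = connected
            (λ r → ∃₂ λ c s → (r , c , s) ∈ₜ W′)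
            (λ c → ∃₂ λ r s → (r , c , s) ∈ₜ W′)
            (λ s → ∃₂ λ r c → (r , c , s) ∈ₜ W′)
            (λ w → (λ (_ , _ , t) → _ , _ , row-closed t w) ,
                   (λ (_ , _ , t) → _ , _ , col-closed t w) ,
                   (λ (_ , _ , t) → _ , _ , sym-closed t w))
            r₀ r (c₀ , s₀ , t₀)
      in r,c,s∉W′ (row-closed t (W⁻ r,c,s∈W))
      where
      open ProperSubBitrade sub
      open IsLatinBitrade isLatinBitrade

      w⊆ : ∀ {r c s} → (r , c , s) ∈ₜ W′ → W r c s
      w⊆ t = W⁻ (proj₁ W′⊊W t)
      b⊆ : ∀ {r c s} → (r , c , s) ∈ₜ B′ → B r c s
      b⊆ t = B⁻ (proj₁ B′⊊B t)

      row-closed : ∀ {r c s c′ s′} → (r , c , s) ∈ₜ W′ → W r c′ s′ → (r , c′ , s′) ∈ₜ W′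
      row-closed = subtrade-closed axis₁ (S.white-unique) (λ r c s → (r , c , s) ∈ₜ W′)
        (λ r c s → (r , c , s) ∈ₜ B′) w⊆ b⊆
        (λ t → let _ , _ , s , (_ , t′) , _ = white-mates t in s , t′)
        (λ t → let _ , (c , (_ , t′) , _) , _ = black-mates t in c , t′)

      col-closed : ∀ {r c s r′ s′} → (r , c , s) ∈ₜ W′ → W r′ c s′ → (r′ , c , s′) ∈ₜ W′
      col-closed = subtrade-closed axis₂ (R.white-unique) (λ c s r → (r , c , s) ∈ₜ W′)
        (λ c s r → (r , c , s) ∈ₜ B′) w⊆ b⊆
        (λ t → let (r , (_ , t′) , _) , _ = white-mates t in r , t′)
        (λ t → let _ , _ , s , (_ , t′) , _ = black-mates t in s , t′)

      sym-closed : ∀ {r c s r′ c′} → (r , c , s) ∈ₜ W′ → W r′ c′ s → (r′ , c′ , s) ∈ₜ W′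
      sym-closed = subtrade-closed axis₃ (C.white-unique) (λ s r c → (r , c , s) ∈ₜ W′)
        (λ s r c → (r , c , s) ∈ₜ B′) w⊆ b⊆
        (λ t → let _ , (c , (_ , t′) , _) , _ = white-mates t in c , t′)
        (λ t → let (r , (_ , t′) , _) , _ = black-mates t in r , t′)

    size-W : size W♭ ≡ N
    size-W = count-triples E
    size-B : size B♭ ≡ N
    size-B = count-triples F

    -- Each edge lies in exactly one white triple, so each of the three kinds of edges is in
    -- bijection with the white triples.
    edges : edgeCount W♭ ≡ N ℕ.+ N ℕ.+ N
    edges = cong₂ ℕ._+_ (cong₂ ℕ._+_
      (count-pairs _ (λ (r , c , s) → r , c)
        (λ t → let s , t′ = any-Fin⁻ t in (_ , _ , s) , W⁻ t′ , ≡.refl)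
        (λ { ((_ , _ , s) , w , ≡.refl) → any-Fin⁺ s (W⁺ w) })
        (λ { w w′ ≡.refl → cong (λ s → _ , _ , s) (R.white-unique w w′) }))
      (count-pairs _ (λ (r , c , s) → r , s)
        (λ t → let c , t′ = any-Fin⁻ t in (_ , c , _) , W⁻ t′ , ≡.refl)
        (λ { ((_ , c , _) , w , ≡.refl) → any-Fin⁺ c (W⁺ w) })
        (λ { w w′ ≡.refl → cong (λ c → _ , c , _) (S.white-unique w w′) })))
      (count-pairs _ (λ (r , c , s) → c , s)
        (λ t → let r , t′ = any-Fin⁻ t in (r , _ , _) , W⁻ t′ , ≡.refl)
        (λ { ((r , _ , _) , w , ≡.refl) → any-Fin⁺ r (W⁺ w) })
        (λ { w w′ ≡.refl → cong (λ r → r , _ , _) (C.white-unique w w′) }))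
      where
      count-pairs : ∀ {p q} (f : Fin p × Fin q → Bool) (g : Fin l × Fin m × Fin n → Fin p × Fin q) →
        (∀ {x} → T (f x) → ∃ λ t → ⟪ W ⟫ t × g t ≡ x) →
        (∀ {x} → (∃ λ t → ⟪ W ⟫ t × g t ≡ x) → T (f x)) →
        (∀ {t t′} → ⟪ W ⟫ t → ⟪ W ⟫ t′ → g t ≡ g t′ → t ≡ t′) →
        count f (cartesianProduct (allFin p) (allFin q)) ≡ N
      count-pairs {p} {q} f g to from g-inj = count-enum f _
        (Unique.cartesianProduct⁺ (Unique.allFin⁺ p) (Unique.allFin⁺ q))
        (λ (x , y) → ∈-cartesianProduct⁺ (∈-allFin x) (∈-allFin y))
        to from (enum-image g g-inj E)

  bitrade : SphericalLatinBitrade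
  bitrade = record
    { W = W♭
    ; B = B♭
    ; isLatinBitrade = latinBitrade
    ; connected = connectedBitrade
    ; separated = separatedBitrade
    ; sphere = begin
        (l ℕ.+ m ℕ.+ n) ℕ.+ (size W♭ ℕ.+ size B♭) ≡⟨ cong₂ ℕ._+_ euler (cong₂ ℕ._+_ size-W size-B) ⟩
        (N ℕ.+ 2) ℕ.+ (N ℕ.+ N)                   ≡⟨ arith N ⟩
        N ℕ.+ N ℕ.+ N ℕ.+ 2                       ≡⟨ cong (ℕ._+ 2) edges ⟨
        edgeCount W♭ ℕ.+ 2                        ∎
    }
    where
    open ≡.≡-Reasoning
    arith : ∀ N → (N ℕ.+ 2) ℕ.+ (N ℕ.+ N) ≡ N ℕ.+ N ℕ.+ N ℕ.+ 2
    arith = ℕ-Solver.solve-∀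

-- There are 2 · `area` faces and 3 · `area` edges, so the field `euler` is V - E + F = 2 with the
-- edges and faces eliminated.
record Sphere {l m n : ℕ} (W B : Rel3 (Fin l) (Fin m) (Fin n)) : Set₁ where
  field
    trade  : Trade W B
    {area} : ℕ
    whites : Enumeration ⟪ W ⟫ area
    blacks : Enumeration ⟪ B ⟫ area
    euler  : l ℕ.+ m ℕ.+ n ≡ area ℕ.+ 2

module _ {l₁ l₂ l m₁ m₂ m n₁ n₂ n : ℕ}
         {x₁ : Fin l₁} {x₂ : Fin l₂} {y₁ : Fin m₁} {y₂ : Fin m₂} {z₁ : Fin n₁} {z₂ : Fin n₂}
         (𝒳 : Amalgam x₁ x₂ (Fin l)) (𝒴 : Amalgam y₁ y₂ (Fin m)) (𝒵 : Amalgam z₁ z₂ (Fin n)) where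

  private
    module X = Amalgam 𝒳
    module Y = Amalgam 𝒴
    module Z = Amalgam 𝒵

    j₁ : Fin l₁ × Fin m₁ × Fin n₁ → Fin l × Fin m × Fin n
    j₁ (x , y , z) = X.ι₁ x , Y.ι₁ y , Z.ι₁ z
    j₂ : Fin l₂ × Fin m₂ × Fin n₂ → Fin l × Fin m × Fin n
    j₂ (x , y , z) = X.ι₂ x , Y.ι₂ y , Z.ι₂ z

    triple≡ : ∀ {X Y Z : Set} {x x′ : X} {y y′ : Y} {z z′ : Z} →
              x ≡ x′ × y ≡ y′ × z ≡ z′ → (x , y , z) ≡ (x′ , y′ , z′)
    triple≡ (≡.refl , ≡.refl , ≡.refl) = ≡.refl

    ≡triple : ∀ {X Y Z : Set} {x x′ : X} {y y′ : Y} {z z′ : Z} →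
              (x , y , z) ≡ (x′ , y′ , z′) → x ≡ x′ × y ≡ y′ × z ≡ z′
    ≡triple ≡.refl = ≡.refl , ≡.refl , ≡.refl

    j₁-inj : ∀ {t t′} → j₁ t ≡ j₁ t′ → t ≡ t′
    j₁-inj eq = let p , q , r = ≡triple eq in triple≡ (X.ι₁-inj p , Y.ι₁-inj q , Z.ι₁-inj r)

    j₂-inj : ∀ {t t′} → j₂ t ≡ j₂ t′ → t ≡ t′
    j₂-inj eq = let p , q , r = ≡triple eq in triple≡ (X.ι₂-inj p , Y.ι₂-inj q , Z.ι₂-inj r)

    j-meet : ∀ {t t′} → j₁ t ≡ j₂ t′ → t ≡ (x₁ , y₁ , z₁) × t′ ≡ (x₂ , y₂ , z₂)
    j-meet eq =
      let p , q , r = ≡triple eq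
          p₁ , p₂ = X.meet p
          q₁ , q₂ = Y.meet q
          r₁ , r₂ = Z.meet r
      in triple≡ (p₁ , q₁ , r₁) , triple≡ (p₂ , q₂ , r₂)

    _≟₃_ : ∀ {a b c} (t t′ : Fin a × Fin b × Fin c) →
           Dec (proj₁ t ≡ proj₁ t′ × proj₁ (proj₂ t) ≡ proj₁ (proj₂ t′) × proj₂ (proj₂ t) ≡ proj₂ (proj₂ t′))
    (x , y , z) ≟₃ (x′ , y′ , z′) = x Fin.≟ x′ ×-dec y Fin.≟ y′ ×-dec z Fin.≟ z′

  SumWhite : Rel3 (Fin l₁) (Fin m₁) (Fin n₁) → Rel3 (Fin l₂) (Fin m₂) (Fin n₂) → Rel3 (Fin l) (Fin m) (Fin n)
  SumWhite W₁ W₂ x y z =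
    Image X.ι₁ Y.ι₁ Z.ι₁ W₁ x y z ⊎ Image X.ι₂ Y.ι₂ Z.ι₂ (W₂ ∖ (x₂ , y₂ , z₂)) x y z

  SumBlack : Rel3 (Fin l₁) (Fin m₁) (Fin n₁) → Rel3 (Fin l₂) (Fin m₂) (Fin n₂) → Rel3 (Fin l) (Fin m) (Fin n)
  SumBlack B₁ B₂ x y z =
    Image X.ι₁ Y.ι₁ Z.ι₁ (B₁ ∖ (x₁ , y₁ , z₁)) x y z ⊎ Image X.ι₂ Y.ι₂ Z.ι₂ B₂ x y z

  module _ {W₁ B₁ : Rel3 (Fin l₁) (Fin m₁) (Fin n₁)} {W₂ B₂ : Rel3 (Fin l₂) (Fin m₂) (Fin n₂)} where

    isSum : B₁ x₁ y₁ z₁ → W₂ x₂ y₂ z₂ →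
            IsSum 𝒳 𝒴 𝒵 W₁ B₁ W₂ B₂ (SumWhite W₁ W₂) (SumBlack B₁ B₂)
    isSum b w = record
      { black-mark = b
      ; white-mark = w
      ; white₁ = λ w → inj₁ (_ , _ , _ , w , ≡.refl , ≡.refl , ≡.refl)
      ; white₂ = white₂
      ; black₁ = black₁
      ; black₂ = λ b → inj₂ (_ , _ , _ , b , ≡.refl , ≡.refl , ≡.refl)
      ; white⁻ = id
      ; black⁻ = id
      }
      where
      white₂ : ∀ {x y z} → W₂ x y z → (x ≡ x₂ × y ≡ y₂ × z ≡ z₂) ⊎ SumWhite W₁ W₂ (X.ι₂ x) (Y.ι₂ y) (Z.ι₂ z)
      white₂ {x} {y} {z} w with (x , y , z) ≟₃ (x₂ , y₂ , z₂)
      ... | yes eq = inj₁ eq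
      ... | no ne  = inj₂ (inj₂ (_ , _ , _ , (w , ne) , ≡.refl , ≡.refl , ≡.refl))
      black₁ : ∀ {x y z} → B₁ x y z → (x ≡ x₁ × y ≡ y₁ × z ≡ z₁) ⊎ SumBlack B₁ B₂ (X.ι₁ x) (Y.ι₁ y) (Z.ι₁ z)
      black₁ {x} {y} {z} b with (x , y , z) ≟₃ (x₁ , y₁ , z₁)
      ... | yes eq = inj₁ eq
      ... | no ne  = inj₂ (inj₁ (_ , _ , _ , (b , ne) , ≡.refl , ≡.refl , ≡.refl))

    enum-SumWhite : ∀ {M N} → W₂ x₂ y₂ z₂ → Enumeration ⟪ W₁ ⟫ M → Enumeration ⟪ W₂ ⟫ (suc N) →
                    Enumeration ⟪ SumWhite W₁ W₂ ⟫ (M ℕ.+ N)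
    enum-SumWhite w E F = enum-cong
      (Sum.map (λ { (t , w , ≡.refl) → _ , _ , _ , w , ≡.refl , ≡.refl , ≡.refl })
               (λ { (t , (w , ne) , ≡.refl) → _ , _ , _ , (w , ne ∘ triple≡) , ≡.refl , ≡.refl , ≡.refl }))
      (Sum.map (λ (_ , _ , _ , w , eq) → _ , w , triple≡ eq)
               (λ (_ , _ , _ , (w , ne) , eq) → _ , (w , ne ∘ ≡triple) , triple≡ eq))
      (enum-⊎ (λ (_ , _ , p) (_ , (_ , ne) , q) → ne (proj₂ (j-meet (≡.trans p (≡.sym q)))))
        (enum-image j₁ (λ _ _ → j₁-inj) E)
        (enum-image j₂ (λ _ _ → j₂-inj) (enum-delete _≟ₜ_ _ w F)))

    enum-SumBlack : ∀ {M N} → B₁ x₁ y₁ z₁ → Enumeration ⟪ B₁ ⟫ (suc M) → Enumeration ⟪ B₂ ⟫ N →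
                    Enumeration ⟪ SumBlack B₁ B₂ ⟫ (M ℕ.+ N)
    enum-SumBlack b E F = enum-cong
      (Sum.map (λ { (t , (b , ne) , ≡.refl) → _ , _ , _ , (b , ne ∘ triple≡) , ≡.refl , ≡.refl , ≡.refl })
               (λ { (t , b , ≡.refl) → _ , _ , _ , b , ≡.refl , ≡.refl , ≡.refl }))
      (Sum.map (λ (_ , _ , _ , (b , ne) , eq) → _ , (b , ne ∘ ≡triple) , triple≡ eq)
               (λ (_ , _ , _ , b , eq) → _ , b , triple≡ eq))
      (enum-⊎ (λ (_ , (_ , ne) , p) (_ , _ , q) → ne (proj₁ (j-meet (≡.trans p (≡.sym q)))))
        (enum-image j₁ (λ _ _ → j₁-inj) (enum-delete _≟ₜ_ _ b E))
        (enum-image j₂ (λ _ _ → j₂-inj) F))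

module _ {l₁ l₂ m₁ m₂ n₁ n₂ : ℕ}
         {x₁ : Fin l₁} {x₂ : Fin (suc l₂)} {y₁ : Fin m₁} {y₂ : Fin (suc m₂)} {z₁ : Fin n₁} {z₂ : Fin (suc n₂)}
         (𝒳 : Amalgam x₁ x₂ (Fin (l₁ ℕ.+ l₂))) (𝒴 : Amalgam y₁ y₂ (Fin (m₁ ℕ.+ m₂)))
         (𝒵 : Amalgam z₁ z₂ (Fin (n₁ ℕ.+ n₂)))
         {W₁ B₁ : Rel3 (Fin l₁) (Fin m₁) (Fin n₁)} {W₂ B₂ : Rel3 (Fin (suc l₂)) (Fin (suc m₂)) (Fin (suc n₂))}
         where

  sum-sphere : Sphere W₁ B₁ → Sphere W₂ B₂ → B₁ x₁ y₁ z₁ → W₂ x₂ y₂ z₂ →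
               Sphere (SumWhite 𝒳 𝒴 𝒵 W₁ W₂) (SumBlack 𝒳 𝒴 𝒵 B₁ B₂)
  sum-sphere S T b w with Sphere.area S | Sphere.whites S | Sphere.blacks S | Sphere.euler S
                        | Sphere.area T | Sphere.whites T | Sphere.blacks T | Sphere.euler T
  ... | zero  | _  | b₁ | _  | _     | _  | _  | _  = ⊥-elim (enum-nonzero b₁ b)
  ... | suc _ | _  | _  | _  | zero  | w₂ | _  | _  = ⊥-elim (enum-nonzero w₂ w)
  ... | suc M | w₁ | b₁ | e₁ | suc N | w₂ | b₂ | e₂ = record
    { trade  = sum (Sphere.trade S) (Sphere.trade T) (isSum 𝒳 𝒴 𝒵 b w)
    ; whites = enum-SumWhite 𝒳 𝒴 𝒵 {B₁ = B₁} {B₂ = B₂} w w₁ w₂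
    ; blacks = subst (Enumeration _) (ℕ.+-suc M N) (enum-SumBlack 𝒳 𝒴 𝒵 {W₁ = W₁} {W₂ = W₂} b b₁ b₂)
    -- Three pairs of vertices are identified. Adding 3 restores the separate vertex counts, to
    -- which the two Euler equations apply.
    ; euler  = ℕ.+-cancelʳ-≡ 3 _ _ (begin
        (l₁ ℕ.+ l₂) ℕ.+ (m₁ ℕ.+ m₂) ℕ.+ (n₁ ℕ.+ n₂) ℕ.+ 3         ≡⟨ regroup l₁ l₂ m₁ m₂ n₁ n₂ ⟩
        (l₁ ℕ.+ m₁ ℕ.+ n₁) ℕ.+ (suc l₂ ℕ.+ suc m₂ ℕ.+ suc n₂)     ≡⟨ cong₂ ℕ._+_ e₁ e₂ ⟩
        (suc M ℕ.+ 2) ℕ.+ (suc N ℕ.+ 2)                           ≡⟨ areas M N ⟩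
        (suc M ℕ.+ N) ℕ.+ 2 ℕ.+ 3                                 ∎)
    }
    where
    open ≡.≡-Reasoning
    regroup : ∀ a b c d e f → (a ℕ.+ b) ℕ.+ (c ℕ.+ d) ℕ.+ (e ℕ.+ f) ℕ.+ 3 ≡
                              (a ℕ.+ c ℕ.+ e) ℕ.+ (suc b ℕ.+ suc d ℕ.+ suc f)
    regroup = ℕ-Solver.solve-∀
    areas : ∀ a b → (suc a ℕ.+ 2) ℕ.+ (suc b ℕ.+ 2) ≡ (suc a ℕ.+ b) ℕ.+ 2 ℕ.+ 3
    areas = ℕ-Solver.solve-∀

-- The cyclic successor and dipoles

next : ∀ {m} → Fin (suc m) → Fin (suc m)
next i with view i
... | ‵fromℕ     = zero
... | ‵inject₁ j = suc j

prev : ∀ {m} → Fin (suc m) → Fin (suc m)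
prev zero    = fromℕ _
prev (suc j) = inject₁ j

next-fromℕ : ∀ m → next (fromℕ m) ≡ zero
next-fromℕ m rewrite view-fromℕ m = ≡.refl

next-inject₁ : ∀ {m} (j : Fin m) → next (inject₁ j) ≡ suc j
next-inject₁ j rewrite view-inject₁ j = ≡.refl

next-prev : ∀ {m} (i : Fin (suc m)) → next (prev i) ≡ i
next-prev zero    = next-fromℕ _
next-prev (suc j) = next-inject₁ j

prev-next : ∀ {m} (i : Fin (suc m)) → prev (next i) ≡ i
prev-next i with view i
... | ‵fromℕ     = ≡.refl
... | ‵inject₁ j = ≡.refl

next-injective : ∀ {m} {i j : Fin (suc m)} → next i ≡ next j → i ≡ j
next-injective {i = i} {j} eq = ≡.trans (≡.sym (prev-next i)) (≡.trans (cong prev eq) (prev-next j))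

next≢ : ∀ {m} (i : Fin (suc (suc m))) → next i ≢ i
next≢ i eq with view i
... | ‵fromℕ     with () ← eq
... | ‵inject₁ j = ℕ.1+n≢n (≡.trans (cong toℕ eq) (Fin.toℕ-inject₁ j))

-- Any point climbs to the top and wraps to `zero`, and from `zero` every point is reached by
-- climbing.
next-walk : ∀ {m} {R : Fin (suc m) → Fin (suc m) → Set} → (∀ i → R i (next i)) → ∀ i j → Star R i j
next-walk {R = R} step i j = to-zero i ◅◅ from-zero j
  where
  from-zero : ∀ i → Star R zero i
  from-zero = <-weakInduction (Star R zero) Star.ε
    (λ i p → p ◅◅ subst (R (inject₁ i)) (next-inject₁ i) (step _) ◅ Star.ε)
  to-zero : ∀ i → Star R i zero
  to-zero = >-weakInduction (λ i → Star R i zero) (subst (R _) (next-fromℕ _) (step _) ◅ Star.ε)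
    (λ i p → subst (R (inject₁ i)) (next-inject₁ i) (step _) ◅ p)

prev-walk : ∀ {m} {R : Fin (suc m) → Fin (suc m) → Set} → (∀ i → R (next i) i) → ∀ i j → Star R i j
prev-walk step i j = Star.reverse id (next-walk step j i)

-- The rows are the poles, and on the equator column c lies between the symbols c and `next c`. Each
-- equatorial edge bounds a white triple with one pole and a black one with the other, so `Black` is
-- `White` with the rows exchanged. With one column the two would coincide, hence the `suc (suc k)`.
module Dipole (k : ℕ) where

  n : ℕ
  n = suc (suc k)

  opposite : Fin 2 → Fin 2
  opposite zero       = suc zero
  opposite (suc zero) = zero

  shift : Fin 2 → Fin n → Fin n
  shift zero       c = c
  shift (suc zero) c = next c

  White Black : Rel3 (Fin 2) (Fin n) (Fin n)
  White r c s = s ≡ shift r c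
  Black r c s = s ≡ shift (opposite r) c

  private
    unshift : Fin 2 → Fin n → Fin n
    unshift zero       s = s
    unshift (suc zero) s = prev s

    shift-unshift : ∀ r s → shift r (unshift r s) ≡ s
    shift-unshift zero       s = ≡.refl
    shift-unshift (suc zero) s = next-prev s

    shift-injective : ∀ r {c c′} → shift r c ≡ shift r c′ → c ≡ c′
    shift-injective zero       eq = eq
    shift-injective (suc zero) eq = next-injective eq

    opposite-involutive : ∀ r → opposite (opposite r) ≡ r
    opposite-involutive zero       = ≡.refl
    opposite-involutive (suc zero) = ≡.refl

    same-or-opposite : ∀ r r′ → r′ ≡ r ⊎ r′ ≡ opposite r
    same-or-opposite zero       zero       = inj₁ ≡.refl
    same-or-opposite zero       (suc zero) = inj₂ ≡.refl
    same-or-opposite (suc zero) zero       = inj₂ ≡.refl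
    same-or-opposite (suc zero) (suc zero) = inj₁ ≡.refl

    shift≢ : ∀ r {c} → shift r c ≢ shift (opposite r) c
    shift≢ zero       eq = next≢ _ (≡.sym eq)
    shift≢ (suc zero) eq = next≢ _ eq

    row-unique : ∀ {r r′ c s} → s ≡ shift r c → s ≡ shift r′ c → r ≡ r′
    row-unique {r} {r′} p q with same-or-opposite r r′
    ... | inj₁ ≡.refl = ≡.refl
    ... | inj₂ ≡.refl = contradiction (≡.trans (≡.sym p) q) (shift≢ r)

    row-cycle : ∀ r {c s c′ s′} → White r c s → White r c′ s′ → Star (Rotation White Black r) s s′
    row-cycle zero       _ _ = next-walk (λ i → i , ≡.refl , ≡.refl) _ _
    row-cycle (suc zero) _ _ = prev-walk (λ i → i , ≡.refl , ≡.refl) _ _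

    column-cycle : ∀ c {s r s′ r′} → White r c s → White r′ c s′ →
                   Star (Rotation (rot White) (rot Black) c) r r′
    column-cycle c {r = r} {r′ = r′} w w′ with same-or-opposite r r′
    ... | inj₁ ≡.refl = Star.ε
    ... | inj₂ ≡.refl = (_ , w , ≡.trans w (cong (λ r → shift r c) (≡.sym (opposite-involutive r)))) ◅ Star.ε

    symbol-cycle : ∀ s {r c r′ c′} → White r c s → White r′ c′ s →
                   Star (Rotation (rot (rot White)) (rot (rot Black)) s) c c′
    symbol-cycle s {r = r} {r′ = r′} w w′ with same-or-opposite r r′
    ... | inj₁ ≡.refl with ≡.refl ← shift-injective r′ (≡.trans (≡.sym w) w′) = Star.ε
    ... | inj₂ ≡.refl = (r , w , w′) ◅ Star.ε

    white-enumeration : ∀ (f : Fin 2 → Fin 2) →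
      Enumeration ⟪ (λ r c s → s ≡ shift (f r) c) ⟫ (2 ℕ.* n)
    white-enumeration f = enum-cong
      (λ { (_ , _ , ≡.refl) → ≡.refl }) (λ { {r , c , _} ≡.refl → (r , c) , _ , ≡.refl })
      (enum-image (λ (r , c) → r , c , shift (f r) c) (λ { _ _ ≡.refl → ≡.refl }) (enum-Fin² 2 n))

  dipole : Sphere White Black
  dipole = record
    { trade  = record
      { axis₁ = record
        { white-unique = λ p q → ≡.trans p (≡.sym q)
        ; black-unique = λ p q → ≡.trans p (≡.sym q)
        ; white-mate   = λ _ → _ , ≡.refl
        ; black-mate   = λ _ → _ , ≡.refl
        ; cycle        = λ {r} {c} {s} {c′} {s′} → row-cycle r {c} {s} {c′} {s′}
        ; occurs       = λ r → zero , _ , ≡.refl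
        }
      ; axis₂ = record
        { white-unique = row-unique
        ; black-unique = λ {_} {_} {r} {r′} p q →
            ≡.trans (≡.sym (opposite-involutive r)) (≡.trans (cong opposite (row-unique p q)) (opposite-involutive r′))
        ; white-mate   = λ {c} {_} {r} w →
            opposite r , ≡.trans w (cong (λ r → shift r c) (≡.sym (opposite-involutive r)))
        ; black-mate   = λ {_} {_} {r} b → opposite r , b
        ; cycle        = column-cycle _
        ; occurs       = λ c → _ , zero , ≡.refl
        }
      ; axis₃ = record
        { white-unique = λ {_} {r} p q → shift-injective r (≡.trans (≡.sym p) q)
        ; black-unique = λ {_} {r} p q → shift-injective (opposite r) (≡.trans (≡.sym p) q)
        ; white-mate   = λ {s} {r} _ → _ , ≡.sym (shift-unshift (opposite r) s)
        ; black-mate   = λ {s} {r} _ → _ , ≡.sym (shift-unshift r s)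
        ; cycle        = λ {s} {r} {c} {r′} {c′} → symbol-cycle s {r} {c} {r′} {c′}
        ; occurs       = λ s → zero , s , ≡.refl
        }
      ; disjoint  = λ {r} w b → shift≢ r (≡.trans (≡.sym w) b)
      ; connected = λ P Q R closed r r′ p →
          let P⇒Q , _ , _ = closed {r} {zero} ≡.refl
              _ , Q⇒R , R⇒P = closed {r′} {zero} ≡.refl
          in R⇒P (Q⇒R (P⇒Q p))
      }
    ; whites = white-enumeration id
    ; blacks = white-enumeration opposite
    ; euler  = arith k
    }
    where
    arith : ∀ k → 2 ℕ.+ suc (suc k) ℕ.+ suc (suc k) ≡ 2 ℕ.* suc (suc k) ℕ.+ 2
    arith = ℕ-Solver.solve-∀

-- Homomorphisms, labellings and coordinates

module IntegerMultiples (G : AbelianGroup 0ℓ 0ℓ) where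

  open AbelianGroup G
  open Multiples commutativeMonoid public using () renaming (_×_ to _×ℕ_)
  open Multiples commutativeMonoid using (×-congʳ; ×-homo-1)
  open AbelianGroupProperties G using (⁻¹-∙-comm; ε⁻¹≈ε; ⁻¹-involutive; inverseˡ-unique; loop)
  open LoopProperties loop using (identityˡ-unique)
  open SetoidReasoning setoid

  infixr 8 _•_

  _•_ : ℤ → Carrier → Carrier
  (+ n)    • x = n ×ℕ x
  -[1+ n ] • x = (suc n ×ℕ x) ⁻¹

  IsAdditive : (ℤ → Carrier) → Set
  IsAdditive f = ∀ i j → f (i ℤ.+ j) ≈ f i ∙ f j

  -- As 1 generates ℤ, an additive map is fixed by its value there. The laws of `_•_`, its
  -- compatibility with homomorphisms and its form in ℤ/n all follow by applying this to a suitable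
  -- additive map.
  additive-unique : ∀ f → IsAdditive f → ∀ i → f i ≈ i • f 1ℤ
  additive-unique f f-+ (+ n) = natural n
    where
    natural : ∀ n → f (+ n) ≈ n ×ℕ f 1ℤ
    natural zero    = identityˡ-unique (f 0ℤ) (f 0ℤ) (sym (f-+ 0ℤ 0ℤ))
    natural (suc n) = trans (f-+ 1ℤ (+ n)) (∙-congˡ (natural n))
  additive-unique f f-+ -[1+ n ] = inverseˡ-unique _ _ (begin
    f -[1+ n ] ∙ suc n ×ℕ f 1ℤ   ≈⟨ ∙-congˡ (additive-unique f f-+ (+ suc n)) ⟨
    f -[1+ n ] ∙ f (+ suc n)     ≈⟨ f-+ -[1+ n ] (+ suc n) ⟨
    f (-[1+ n ] ℤ.+ + suc n)     ≡⟨ cong f (ℤ.+-inverseˡ (+ suc n)) ⟩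
    f 0ℤ                         ≈⟨ additive-unique f f-+ 0ℤ ⟩
    ε                            ∎)

  •-congˡ : ∀ i {x y} → x ≈ y → i • x ≈ i • y
  •-congˡ (+ n)    eq = ×-congʳ n eq
  •-congˡ -[1+ n ] eq = ⁻¹-cong (×-congʳ (suc n) eq)

  1•x≈x : ∀ x → 1ℤ • x ≈ x
  1•x≈x = ×-homo-1

  -‿• : ∀ i x → (ℤ.- i) • x ≈ (i • x) ⁻¹
  -‿• (+ zero)  x = sym ε⁻¹≈ε
  -‿• (+ suc n) x = refl
  -‿• -[1+ n ]  x = sym (⁻¹-involutive _)

  private
    ⊖-• : ∀ m n x → (m ℤ.⊖ n) • x ≈ m ×ℕ x ∙ (n ×ℕ x) ⁻¹
    ⊖-• m       zero    x = begin
      m ×ℕ x          ≈⟨ identityʳ _ ⟨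
      m ×ℕ x ∙ ε      ≈⟨ ∙-congˡ ε⁻¹≈ε ⟨
      m ×ℕ x ∙ ε ⁻¹   ∎
    ⊖-• zero    (suc n) x = sym (identityˡ _)
    ⊖-• (suc m) (suc n) x = begin
      (suc m ℤ.⊖ suc n) • x                        ≡⟨ cong (_• x) (ℤ.[1+m]⊖[1+n]≡m⊖n m n) ⟩
      (m ℤ.⊖ n) • x                                ≈⟨ ⊖-• m n x ⟩
      m ×ℕ x ∙ (n ×ℕ x) ⁻¹                         ≈⟨ ∙-congʳ (identityʳ _) ⟨
      m ×ℕ x ∙ ε ∙ (n ×ℕ x) ⁻¹                     ≈⟨ ∙-congʳ (∙-congˡ (inverseʳ x)) ⟨
      m ×ℕ x ∙ (x ∙ x ⁻¹) ∙ (n ×ℕ x) ⁻¹            ≈⟨ ∙-congʳ (assoc _ _ _) ⟨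
      m ×ℕ x ∙ x ∙ x ⁻¹ ∙ (n ×ℕ x) ⁻¹              ≈⟨ assoc _ _ _ ⟩
      m ×ℕ x ∙ x ∙ (x ⁻¹ ∙ (n ×ℕ x) ⁻¹)            ≈⟨ ∙-cong (comm _ _) (⁻¹-∙-comm _ _) ⟩
      suc m ×ℕ x ∙ (suc n ×ℕ x) ⁻¹                 ∎

  •-additive : ∀ x → IsAdditive (_• x)
  •-additive x (+ m)    (+ n)    = Multiples.×-homo-+ commutativeMonoid x m n
  •-additive x (+ m)    -[1+ n ] = ⊖-• m (suc n) x
  •-additive x -[1+ m ] (+ n)    = trans (⊖-• n (suc m) x) (comm _ _)
  •-additive x -[1+ m ] -[1+ n ] = begin
    (suc (suc (m ℕ.+ n)) ×ℕ x) ⁻¹            ≡⟨ cong (λ k → (suc k ×ℕ x) ⁻¹) (ℕ.+-suc m n) ⟨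
    ((suc m ℕ.+ suc n) ×ℕ x) ⁻¹              ≈⟨ ⁻¹-cong (Multiples.×-homo-+ commutativeMonoid x (suc m) (suc n)) ⟩
    (suc m ×ℕ x ∙ suc n ×ℕ x) ⁻¹             ≈⟨ ⁻¹-∙-comm _ _ ⟨
    (suc m ×ℕ x) ⁻¹ ∙ (suc n ×ℕ x) ⁻¹        ∎

  *-• : ∀ i j x → (i ℤ.* j) • x ≈ i • (j • x)
  *-• i j x = trans
    (additive-unique (λ i → (i ℤ.* j) • x)
      (λ i i′ → trans (reflexive (cong (_• x) (ℤ.*-distribʳ-+ j i i′))) (•-additive x (i ℤ.* j) (i′ ℤ.* j))) i)
    (•-congˡ i (reflexive (cong (_• x) (ℤ.*-identityˡ j))))

  private
    interchange : ∀ a b c d → (a ∙ b) ∙ (c ∙ d) ≈ (a ∙ c) ∙ (b ∙ d)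
    interchange = CommutativeSemigroupProperties.interchange commutativeSemigroup

  infixl 6 _:+_
  infix  8 :-_

  data Expr (n : ℕ) : Set where
    var  : Fin n → Expr n
    :0   : Expr n
    _:+_ : Expr n → Expr n → Expr n
    :-_  : Expr n → Expr n

  ⟦_⟧ : ∀ {n} → Expr n → Vec Carrier n → Carrier
  ⟦ var i ⟧  ρ = Vec.lookup ρ i
  ⟦ :0 ⟧     ρ = ε
  ⟦ s :+ t ⟧ ρ = ⟦ s ⟧ ρ ∙ ⟦ t ⟧ ρ
  ⟦ :- s ⟧   ρ = ⟦ s ⟧ ρ ⁻¹

  private
    basis : ∀ {n} → Fin n → Vec ℤ n
    basis zero    = 1ℤ ∷ Vec.replicate _ 0ℤ
    basis (suc i) = 0ℤ ∷ basis i

    coefficients : ∀ {n} → Expr n → Vec ℤ n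
    coefficients (var i)  = basis i
    coefficients :0       = Vec.replicate _ 0ℤ
    coefficients (s :+ t) = Vec.zipWith ℤ._+_ (coefficients s) (coefficients t)
    coefficients (:- s)   = Vec.map ℤ.-_ (coefficients s)

    combination : ∀ {n} → Vec ℤ n → Vec Carrier n → Carrier
    combination []       []       = ε
    combination (k ∷ ks) (x ∷ xs) = k • x ∙ combination ks xs

    combination-0 : ∀ {n} (ρ : Vec Carrier n) → combination (Vec.replicate n 0ℤ) ρ ≈ ε
    combination-0 []      = refl
    combination-0 (x ∷ ρ) = trans (identityˡ _) (combination-0 ρ)

    combination-basis : ∀ {n} i (ρ : Vec Carrier n) → combination (basis i) ρ ≈ Vec.lookup ρ i
    combination-basis zero    (x ∷ ρ) = trans (∙-cong (1•x≈x x) (combination-0 ρ)) (identityʳ x)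
    combination-basis (suc i) (x ∷ ρ) = trans (identityˡ _) (combination-basis i ρ)

    combination-+ : ∀ {n} (k l : Vec ℤ n) ρ →
                    combination (Vec.zipWith ℤ._+_ k l) ρ ≈ combination k ρ ∙ combination l ρ
    combination-+ []      []      []      = sym (identityˡ ε)
    combination-+ (i ∷ k) (j ∷ l) (x ∷ ρ) =
      trans (∙-cong (•-additive x i j) (combination-+ k l ρ)) (interchange _ _ _ _)

    combination-neg : ∀ {n} (k : Vec ℤ n) ρ → combination (Vec.map ℤ.-_ k) ρ ≈ combination k ρ ⁻¹
    combination-neg []      []      = sym ε⁻¹≈ε
    combination-neg (i ∷ k) (x ∷ ρ) = trans (∙-cong (-‿• i x) (combination-neg k ρ)) (⁻¹-∙-comm _ _)

    correct : ∀ {n} (s : Expr n) ρ → combination (coefficients s) ρ ≈ ⟦ s ⟧ ρ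
    correct (var i)  ρ = combination-basis i ρ
    correct :0       ρ = combination-0 ρ
    correct (s :+ t) ρ = trans (combination-+ (coefficients s) (coefficients t) ρ)
                               (∙-cong (correct s ρ) (correct t ρ))
    correct (:- s)   ρ = trans (combination-neg (coefficients s) ρ) (⁻¹-cong (correct s ρ))

  -- A solver for abelian groups by reflection: each side equals the integer combination given by
  -- its coefficients, and for closed expressions these vectors agree by computation.
  linear : ∀ {n} (ρ : Vec Carrier n) (s t : Expr n) → coefficients s ≡ coefficients t → ⟦ s ⟧ ρ ≈ ⟦ t ⟧ ρ
  linear ρ s t eq = trans (sym (correct s ρ))
    (trans (reflexive (cong (λ k → combination k ρ) eq)) (correct t ρ))

sum-• : ∀ (G : AbelianGroup 0ℓ 0ℓ) (let open AbelianGroup G) (let open IntegerMultiples G) i j k x →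
        (i ℤ.+ j ℤ.+ k) • x ≈ i • x ∙ j • x ∙ k • x
sum-• G i j k x = trans (•-additive x (i ℤ.+ j) k) (∙-congʳ (•-additive x i j))
  where
  open AbelianGroup G
  open IntegerMultiples G

record Hom (G H : AbelianGroup 0ℓ 0ℓ) : Set where
  private
    module G = AbelianGroup G
    module H = AbelianGroup H
  field
    to     : G.Carrier → H.Carrier
    cong-≈ : ∀ {x y} → x G.≈ y → to x H.≈ to y
    homo   : ∀ x y → to (x G.∙ y) H.≈ to x H.∙ to y

  open AbelianGroupProperties H using (loop; inverseˡ-unique)
  open LoopProperties loop using (identityˡ-unique)
  open IntegerMultiples G using () renaming (_•_ to _•ᴳ_)
  open IntegerMultiples H using (_•_; additive-unique; •-congˡ)

  ε-homo : to G.ε H.≈ H.ε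
  ε-homo = identityˡ-unique _ _ (H.trans (H.sym (homo G.ε G.ε)) (cong-≈ (G.identityˡ G.ε)))

  ⁻¹-homo : ∀ x → to (x G.⁻¹) H.≈ to x H.⁻¹
  ⁻¹-homo x = inverseˡ-unique _ _
    (H.trans (H.sym (homo _ _)) (H.trans (cong-≈ (G.inverseˡ x)) ε-homo))

  •-homo : ∀ i x → to (i •ᴳ x) H.≈ i • to x
  •-homo i x = H.trans
    (additive-unique (λ i → to (i •ᴳ x)) (λ i j → H.trans (cong-≈ (IntegerMultiples.•-additive G x i j)) (homo _ _)) i)
    (•-congˡ i (cong-≈ (IntegerMultiples.1•x≈x G x)))

module Evaluation {X : Set} (G : AbelianGroup 0ℓ 0ℓ) where

  open AbelianGroup G
  open Presentation X

  eval : (X → Carrier) → Term → Carrier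
  eval f (gen x) = f x
  eval f 𝟎       = ε
  eval f (s ⊕ t) = eval f s ∙ eval f t
  eval f (⊝ t)   = eval f t ⁻¹

  eval-ext : ∀ {f g} → (∀ x → f x ≈ g x) → ∀ t → eval f t ≈ eval g t
  eval-ext f≈g (gen x) = f≈g x
  eval-ext f≈g 𝟎       = refl
  eval-ext f≈g (s ⊕ t) = ∙-cong (eval-ext f≈g s) (eval-ext f≈g t)
  eval-ext f≈g (⊝ t)   = ⁻¹-cong (eval-ext f≈g t)

  -- The universal property of the presented group.
  evaluation : ∀ {Relator : Term → Set} f → (∀ {t} → Relator t → eval f t ≈ ε) → Hom (presented Relator) G
  evaluation {Relator} f kills = record
    { to = eval f ; cong-≈ = eval-cong ; homo = λ _ _ → refl }
    where
    eval-cong : ∀ {s t} → Provable Relator s t → eval f s ≈ eval f t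
    eval-cong (relator r)     = kills r
    eval-cong ≈-refl          = refl
    eval-cong (≈-sym p)       = sym (eval-cong p)
    eval-cong (≈-trans p q)   = trans (eval-cong p) (eval-cong q)
    eval-cong (⊕-cong p q)    = ∙-cong (eval-cong p) (eval-cong q)
    eval-cong (⊝-cong p)      = ⁻¹-cong (eval-cong p)
    eval-cong (⊕-assoc s t u) = assoc _ _ _
    eval-cong (⊕-comm s t)    = comm _ _
    eval-cong (⊕-identity t)  = identityˡ _
    eval-cong (⊕-inverse t)   = inverseˡ _

hom-eval : ∀ {X G H} (φ : Hom G H) (f : X → AbelianGroup.Carrier G) t →
           AbelianGroup._≈_ H (Hom.to φ (Evaluation.eval G f t)) (Evaluation.eval H (Hom.to φ ∘ f) t)
hom-eval {X} {G} {H} φ f = go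
  where
  open Presentation X
  open AbelianGroup H
  open Hom φ
  go : ∀ t → to (Evaluation.eval G f t) ≈ Evaluation.eval H (to ∘ f) t
  go (gen x) = refl
  go 𝟎       = ε-homo
  go (s ⊕ t) = trans (homo _ _) (∙-cong (go s) (go t))
  go (⊝ t)   = trans (⁻¹-homo _) (⁻¹-cong (go t))

Labelling : ∀ {l m n} → Rel3 (Fin l) (Fin m) (Fin n) → (G : AbelianGroup 0ℓ 0ℓ) →
            (Vertex l m n → AbelianGroup.Carrier G) → Set
Labelling W G f = ∀ {r c s} → W r c s → f (row r) ∙ f (column c) ∙ f (symbol s) ≈ ε
  where open AbelianGroup G

module _ {l m n N : ℕ} {W : Rel3 (Fin l) (Fin m) (Fin n)} (E : Enumeration ⟪ W ⟫ N) where

  open Presentation (Vertex l m n)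

  𝒜ₑ : AbelianGroup 0ℓ 0ℓ
  𝒜ₑ = 𝒜 (tripleSet E)

  relation : Labelling W 𝒜ₑ gen
  relation w = relator (r+c+s (∈-tripleSet⁺ E w))

  labelHom : ∀ G f → Labelling W G f → Hom 𝒜ₑ G
  labelHom G f lab = Evaluation.evaluation G f (λ { (r+c+s t) → lab (∈-tripleSet⁻ E t) })

  open AbelianGroup 𝒜ₑ
  open IntegerMultiples 𝒜ₑ

  -- K is the quotient of 𝒜ₑ by a subgroup ⟨X , Y⟩ ≅ ℤ ⊕ ℤ which the section splits off.
  record Coordinates (K : AbelianGroup 0ℓ 0ℓ) (X Y : Term) : Set where
    field
      label     : Vertex l m n → AbelianGroup.Carrier K
      labelling : Labelling W K label
      section   : Hom K 𝒜ₑ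
    module section = Hom section
    open section public using () renaming (to to ψ)
    field
      label-ψ  : ∀ k → AbelianGroup._≈_ K (Evaluation.eval K label (ψ k)) k
      ψ-row    : ∀ r → ψ (label (row r)) ≈ gen (row r) ⊕ ⊝ X
      ψ-column : ∀ c → ψ (label (column c)) ≈ gen (column c) ⊕ ⊝ Y
      ψ-symbol : ∀ s → ψ (label (symbol s)) ≈ gen (symbol s) ⊕ (X ⊕ Y)

  module _ {K : AbelianGroup 0ℓ 0ℓ} {X Y : Term} (coords : Coordinates K X Y)
           (K-torsion : ∀ k → Torsion.IsTorsion K k) where

    open Coordinates coords
    private
      module K = AbelianGroup K
      module ψ = Hom section

      evalℤ : (Vertex l m n → ℤ) → Term → ℤ
      evalℤ = Evaluation.eval ℤ.+-0-abelianGroup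

      -- Labellings into ℤ that exist for every `W`, because 1 + 0 - 1 = 0. They read off the
      -- coefficients of `X` and `Y`.
      degX degY : Vertex l m n → ℤ
      degX (row _)    = 1ℤ
      degX (column _) = 0ℤ
      degX (symbol _) = -1ℤ
      degY (row _)    = 0ℤ
      degY (column _) = 1ℤ
      degY (symbol _) = -1ℤ

      φ : Hom 𝒜ₑ K
      φ = labelHom K label labelling
      module φ = Hom φ

      -- Both sides respect the group operations, so only generators matter, and there it is one of
      -- the fields `ψ-row`, `ψ-column`, `ψ-symbol`.
      decompose : ∀ t → ψ (φ.to t) ≈ t ⊕ ⊝ (evalℤ degX t • X) ⊕ ⊝ (evalℤ degY t • Y)
      decompose t = trans (hom-eval section label t) (go t)
        where
        open SetoidReasoning setoid
        go : ∀ t → Evaluation.eval 𝒜ₑ (ψ ∘ label) t ≈ t ⊕ ⊝ (evalℤ degX t • X) ⊕ ⊝ (evalℤ degY t • Y)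
        -- `1ℤ • X` computes to `X ∙ ε` and `0ℤ • Y` to `ε`; hence `var 1F :+ :0` and the lone `:0`.
        go (gen (row r)) = trans (ψ-row r)
          (linear (gen (row r) ∷ X ∷ []) (var 0F :+ :- var 1F) (var 0F :+ :- (var 1F :+ :0) :+ :- :0) ≡.refl)
        go (gen (column c)) = trans (ψ-column c)
          (linear (gen (column c) ∷ Y ∷ []) (var 0F :+ :- var 1F) (var 0F :+ :- :0 :+ :- (var 1F :+ :0)) ≡.refl)
        go (gen (symbol s)) = trans (ψ-symbol s)
          (linear (gen (symbol s) ∷ X ∷ Y ∷ []) (var 0F :+ (var 1F :+ var 2F))
            (var 0F :+ :- (:- (var 1F :+ :0)) :+ :- (:- (var 2F :+ :0))) ≡.refl)
        go 𝟎 = linear [] :0 (:0 :+ :- :0 :+ :- :0) ≡.refl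
        go (s ⊕ t) = begin
          _ ≈⟨ ∙-cong (go s) (go t) ⟩
          _ ≈⟨ linear (s ∷ t ∷ evalℤ degX s • X ∷ evalℤ degX t • X ∷ evalℤ degY s • Y ∷ evalℤ degY t • Y ∷ [])
                 ((var 0F :+ :- var 2F :+ :- var 4F) :+ (var 1F :+ :- var 3F :+ :- var 5F))
                 ((var 0F :+ var 1F) :+ :- (var 2F :+ var 3F) :+ :- (var 4F :+ var 5F)) ≡.refl ⟩
          _ ≈⟨ ∙-cong (∙-congˡ (⁻¹-cong (•-additive X (evalℤ degX s) (evalℤ degX t))))
                      (⁻¹-cong (•-additive Y (evalℤ degY s) (evalℤ degY t))) ⟨
          _ ∎
        go (⊝ t) = begin
          _ ≈⟨ ⁻¹-cong (go t) ⟩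
          _ ≈⟨ linear (t ∷ evalℤ degX t • X ∷ evalℤ degY t • Y ∷ [])
                 (:- (var 0F :+ :- var 1F :+ :- var 2F)) (:- var 0F :+ :- (:- var 1F) :+ :- (:- var 2F)) ≡.refl ⟩
          _ ≈⟨ ∙-cong (∙-congˡ (⁻¹-cong (-‿• (evalℤ degX t) X))) (⁻¹-cong (-‿• (evalℤ degY t) Y)) ⟨
          _ ∎

      -- A labelling into ℤ is a homomorphism to a torsion-free group.
      degree-torsion : ∀ d → Labelling W ℤ.+-0-abelianGroup d → ∀ {t} → Torsion.IsTorsion 𝒜ₑ t → evalℤ d t ≡ 0ℤ
      degree-torsion d lab {t} (k , k≢0 , kt≈0) =
        ℤ.*-cancelˡ-≡ (+ k) (evalℤ d t) 0ℤ {{k≢0}} (begin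
          + k ℤ.* evalℤ d t             ≡⟨ IntegerMultiples.additive-unique ℤ.+-0-abelianGroup (ℤ._* evalℤ d t)
                                            (ℤ.*-distribʳ-+ (evalℤ d t)) (+ k) ⟩
          (+ k) •ᶻ (1ℤ ℤ.* evalℤ d t)     ≡⟨ cong ((+ k) •ᶻ_) (ℤ.*-identityˡ (evalℤ d t)) ⟩
          (+ k) •ᶻ evalℤ d t              ≡⟨ Hom.•-homo D (+ k) t ⟨
          evalℤ d ((+ k) • t)             ≡⟨ Hom.cong-≈ D kt≈0 ⟩
          0ℤ                            ≡⟨ ℤ.*-zeroʳ (+ k) ⟨
          + k ℤ.* 0ℤ                    ∎)
        where
        open ≡.≡-Reasoning
        open IntegerMultiples ℤ.+-0-abelianGroup using () renaming (_•_ to _•ᶻ_)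
        D : Hom 𝒜ₑ ℤ.+-0-abelianGroup
        D = labelHom _ d lab

      ψφ : ∀ {t} → Torsion.IsTorsion 𝒜ₑ t → ψ (φ.to t) ≈ t
      ψφ {t} tors = begin
        ψ (φ.to t)                                               ≈⟨ decompose t ⟩
        t ⊕ ⊝ (evalℤ degX t • X) ⊕ ⊝ (evalℤ degY t • Y)
          ≡⟨ cong₂ (λ i j → t ⊕ ⊝ (i • X) ⊕ ⊝ (j • Y)) (degree-torsion degX (λ _ → ≡.refl) tors)
                                                       (degree-torsion degY (λ _ → ≡.refl) tors) ⟩
        t ⊕ ⊝ 𝟎 ⊕ ⊝ 𝟎
          ≈⟨ linear (t ∷ []) (var 0F :+ :- :0 :+ :- :0) (var 0F) ≡.refl ⟩
        t                                                        ∎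
        where open SetoidReasoning setoid

    -- On torsion elements the two degrees vanish, so `decompose` makes `ψ` a left inverse of `φ`.
    -- Conversely `ψ` lands in the torsion subgroup because `K` is a torsion group.
    torsion≅ : AbelianGroup.group (torsionSubgroup 𝒜ₑ) ≅ AbelianGroup.group K
    torsion≅ = φ.to ∘ proj₁ , record
      { isGroupMonomorphism = record
        { isGroupHomomorphism = record
          { isMonoidHomomorphism = record
            { isMagmaHomomorphism = record
              { isRelHomomorphism = record { cong = φ.cong-≈ }
              ; homo = λ (s , _) (t , _) → φ.homo s t
              }
            ; ε-homo = φ.ε-homo
            }
          ; ⁻¹-homo = λ (t , _) → φ.⁻¹-homo t
          }
        ; injective = λ { {s , p} {t , q} eq → trans (sym (ψφ p)) (trans (ψ.cong-≈ eq) (ψφ q)) }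
        }
      ; surjective = λ k → let j , j≢0 , jk≈0 = K-torsion k in
          (ψ k , j , j≢0 , trans (sym (ψ.•-homo (+ j) k)) (trans (ψ.cong-≈ jk≈0) ψ.ε-homo)) ,
          λ { {t , _} eq → K.trans (φ.cong-≈ eq) (label-ψ k) }
      }

module _ (H K : AbelianGroup 0ℓ 0ℓ) where
  private
    module H = AbelianGroup H
    module K = AbelianGroup K

  inl : Hom H (DirectProduct.abelianGroup H K)
  inl = record { to = _, K.ε ; cong-≈ = _, K.refl ; homo = λ _ _ → H.refl , K.sym (K.identityˡ K.ε) }

  fst : Hom (DirectProduct.abelianGroup H K) H
  fst = record { to = proj₁ ; cong-≈ = proj₁ ; homo = λ _ _ → H.refl }

  snd : Hom (DirectProduct.abelianGroup H K) K
  snd = record { to = proj₂ ; cong-≈ = proj₂ ; homo = λ _ _ → K.refl }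

  inr : Hom K (DirectProduct.abelianGroup H K)
  inr = record { to = H.ε ,_ ; cong-≈ = H.refl ,_ ; homo = λ _ _ → H.sym (H.identityˡ H.ε) , K.refl }

•-mod : ∀ (G : AbelianGroup 0ℓ 0ℓ) (let open AbelianGroup G) (let open IntegerMultiples G) {q x} →
        (+ q) • x ≈ ε → ∀ i j → i ≡ j [mod q ] → i • x ≈ j • x
•-mod G {q} {x} qx≈ε i j (divides k i-j≡kq) = begin
  i • x                            ≡⟨ cong (_• x) (split i j) ⟨
  ((i ℤ.- j) ℤ.+ j) • x            ≈⟨ •-additive x (i ℤ.- j) j ⟩
  (i ℤ.- j) • x ∙ j • x            ≡⟨ cong (λ d → d • x ∙ j • x) i-j≡kq ⟩
  (k ℤ.* + q) • x ∙ j • x          ≈⟨ ∙-congʳ (*-• k (+ q) x) ⟩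
  k • ((+ q) • x) ∙ j • x          ≈⟨ ∙-congʳ (•-congˡ k qx≈ε) ⟩
  k • ε ∙ j • x                    ≈⟨ ∙-congʳ (additive-unique (λ _ → ε) (λ _ _ → sym (identityˡ ε)) k) ⟨
  ε ∙ j • x                        ≈⟨ identityˡ _ ⟩
  j • x                            ∎
  where
  open AbelianGroup G
  open IntegerMultiples G
  open SetoidReasoning setoid
  split : ∀ i j → (i ℤ.- j) ℤ.+ j ≡ i
  split = solve-∀

-- Coordinates of a connected sum

module _ {l₁ l₂ l m₁ m₂ m n₁ n₂ n : ℕ}
         {x₁ : Fin l₁} {x₂ : Fin l₂} {y₁ : Fin m₁} {y₂ : Fin m₂} {z₁ : Fin n₁} {z₂ : Fin n₂}
         {𝒳 : Amalgam x₁ x₂ (Fin l)} {𝒴 : Amalgam y₁ y₂ (Fin m)} {𝒵 : Amalgam z₁ z₂ (Fin n)}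
         {W₁ B₁ : Rel3 (Fin l₁) (Fin m₁) (Fin n₁)} {W₂ B₂ : Rel3 (Fin l₂) (Fin m₂) (Fin n₂)}
         {W B : Rel3 (Fin l) (Fin m) (Fin n)} (S : IsSum 𝒳 𝒴 𝒵 W₁ B₁ W₂ B₂ W B) where

  private
    module X = Amalgam 𝒳
    module Y = Amalgam 𝒴
    module Z = Amalgam 𝒵
    open IsSum S

  embed₁ : Vertex l₁ m₁ n₁ → Vertex l m n
  embed₁ (row r)    = row (X.ι₁ r)
  embed₁ (column c) = column (Y.ι₁ c)
  embed₁ (symbol s) = symbol (Z.ι₁ s)

  embed₂ : Vertex l₂ m₂ n₂ → Vertex l m n
  embed₂ (row r)    = row (X.ι₂ r)
  embed₂ (column c) = column (Y.ι₂ c)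
  embed₂ (symbol s) = symbol (Z.ι₂ s)

  module _ {A : Set} (f : Vertex l₁ m₁ n₁ → A) (g : Vertex l₂ m₂ n₂ → A) where
    pair : Vertex l m n → A
    pair (row r)    = X.copair (f ∘ row) (g ∘ row) r
    pair (column c) = Y.copair (f ∘ column) (g ∘ column) c
    pair (symbol s) = Z.copair (f ∘ symbol) (g ∘ symbol) s

  module _ (G : AbelianGroup 0ℓ 0ℓ) where

    open AbelianGroup G

    module _ (f : Vertex l₁ m₁ n₁ → Carrier) (g : Vertex l₂ m₂ n₂ → Carrier)
             (row≈    : f (row x₁) ≈ g (row x₂))
             (column≈ : f (column y₁) ≈ g (column y₂))
             (symbol≈ : f (symbol z₁) ≈ g (symbol z₂)) where

      pair-embed₁ : ∀ v → pair f g (embed₁ v) ≈ f v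
      pair-embed₁ (row r)    = X.copair-ι₁ setoid row≈ r
      pair-embed₁ (column c) = Y.copair-ι₁ setoid column≈ c
      pair-embed₁ (symbol s) = Z.copair-ι₁ setoid symbol≈ s

      pair-embed₂ : ∀ v → pair f g (embed₂ v) ≈ g v
      pair-embed₂ (row r)    = X.copair-ι₂ setoid row≈ r
      pair-embed₂ (column c) = Y.copair-ι₂ setoid column≈ c
      pair-embed₂ (symbol s) = Z.copair-ι₂ setoid symbol≈ s

      pair-labelling : Labelling W₁ G f → Labelling (W₂ ∖ (x₂ , y₂ , z₂)) G g → Labelling W G (pair f g)
      pair-labelling lab₁ lab₂ w with white⁻ w
      ... | inj₁ (a , b , c , w₁ , ≡.refl , ≡.refl , ≡.refl) = trans
        (∙-cong (∙-cong (pair-embed₁ (row a)) (pair-embed₁ (column b))) (pair-embed₁ (symbol c))) (lab₁ w₁)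
      ... | inj₂ (a , b , c , w₂ , ≡.refl , ≡.refl , ≡.refl) = trans
        (∙-cong (∙-cong (pair-embed₂ (row a)) (pair-embed₂ (column b))) (pair-embed₂ (symbol c))) (lab₂ w₂)

  -- The white triple removed from the second sphere is a relation of 𝒜 W₂ but not of 𝒜 W, where
  -- its value is the value ĝ of the removed black triple.  As q kills ĝ, the labelling h, which
  -- is 1 on the removed triple and 0 mod q on the others, corrects the labels of the second sphere.
  module SumCoordinates {N₁ N₂ N : ℕ}
    (E₁ : Enumeration ⟪ W₁ ⟫ N₁) (E₂ : Enumeration ⟪ W₂ ⟫ N₂) (E : Enumeration ⟪ W ⟫ N)
    {K₁ K₂ : AbelianGroup 0ℓ 0ℓ} {X₁ Y₁ : Presentation.Term (Vertex l₁ m₁ n₁)}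
    (C₁ : Coordinates E₁ K₁ X₁ Y₁)
    (C₂ : Coordinates E₂ K₂ (Presentation.gen (row x₂)) (Presentation.gen (column y₂)))
    (q : ℕ) (h : Vertex l₂ m₂ n₂ → ℤ.ℤ) (h-labelling : Labelling (W₂ ∖ (x₂ , y₂ , z₂)) (ℤ/ q) h)
    (h-row : h (row x₂) ≡ 0ℤ [mod q ]) (h-column : h (column y₂) ≡ 0ℤ [mod q ])
    (h-symbol : h (symbol z₂) ≡ 1ℤ [mod q ])
    where

    private
      module K₁ = AbelianGroup K₁
      module K₂ = AbelianGroup K₂
      module C₁ = Coordinates C₁
      module C₂ = Coordinates C₂
      f₁ = C₁.label
      f₂ = C₂.label
      open IntegerMultiples K₁ using () renaming (_•_ to _•₁_)

    g : K₁.Carrier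
    g = f₁ (row x₁) K₁.∙ f₁ (column y₁) K₁.∙ f₁ (symbol z₁)

    K : AbelianGroup 0ℓ 0ℓ
    K = DirectProduct.abelianGroup K₂ K₁

    label₁ : Vertex l₁ m₁ n₁ → K₂.Carrier × K₁.Carrier
    label₁ v = K₂.ε , f₁ v

    -- The constants are chosen so that over a triple they add up to g - g = 0, leaving only the sum
    -- of `h` times `g`. At the seam `h` is 0, 0, 1 modulo `q`, and the second component becomes the
    -- label `f₁` of the first half.
    label₂ : Vertex l₂ m₂ n₂ → K₂.Carrier × K₁.Carrier
    label₂ v@(row _)    = f₂ v , f₁ (row x₁) K₁.∙ h v •₁ g
    label₂ v@(column _) = f₂ v , f₁ (column y₁) K₁.∙ h v •₁ g
    label₂ v@(symbol _) = f₂ v , f₁ (symbol z₁) K₁.∙ g K₁.⁻¹ K₁.∙ h v •₁ g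

    label : Vertex l m n → K₂.Carrier × K₁.Carrier
    label = pair label₁ label₂

    module _ (f₂-row    : f₂ (row x₂) K₂.≈ K₂.ε)
             (f₂-column : f₂ (column y₂) K₂.≈ K₂.ε)
             (f₂-symbol : f₂ (symbol z₂) K₂.≈ K₂.ε)
             (qg≈ε      : (+ q) •₁ g K₁.≈ K₁.ε) where

      private
        module K = AbelianGroup K

        row≈ : (K₂.ε , f₁ (row x₁)) K.≈ label₂ (row x₂)
        row≈ = K₂.sym f₂-row , K₁.sym (K₁.trans (K₁.∙-congˡ (•-mod K₁ qg≈ε (h (row x₂)) 0ℤ h-row)) (K₁.identityʳ _))

        column≈ : (K₂.ε , f₁ (column y₁)) K.≈ label₂ (column y₂)
        column≈ = K₂.sym f₂-column , K₁.sym (K₁.trans (K₁.∙-congˡ (•-mod K₁ qg≈ε (h (column y₂)) 0ℤ h-column)) (K₁.identityʳ _))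

        symbol≈ : (K₂.ε , f₁ (symbol z₁)) K.≈ label₂ (symbol z₂)
        symbol≈ = K₂.sym f₂-symbol , K₁.sym (K₁.trans
          (K₁.∙-congˡ (•-mod K₁ qg≈ε (h (symbol z₂)) 1ℤ h-symbol))
          (linear (f₁ (symbol z₁) ∷ g ∷ []) (var 0F :+ :- var 1F :+ (var 1F :+ :0)) (var 0F) ≡.refl))
          where open IntegerMultiples K₁ using (linear; var; _:+_; :-_; :0)

      label-embed₁ : ∀ v → label (embed₁ v) K.≈ (K₂.ε , f₁ v)
      label-embed₁ = pair-embed₁ K label₁ label₂ row≈ column≈ symbol≈

      label-embed₂ : ∀ v → label (embed₂ v) K.≈ label₂ v
      label-embed₂ = pair-embed₂ K label₁ label₂ row≈ column≈ symbol≈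

      private
        label-sum₂ : ∀ r c s → label₂ (row r) K.∙ label₂ (column c) K.∙ label₂ (symbol s) K.≈
          (f₂ (row r) K₂.∙ f₂ (column c) K₂.∙ f₂ (symbol s) ,
           (h (row r) ℤ.+ h (column c) ℤ.+ h (symbol s)) •₁ g)
        label-sum₂ r c s = K₂.refl , K₁.trans
          (M.linear (f₁ (row x₁) ∷ f₁ (column y₁) ∷ f₁ (symbol z₁)
                    ∷ h (row r) •₁ g ∷ h (column c) •₁ g ∷ h (symbol s) •₁ g ∷ [])
             ((v 0F M.:+ v 3F) M.:+ (v 1F M.:+ v 4F) M.:+
              (v 2F M.:+ M.:- (v 0F M.:+ v 1F M.:+ v 2F) M.:+ v 5F))
             (v 3F M.:+ v 4F M.:+ v 5F) ≡.refl)
          (K₁.sym (sum-• K₁ (h (row r)) (h (column c)) (h (symbol s)) g))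
          where
          module M = IntegerMultiples K₁
          v : Fin 6 → M.Expr 6
          v = M.var

      label-triple₂ : ∀ r c s →
        label (row (X.ι₂ r)) K.∙ label (column (Y.ι₂ c)) K.∙ label (symbol (Z.ι₂ s)) K.≈
        (f₂ (row r) K₂.∙ f₂ (column c) K₂.∙ f₂ (symbol s) ,
         (h (row r) ℤ.+ h (column c) ℤ.+ h (symbol s)) •₁ g)
      label-triple₂ r c s = K.trans
        (K.∙-cong (K.∙-cong (label-embed₂ (row r)) (label-embed₂ (column c))) (label-embed₂ (symbol s)))
        (label-sum₂ r c s)

      -- This passes the torsion condition on to a mark of the second half, so that a further sphere
      -- can be glued there.
      mark-torsion₂ : ∀ b r c s →
        AbelianGroup._≈_ K₂ (IntegerMultiples._•_ K₂ (+ b) (f₂ (row r) K₂.∙ f₂ (column c) K₂.∙ f₂ (symbol s))) K₂.ε →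
        (+ b) ℤ.* (h (row r) ℤ.+ h (column c) ℤ.+ h (symbol s)) ≡ 0ℤ [mod q ] →
        IntegerMultiples._•_ K (+ b)
          (label (row (X.ι₂ r)) K.∙ label (column (Y.ι₂ c)) K.∙ label (symbol (Z.ι₂ s))) K.≈ K.ε
      mark-torsion₂ b r c s bf≈ε bh≡0 = K.trans
        (IntegerMultiples.•-congˡ K (+ b) (label-triple₂ r c s))
        (K₂.trans (Hom.•-homo (fst K₂ K₁) (+ b) _) bf≈ε ,
         K₁.trans (Hom.•-homo (snd K₂ K₁) (+ b) _)
           (K₁.trans (K₁.sym (IntegerMultiples.*-• K₁ (+ b) (h (row r) ℤ.+ h (column c) ℤ.+ h (symbol s)) g))
             (•-mod K₁ qg≈ε ((+ b) ℤ.* (h (row r) ℤ.+ h (column c) ℤ.+ h (symbol s))) 0ℤ bh≡0)))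

      private
        module 𝒜₁ = AbelianGroup (𝒜ₑ E₁)
        module 𝒜₂ = AbelianGroup (𝒜ₑ E₂)
        open AbelianGroup (𝒜ₑ E)
        open IntegerMultiples (𝒜ₑ E)
        open Presentation (Vertex l m n)
        module P₁ = Presentation (Vertex l₁ m₁ n₁)
        module P₂ = Presentation (Vertex l₂ m₂ n₂)

        labelling : Labelling W K label
        labelling = pair-labelling K label₁ label₂ row≈ column≈ symbol≈
          (λ w → K₂.trans (K₂.∙-congʳ (K₂.identityˡ _)) (K₂.identityˡ _) , C₁.labelling w)
          (λ {r} {c} {s} w → K.trans (label-sum₂ r c s) (C₂.labelling (proj₁ w) , •-mod K₁ qg≈ε (h (row r) ℤ.+ h (column c) ℤ.+ h (symbol s)) 0ℤ (h-labelling w)))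

        φ : Hom (𝒜ₑ E) K
        φ = labelHom E K label labelling
        module φ = Hom φ

        ι : Hom (𝒜ₑ E₁) (𝒜ₑ E)
        ι = labelHom E₁ (𝒜ₑ E) (gen ∘ embed₁) (relation E ∘ white₁)
        module ι = Hom ι

        x y z ĝ : Term
        x = gen (row (X.ι₁ x₁))
        y = gen (column (Y.ι₁ y₁))
        z = gen (symbol (Z.ι₁ z₁))
        ĝ = x ⊕ y ⊕ z

        -- The shifts by `X₁` and `Y₁` cancel in a sum of one row, one column and one symbol.
        ιψg : ι.to (C₁.ψ g) ≈ ĝ
        ιψg = ι.cong-≈ (begin
          C₁.ψ g
            ≈⟨ C₁.section.homo _ _ ⟩
          _ ≈⟨ 𝒜₁.∙-cong (𝒜₁.trans (C₁.section.homo _ _) (𝒜₁.∙-cong (C₁.ψ-row x₁) (C₁.ψ-column y₁)))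
                         (C₁.ψ-symbol z₁) ⟩
          _ ≈⟨ M.linear (P₁.gen (row x₁) ∷ P₁.gen (column y₁) ∷ P₁.gen (symbol z₁) ∷ X₁ ∷ Y₁ ∷ [])
                 ((v 0F M.:+ M.:- v 3F) M.:+ (v 1F M.:+ M.:- v 4F) M.:+ (v 2F M.:+ (v 3F M.:+ v 4F)))
                 (v 0F M.:+ v 1F M.:+ v 2F) ≡.refl ⟩
          P₁.gen (row x₁) P₁.⊕ P₁.gen (column y₁) P₁.⊕ P₁.gen (symbol z₁) ∎)
          where
          module M = IntegerMultiples (𝒜ₑ E₁)
          v : Fin 5 → M.Expr 5
          v = M.var
          open SetoidReasoning 𝒜₁.setoid

        qĝ≈𝟎 : (+ q) • ĝ ≈ 𝟎
        qĝ≈𝟎 = begin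
          (+ q) • ĝ                   ≈⟨ •-congˡ (+ q) ιψg ⟨
          (+ q) • ι.to (C₁.ψ g)       ≈⟨ ι.•-homo (+ q) (C₁.ψ g) ⟨
          ι.to ((+ q) •ᵃ C₁.ψ g)      ≈⟨ ι.cong-≈ (C₁.section.•-homo (+ q) g) ⟨
          ι.to (C₁.ψ ((+ q) •₁ g))    ≈⟨ ι.cong-≈ (𝒜₁.trans (C₁.section.cong-≈ qg≈ε) C₁.section.ε-homo) ⟩
          𝟎                       ∎
          where
          open SetoidReasoning setoid
          open IntegerMultiples (𝒜ₑ E₁) using () renaming (_•_ to _•ᵃ_)

        -- The reverse of the twist in `label₂`: subtracting the seam and the `h`-multiple of `ĝ`
        -- makes all three marked vertices vanish. The relation of the removed white triple is
        -- thereby restored, and `χ` is defined on the whole of the second group.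
        χ-label : Vertex l₂ m₂ n₂ → Term
        χ-label v@(row r)    = gen (embed₂ v) ⊕ ⊝ x ⊕ ⊝ (h v • ĝ)
        χ-label v@(column c) = gen (embed₂ v) ⊕ ⊝ y ⊕ ⊝ (h v • ĝ)
        χ-label v@(symbol s) = gen (embed₂ v) ⊕ ⊝ z ⊕ ĝ ⊕ ⊝ (h v • ĝ)

        χ-row : χ-label (row x₂) ≈ 𝟎
        χ-row rewrite ≡.sym X.glued = trans (∙-congˡ (⁻¹-cong (•-mod (𝒜ₑ E) qĝ≈𝟎 (h (row x₂)) 0ℤ h-row)))
          (linear (x ∷ []) (var 0F :+ :- var 0F :+ :- :0) :0 ≡.refl)

        χ-column : χ-label (column y₂) ≈ 𝟎
        χ-column rewrite ≡.sym Y.glued = trans (∙-congˡ (⁻¹-cong (•-mod (𝒜ₑ E) qĝ≈𝟎 (h (column y₂)) 0ℤ h-column)))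
          (linear (y ∷ []) (var 0F :+ :- var 0F :+ :- :0) :0 ≡.refl)

        χ-symbol : χ-label (symbol z₂) ≈ 𝟎
        χ-symbol rewrite ≡.sym Z.glued = trans (∙-congˡ (⁻¹-cong (•-mod (𝒜ₑ E) qĝ≈𝟎 (h (symbol z₂)) 1ℤ h-symbol)))
          (linear (z ∷ ĝ ∷ []) (var 0F :+ :- var 0F :+ var 1F :+ :- (var 1F :+ :0)) :0 ≡.refl)

        mark? : ∀ (t : Fin l₂ × Fin m₂ × Fin n₂) →
                Dec (proj₁ t ≡ x₂ × proj₁ (proj₂ t) ≡ y₂ × proj₂ (proj₂ t) ≡ z₂)
        mark? (r , c , s) = r Fin.≟ x₂ ×-dec c Fin.≟ y₂ ×-dec s Fin.≟ z₂

        unmarked : ∀ {r c s} → W₂ r c s → ¬ (r ≡ x₂ × c ≡ y₂ × s ≡ z₂) → W (X.ι₂ r) (Y.ι₂ c) (Z.ι₂ s)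
        unmarked w ne with white₂ w
        ... | inj₁ eq = contradiction eq ne
        ... | inj₂ w′ = w′

        χ-labelling : Labelling W₂ (𝒜ₑ E) χ-label
        χ-labelling {r} {c} {s} w with mark? (r , c , s)
        ... | yes (≡.refl , ≡.refl , ≡.refl) = trans (∙-cong (∙-cong χ-row χ-column) χ-symbol)
          (linear [] (:0 :+ :0 :+ :0) :0 ≡.refl)
        ... | no ne = begin
          _ ≈⟨ linear (gen (row (X.ι₂ r)) ∷ gen (column (Y.ι₂ c)) ∷ gen (symbol (Z.ι₂ s)) ∷ x ∷ y ∷ z ∷
                       h (row r) • ĝ ∷ h (column c) • ĝ ∷ h (symbol s) • ĝ ∷ [])
                 ((v 0F :+ :- v 3F :+ :- v 6F) :+ (v 1F :+ :- v 4F :+ :- v 7F) :+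
                  (v 2F :+ :- v 5F :+ (v 3F :+ v 4F :+ v 5F) :+ :- v 8F))
                 ((v 0F :+ v 1F :+ v 2F) :+ :- (v 6F :+ v 7F :+ v 8F)) ≡.refl ⟩
          _ ≈⟨ ∙-cong (relation E (unmarked w ne)) (⁻¹-cong (trans (sym (sum-• (𝒜ₑ E) (h (row r)) (h (column c)) (h (symbol s)) ĝ))
                                                     (•-mod (𝒜ₑ E) qĝ≈𝟎 (h (row r) ℤ.+ h (column c) ℤ.+ h (symbol s)) 0ℤ (h-labelling (w , ne))))) ⟩
          _ ≈⟨ linear [] (:0 :+ :- :0) :0 ≡.refl ⟩
          𝟎 ∎
          where
          v : Fin 9 → Expr 9
          v = var
          open SetoidReasoning setoid

        χ : Hom (𝒜ₑ E₂) (𝒜ₑ E)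
        χ = labelHom E₂ (𝒜ₑ E) χ-label χ-labelling
        module χ = Hom χ

        section : Hom K (𝒜ₑ E)
        section = record
          { to     = λ (k₂ , k₁) → χ.to (C₂.ψ k₂) ⊕ ι.to (C₁.ψ k₁)
          ; cong-≈ = λ (p , q) → ∙-cong (χ.cong-≈ (C₂.section.cong-≈ p)) (ι.cong-≈ (C₁.section.cong-≈ q))
          ; homo   = λ (k₂ , k₁) (k₂′ , k₁′) → trans
              (∙-cong (χ.cong-≈ (C₂.section.homo k₂ k₂′))
                      (ι.cong-≈ (C₁.section.homo k₁ k₁′)))
              (linear (χ.to (C₂.ψ k₂) ∷ χ.to (C₂.ψ k₂′) ∷ ι.to (C₁.ψ k₁) ∷ ι.to (C₁.ψ k₁′) ∷ [])
                ((var 0F :+ var 1F) :+ (var 2F :+ var 3F)) ((var 0F :+ var 2F) :+ (var 1F :+ var 3F)) ≡.refl)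
          }

        φι : ∀ t → φ.to (ι.to t) K.≈ (K₂.ε , Evaluation.eval K₁ f₁ t)
        φι t = K.trans (hom-eval φ (gen ∘ embed₁) t)
          (K.trans (Evaluation.eval-ext K label-embed₁ t) (K.sym (hom-eval (inr K₂ K₁) f₁ t)))

        φ-•ĝ : ∀ i → φ.to (i • ĝ) K.≈ (K₂.ε , i •₁ g)
        φ-•ĝ i = K.trans (φ.•-homo i ĝ) (K.trans
          (IntegerMultiples.•-congˡ K i
            (K.trans (K.∙-cong (K.∙-cong (label-embed₁ (row x₁)) (label-embed₁ (column y₁))) (label-embed₁ (symbol z₁)))
              (K₂.trans (K₂.∙-congʳ (K₂.identityˡ _)) (K₂.identityˡ _) , K₁.refl)))
          (K.sym (Hom.•-homo (inr K₂ K₁) i g)))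

        -- What `label₂` adds in the second component is what `χ-label` takes away, so `χ` splits
        -- off the factor `K₂`.
        φχ-label : ∀ v → φ.to (χ-label v) K.≈ (f₂ v , K₁.ε)
        φχ-label v@(row _) = K.trans
          (K.∙-cong (K.∙-cong (label-embed₂ v) (K.⁻¹-cong (label-embed₁ (row x₁)))) (K.⁻¹-cong (φ-•ĝ (h v))))
          (M₂.linear (f₂ v ∷ []) (M₂.var 0F M₂.:+ M₂.:- M₂.:0 M₂.:+ M₂.:- M₂.:0) (M₂.var 0F) ≡.refl ,
           M₁.linear (f₁ (row x₁) ∷ h v •₁ g ∷ [])
             ((M₁.var 0F M₁.:+ M₁.var 1F) M₁.:+ M₁.:- M₁.var 0F M₁.:+ M₁.:- M₁.var 1F) M₁.:0 ≡.refl)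
          where module M₁ = IntegerMultiples K₁
                module M₂ = IntegerMultiples K₂
        φχ-label v@(column _) = K.trans
          (K.∙-cong (K.∙-cong (label-embed₂ v) (K.⁻¹-cong (label-embed₁ (column y₁)))) (K.⁻¹-cong (φ-•ĝ (h v))))
          (M₂.linear (f₂ v ∷ []) (M₂.var 0F M₂.:+ M₂.:- M₂.:0 M₂.:+ M₂.:- M₂.:0) (M₂.var 0F) ≡.refl ,
           M₁.linear (f₁ (column y₁) ∷ h v •₁ g ∷ [])
             ((M₁.var 0F M₁.:+ M₁.var 1F) M₁.:+ M₁.:- M₁.var 0F M₁.:+ M₁.:- M₁.var 1F) M₁.:0 ≡.refl)
          where module M₁ = IntegerMultiples K₁
                module M₂ = IntegerMultiples K₂
        φχ-label v@(symbol _) = K.trans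
          (K.∙-cong (K.∙-cong (K.∙-cong (label-embed₂ v) (K.⁻¹-cong (label-embed₁ (symbol z₁)))) φ-ĝ)
                    (K.⁻¹-cong (φ-•ĝ (h v))))
          (M₂.linear (f₂ v ∷ []) (M₂.var 0F M₂.:+ M₂.:- M₂.:0 M₂.:+ M₂.:0 M₂.:+ M₂.:- M₂.:0) (M₂.var 0F) ≡.refl ,
           M₁.linear (f₁ (symbol z₁) ∷ g ∷ h v •₁ g ∷ [])
             ((M₁.var 0F M₁.:+ M₁.:- M₁.var 1F M₁.:+ M₁.var 2F) M₁.:+ M₁.:- M₁.var 0F M₁.:+ M₁.var 1F
               M₁.:+ M₁.:- M₁.var 2F) M₁.:0 ≡.refl)
          where module M₁ = IntegerMultiples K₁
                module M₂ = IntegerMultiples K₂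
                φ-ĝ : φ.to ĝ K.≈ (K₂.ε , g)
                φ-ĝ = K.trans (φ.cong-≈ (sym (1•x≈x ĝ))) (K.trans (φ-•ĝ 1ℤ) (K₂.refl , M₁.1•x≈x g))

        φχ : ∀ t → φ.to (χ.to t) K.≈ (Evaluation.eval K₂ f₂ t , K₁.ε)
        φχ t = K.trans (hom-eval φ χ-label t)
          (K.trans (Evaluation.eval-ext K φχ-label t) (K.sym (hom-eval (inl K₂ K₁) f₂ t)))

        ιψ : ∀ i k → ι.to (C₁.ψ (k K₁.∙ i •₁ g)) ≈ ι.to (C₁.ψ k) ⊕ i • ĝ
        ιψ i k = begin
          ι.to (C₁.ψ (k K₁.∙ i •₁ g))              ≈⟨ ι.cong-≈ (C₁.section.homo _ _) ⟩
          ι.to (C₁.ψ k) ⊕ ι.to (C₁.ψ (i •₁ g))     ≈⟨ ∙-congˡ (ι.cong-≈ (C₁.section.•-homo i g)) ⟩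
          ι.to (C₁.ψ k) ⊕ ι.to (i •ᵃ C₁.ψ g)       ≈⟨ ∙-congˡ (ι.•-homo i _) ⟩
          ι.to (C₁.ψ k) ⊕ i • ι.to (C₁.ψ g)        ≈⟨ ∙-congˡ (•-congˡ i ιψg) ⟩
          ι.to (C₁.ψ k) ⊕ i • ĝ                    ∎
          where
          open SetoidReasoning setoid
          open IntegerMultiples (𝒜ₑ E₁) using () renaming (_•_ to _•ᵃ_)

        ψ₁ : ∀ v → Hom.to section (label (embed₁ v)) ≈ ι.to (C₁.ψ (f₁ v))
        ψ₁ v = trans (Hom.cong-≈ section (label-embed₁ v))
          (trans (∙-congʳ (trans (χ.cong-≈ C₂.section.ε-homo) χ.ε-homo)) (identityˡ _))

      -- The free part of the first half serves for the sum. `C₂` is normalised at the marked row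
      -- and column, which `χ` sends to zero, so the second half contributes nothing to it.
      X Y : Term
      X = ι.to X₁
      Y = ι.to Y₁

      private
        ψ-row : ∀ {r} → (∃ λ a → X.ι₁ a ≡ r) ⊎ (∃ λ b → X.ι₂ b ≡ r) →
          Hom.to section (label (row r)) ≈ gen (row r) ⊕ ⊝ X
        ψ-row (inj₁ (a , ≡.refl)) = trans (ψ₁ (row a)) (ι.cong-≈ (C₁.ψ-row a))
        ψ-row (inj₂ (b , ≡.refl)) = begin
          _ ≈⟨ Hom.cong-≈ section (label-embed₂ (row b)) ⟩
          _ ≈⟨ ∙-cong (χ.cong-≈ (C₂.ψ-row b)) (trans (ιψ (h (row b)) (f₁ (row x₁))) (∙-congʳ (ι.cong-≈ (C₁.ψ-row x₁)))) ⟩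
          _ ≈⟨ ∙-congʳ (∙-congˡ (⁻¹-cong χ-row)) ⟩
          _ ≈⟨ linear (gen (row (X.ι₂ b)) ∷ x ∷ h (row b) • ĝ ∷ X ∷ [])
                 (var 0F :+ :- var 1F :+ :- var 2F :+ :- :0 :+ (var 1F :+ :- var 3F :+ var 2F))
                 (var 0F :+ :- var 3F) ≡.refl ⟩
          _ ∎
          where open SetoidReasoning setoid

        ψ-column : ∀ {c} → (∃ λ a → Y.ι₁ a ≡ c) ⊎ (∃ λ b → Y.ι₂ b ≡ c) →
          Hom.to section (label (column c)) ≈ gen (column c) ⊕ ⊝ Y
        ψ-column (inj₁ (a , ≡.refl)) = trans (ψ₁ (column a)) (ι.cong-≈ (C₁.ψ-column a))
        ψ-column (inj₂ (b , ≡.refl)) = begin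
          _ ≈⟨ Hom.cong-≈ section (label-embed₂ (column b)) ⟩
          _ ≈⟨ ∙-cong (χ.cong-≈ (C₂.ψ-column b)) (trans (ιψ (h (column b)) (f₁ (column y₁))) (∙-congʳ (ι.cong-≈ (C₁.ψ-column y₁)))) ⟩
          _ ≈⟨ ∙-congʳ (∙-congˡ (⁻¹-cong χ-column)) ⟩
          _ ≈⟨ linear (gen (column (Y.ι₂ b)) ∷ y ∷ h (column b) • ĝ ∷ Y ∷ [])
                 (var 0F :+ :- var 1F :+ :- var 2F :+ :- :0 :+ (var 1F :+ :- var 3F :+ var 2F))
                 (var 0F :+ :- var 3F) ≡.refl ⟩
          _ ∎
          where open SetoidReasoning setoid

        ψ-symbol : ∀ {s} → (∃ λ a → Z.ι₁ a ≡ s) ⊎ (∃ λ b → Z.ι₂ b ≡ s) →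
          Hom.to section (label (symbol s)) ≈ gen (symbol s) ⊕ (X ⊕ Y)
        ψ-symbol (inj₁ (a , ≡.refl)) = trans (ψ₁ (symbol a)) (ι.cong-≈ (C₁.ψ-symbol a))
        ψ-symbol (inj₂ (b , ≡.refl)) = begin
          _ ≈⟨ Hom.cong-≈ section (label-embed₂ (symbol b)) ⟩
          _ ≈⟨ ∙-cong (χ.cong-≈ (C₂.ψ-symbol b)) (trans (ιψ (h (symbol b)) _)
                 (∙-congʳ (trans (ι.cong-≈ (C₁.section.homo _ _))
                   (∙-cong (ι.cong-≈ (C₁.ψ-symbol z₁))
                           (trans (ι.cong-≈ (C₁.section.⁻¹-homo g)) (⁻¹-cong ιψg)))))) ⟩
          _ ≈⟨ ∙-congʳ (∙-congˡ (∙-cong χ-row χ-column)) ⟩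
          _ ≈⟨ linear (gen (symbol (Z.ι₂ b)) ∷ z ∷ ĝ ∷ h (symbol b) • ĝ ∷ X ∷ Y ∷ [])
                 ((var 0F :+ :- var 1F :+ var 2F :+ :- var 3F) :+ (:0 :+ :0) :+
                   (var 1F :+ (var 4F :+ var 5F) :+ :- var 2F :+ var 3F))
                 (var 0F :+ (var 4F :+ var 5F)) ≡.refl ⟩
          _ ∎
          where open SetoidReasoning setoid

      sum-coordinates : Coordinates E K X Y
      sum-coordinates = record
        { label     = label
        ; labelling = labelling
        ; section   = section
        ; label-ψ   = λ (k₂ , k₁) → K.trans (K.∙-cong (φχ (C₂.ψ k₂)) (φι (C₁.ψ k₁)))
            (K₂.trans (K₂.identityʳ _) (C₂.label-ψ k₂) , K₁.trans (K₁.identityˡ _) (C₁.label-ψ k₁))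
        ; ψ-row     = λ r → ψ-row (X.cover r)
        ; ψ-column  = λ c → ψ-column (Y.cover c)
        ; ψ-symbol  = λ s → ψ-symbol (Z.cover s)
        }

module _ (G : AbelianGroup 0ℓ 0ℓ) where

  open AbelianGroup G
  open IntegerMultiples G

  arithmetic-progression : ∀ {m} (x : Fin (suc m) → Carrier) d →
    (∀ i → x (suc i) ≈ x (inject₁ i) ∙ d) → ∀ i → x i ≈ x zero ∙ toℕ i ×ℕ d
  arithmetic-progression x d step = <-weakInduction _ (sym (identityʳ _)) λ i ih → begin
    x (suc i)                                ≈⟨ step i ⟩
    x (inject₁ i) ∙ d                        ≈⟨ ∙-congʳ ih ⟩
    x zero ∙ toℕ (inject₁ i) ×ℕ d ∙ d        ≡⟨ cong (λ k → x zero ∙ k ×ℕ d ∙ d) (Fin.toℕ-inject₁ i) ⟩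
    x zero ∙ toℕ i ×ℕ d ∙ d                  ≈⟨ trans (assoc _ _ _) (∙-congˡ (comm _ _)) ⟩
    x zero ∙ suc (toℕ i) ×ℕ d                ∎
    where open SetoidReasoning setoid

•-ℤ/ : ∀ n (let open AbelianGroup (ℤ/ n)) (let open IntegerMultiples (ℤ/ n)) i j → i • j ≈ i ℤ.* j
•-ℤ/ n i j = sym {i ℤ.* j} {i • j} (trans {i ℤ.* j} {i • (1ℤ ℤ.* j)} {i • j}
  (additive-unique (ℤ._* j) (λ i i′ → reflexive (ℤ.*-distribʳ-+ j i i′)) i)
  (reflexive (cong (i •_) (ℤ.*-identityˡ j))))
  where
  open AbelianGroup (ℤ/ n)
  open IntegerMultiples (ℤ/ n)

-- Dipoles and blocks

-- In the dipole with n columns the difference of the two rows has order n.  Summing the dipoles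
-- with b and with a columns makes the row V of the first one a times the row U of the second one,
-- so that U has order a b, all relative to the common row x₀.  Deleting the relation of the white
-- mark (x₀ , y₀ , z₀) allows a defect e there: a U + e = V.
module Block (a′ b′ : ℕ)
  (𝒳 : Amalgam {Fin 2} {Fin 2} 0F 0F (Fin 3))
  (𝒴 : Amalgam {Fin (suc (suc b′))} {Fin (suc (suc a′))} 0F 1F (Fin (suc (suc b′) ℕ.+ suc a′)))
  (𝒵 : Amalgam {Fin (suc (suc b′))} {Fin (suc (suc a′))} 1F 1F (Fin (suc (suc b′) ℕ.+ suc a′))) where

  private
    module A = Dipole a′
    module B = Dipole b′

  a b : ℕ
  a = A.n
  b = B.n

  private
    module X = Amalgam 𝒳
    module Y = Amalgam 𝒴
    module Z = Amalgam 𝒵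

  White Black : Rel3 (Fin 3) (Fin (b ℕ.+ suc a′)) (Fin (b ℕ.+ suc a′))
  White = SumWhite 𝒳 𝒴 𝒵 B.White A.White
  Black = SumBlack 𝒳 𝒴 𝒵 B.Black A.Black

  -- Both marks hold by computation. In the dipole with `b` columns (0, 0, 1) is black, since symbol
  -- 1 follows column 0; in the other one (0, 1, 1) is white, and (0, 0, 0) is left over to become
  -- the white mark.
  sphere : Sphere White Black
  sphere = sum-sphere 𝒳 𝒴 𝒵 B.dipole A.dipole ≡.refl ≡.refl

  S : IsSum 𝒳 𝒴 𝒵 B.White B.Black A.White A.Black White Black
  S = isSum 𝒳 𝒴 𝒵 ≡.refl ≡.refl

  x₀ : Fin 3
  x₀ = X.ι₂ 0F
  y₀ z₀ : Fin (b ℕ.+ suc a′)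
  y₀ = Y.ι₂ 0F
  z₀ = Z.ι₂ 0F

  white-mark : White x₀ y₀ z₀
  white-mark = inj₂ (_ , _ , _ , (≡.refl , λ { (_ , () , _) }) , ≡.refl , ≡.refl , ≡.refl)

  y₁ z₁ : Fin (b ℕ.+ suc a′)
  y₁ = Y.ι₁ 1F
  -- The black triple of row 0 at column 1; `next 1F` is `0F` if b = 2 and `2F` otherwise.
  z₁ = Z.ι₁ (next 1F)

  black-mark : Black x₀ y₁ z₁
  black-mark = inj₁ (0F , 1F , next 1F , (≡.refl , λ { (_ , () , _) }) , X.glued , ≡.refl , ≡.refl)

  module _ (G : AbelianGroup 0ℓ 0ℓ) where

    open AbelianGroup G
    open IntegerMultiples G

    module _ (U V e : Carrier) where

      -- The offset U - V is forced by the seam: symbol 1 has label - U in the second dipole, so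
      -- here column 1 has label U, and column 0 comes one step of V earlier.
      label₁ : Vertex 2 b b → Carrier
      label₁ (row 0F)   = ε
      label₁ (row 1F)   = V
      label₁ (column j) = U ∙ V ⁻¹ ∙ toℕ j ×ℕ V
      label₁ (symbol j) = (U ∙ V ⁻¹ ∙ toℕ j ×ℕ V) ⁻¹

      -- Symbol 0 carries the defect `e` of the triple (0, 0, 0). Symbol 1 is not minus column 1,
      -- because the relation of (0, 1, 1) has been removed; their sum is - V, the value of the
      -- removed black triple.
      label₂ : Vertex 2 a a → Carrier
      label₂ (row 0F)            = ε
      label₂ (row 1F)            = U
      label₂ (column 0F)         = ε
      label₂ (column (suc j))    = U ∙ V ⁻¹ ∙ toℕ j ×ℕ U
      label₂ (symbol 0F)         = e
      label₂ (symbol 1F)         = U ⁻¹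
      label₂ (symbol (suc (suc j))) = (U ∙ V ⁻¹ ∙ suc (toℕ j) ×ℕ U) ⁻¹

      blockLabel : Vertex 3 (b ℕ.+ suc a′) (b ℕ.+ suc a′) → Carrier
      blockLabel = pair S label₁ label₂

      private
        row≈ : ε ≈ ε
        row≈ = refl

        column≈ : label₁ (column 0F) ≈ label₂ (column 1F)
        column≈ = refl

        symbol≈ : label₁ (symbol 1F) ≈ label₂ (symbol 1F)
        symbol≈ = linear (U ∷ V ∷ []) (:- (var 0F :+ :- var 1F :+ (var 1F :+ :0))) (:- var 0F) ≡.refl

      blockLabel-embed₁ : ∀ v → blockLabel (embed₁ S v) ≈ label₁ v
      blockLabel-embed₁ = pair-embed₁ S G label₁ label₂ row≈ column≈ symbol≈

      blockLabel-embed₂ : ∀ v → blockLabel (embed₂ S v) ≈ label₂ v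
      blockLabel-embed₂ = pair-embed₂ S G label₁ label₂ row≈ column≈ symbol≈

      module _ (aU+e≈V : (+ a) • U ∙ e ≈ V) (bV≈ε : (+ b) • V ≈ ε) where

        private
          step₁ : ∀ j → label₁ (column (next j)) ≈ label₁ (column j) ∙ V
          step₁ j with view j
          ... | ‵inject₁ i = begin
            U ∙ V ⁻¹ ∙ (V ∙ toℕ i ×ℕ V)
              ≈⟨ linear (U ∷ V ∷ toℕ i ×ℕ V ∷ []) (var 0F :+ :- var 1F :+ (var 1F :+ var 2F))
                   (var 0F :+ :- var 1F :+ var 2F :+ var 1F) ≡.refl ⟩
            U ∙ V ⁻¹ ∙ toℕ i ×ℕ V ∙ V              ≡⟨ cong (λ k → U ∙ V ⁻¹ ∙ k ×ℕ V ∙ V) (Fin.toℕ-inject₁ i) ⟨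
            U ∙ V ⁻¹ ∙ toℕ (inject₁ i) ×ℕ V ∙ V    ∎
            where open SetoidReasoning setoid
          -- Wrapping around the columns of this dipole costs b V, which vanishes.
          ... | ‵fromℕ = begin
            U ∙ V ⁻¹ ∙ ε                            ≈⟨ ∙-congˡ bV≈ε ⟨
            U ∙ V ⁻¹ ∙ b ×ℕ V                       ≈⟨ trans (∙-congˡ (comm _ _)) (sym (assoc _ _ _)) ⟩
            U ∙ V ⁻¹ ∙ suc b′ ×ℕ V ∙ V              ≡⟨ cong (λ k → U ∙ V ⁻¹ ∙ k ×ℕ V ∙ V) (Fin.toℕ-fromℕ (suc b′)) ⟨
            U ∙ V ⁻¹ ∙ toℕ (fromℕ (suc b′)) ×ℕ V ∙ V   ∎
            where open SetoidReasoning setoid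

          labelling₁ : Labelling B.White G label₁
          labelling₁ {0F} {c} ≡.refl = trans (∙-congʳ (identityˡ _)) (inverseʳ _)
          labelling₁ {1F} {c} ≡.refl = trans (∙-congˡ (⁻¹-cong (step₁ c)))
            (linear (V ∷ label₁ (column c) ∷ []) (var 0F :+ var 1F :+ :- (var 1F :+ var 0F)) :0 ≡.refl)

          step₂ : ∀ c → U ∙ label₂ (column c) ∙ label₂ (symbol (next c)) ≈ ε
          step₂ 0F = linear (U ∷ []) (var 0F :+ :0 :+ :- var 0F) :0 ≡.refl
          step₂ (suc j) with view j
          ... | ‵inject₁ i = trans
            (∙-congˡ (⁻¹-cong (reflexive (cong (λ k → U ∙ V ⁻¹ ∙ suc k ×ℕ U) (≡.sym (Fin.toℕ-inject₁ i))))))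
            (linear (U ∷ V ∷ toℕ (inject₁ i) ×ℕ U ∷ [])
              (var 0F :+ (var 0F :+ :- var 1F :+ var 2F) :+ :- (var 0F :+ :- var 1F :+ (var 0F :+ var 2F))) :0 ≡.refl)
          -- At the wrap the last column U - V + a′ U meets the row U, giving a U - V since a = a′ +
          -- 2; symbol 0 contributes the defect `e`.
          ... | ‵fromℕ = begin
            U ∙ (U ∙ V ⁻¹ ∙ toℕ (fromℕ a′) ×ℕ U) ∙ e
              ≡⟨ cong (λ k → U ∙ (U ∙ V ⁻¹ ∙ k ×ℕ U) ∙ e) (Fin.toℕ-fromℕ a′) ⟩
            U ∙ (U ∙ V ⁻¹ ∙ a′ ×ℕ U) ∙ e
              ≈⟨ linear (U ∷ V ∷ e ∷ a′ ×ℕ U ∷ []) (var 0F :+ (var 0F :+ :- var 1F :+ var 3F) :+ var 2F)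
                   (var 0F :+ (var 0F :+ var 3F) :+ var 2F :+ :- var 1F) ≡.refl ⟩
            a ×ℕ U ∙ e ∙ V ⁻¹
              ≈⟨ ∙-congʳ aU+e≈V ⟩
            V ∙ V ⁻¹
              ≈⟨ inverseʳ V ⟩
            ε ∎
            where open SetoidReasoning setoid

          -- The disjunction serves two purposes: a genuine labelling when `e` vanishes, and a
          -- labelling away from the white mark otherwise.
          labelling₂ : ∀ {r c s} → A.White r c s → ¬ (r ≡ 0F × c ≡ 1F × s ≡ 1F) →
                       ¬ (r ≡ 0F × c ≡ 0F × s ≡ 0F) ⊎ e ≈ ε →
                       label₂ (row r) ∙ label₂ (column c) ∙ label₂ (symbol s) ≈ ε
          labelling₂ {0F} {0F} ≡.refl _ (inj₁ ne) = contradiction (≡.refl , ≡.refl , ≡.refl) ne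
          labelling₂ {0F} {0F} ≡.refl _ (inj₂ e≈ε) = trans (∙-cong (identityˡ ε) e≈ε) (identityˡ ε)
          labelling₂ {0F} {1F} ≡.refl ne _ = contradiction (≡.refl , ≡.refl , ≡.refl) ne
          labelling₂ {0F} {suc (suc j)} ≡.refl _ _ = trans (∙-congʳ (identityˡ _)) (inverseʳ _)
          labelling₂ {1F} {c} ≡.refl _ _ = step₂ c

          labelling : ∀ {r c s} → White r c s → ¬ (r ≡ x₀ × c ≡ y₀ × s ≡ z₀) ⊎ e ≈ ε →
                      blockLabel (row r) ∙ blockLabel (column c) ∙ blockLabel (symbol s) ≈ ε
          labelling (inj₁ (r , c , s , w , ≡.refl , ≡.refl , ≡.refl)) _ = trans
            (∙-cong (∙-cong (blockLabel-embed₁ (row r)) (blockLabel-embed₁ (column c))) (blockLabel-embed₁ (symbol s)))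
            (labelling₁ {r} {c} w)
          labelling (inj₂ (r , c , s , (w , ne) , ≡.refl , ≡.refl , ≡.refl)) ne′ = trans
            (∙-cong (∙-cong (blockLabel-embed₂ (row r)) (blockLabel-embed₂ (column c))) (blockLabel-embed₂ (symbol s)))
            (labelling₂ {r} {c} w ne (map₁ (λ ne′ → λ { (≡.refl , ≡.refl , ≡.refl) → ne′ (≡.refl , ≡.refl , ≡.refl) }) ne′))

        blockLabelling° : Labelling (White ∖ (x₀ , y₀ , z₀)) G blockLabel
        blockLabelling° (w , ne) = labelling w (inj₁ ne)

        blockLabelling : e ≈ ε → Labelling White G blockLabel
        blockLabelling e≈ε w = labelling w (inj₂ e≈ε)

        blockLabel-black-mark : blockLabel (row x₀) ∙ blockLabel (column y₁) ∙ blockLabel (symbol z₁) ≈ V ⁻¹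
        blockLabel-black-mark = trans
          (∙-cong (∙-cong (blockLabel-embed₂ (row 0F)) (blockLabel-embed₁ (column 1F)))
                  (trans (blockLabel-embed₁ (symbol (next 1F))) (⁻¹-cong (step₁ 1F))))
          (linear (V ∷ label₁ (column 1F) ∷ []) (:0 :+ var 1F :+ :- (var 1F :+ var 0F)) (:- var 0F) ≡.refl)

  -- The labels are group words in U, V and e, so homomorphisms carry them to the same words.
  blockLabel-natural : ∀ {H G : AbelianGroup 0ℓ 0ℓ} (φ : Hom H G) (let open Hom φ) (let open AbelianGroup G)
    {U V e U′ V′ e′} → to U ≈ U′ → to V ≈ V′ → to e ≈ e′ →
    ∀ v → to (blockLabel H U V e v) ≈ blockLabel G U′ V′ e′ v
  blockLabel-natural {H} {G} φ {U} {V} {e} {U′} {V′} {e′} U≈ V≈ e≈ = natural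
    where
    open AbelianGroup G
    open Hom φ
    open IntegerMultiples H using () renaming (_×ℕ_ to _×ᴴ_)
    open IntegerMultiples G using (_×ℕ_; •-congˡ)
    module H = AbelianGroup H

    multiple : ∀ n {x y} → to x ≈ y → to (n ×ᴴ x) ≈ n ×ℕ y
    multiple n {x} eq = trans (•-homo (+ n) x) (•-congˡ (+ n) eq)

    progression : ∀ n {x y} → to x ≈ y → to (U H.∙ V H.⁻¹ H.∙ n ×ᴴ x) ≈ U′ ∙ V′ ⁻¹ ∙ n ×ℕ y
    progression n eq = trans (homo _ _) (∙-cong
      (trans (homo _ _) (∙-cong U≈ (trans (⁻¹-homo V) (⁻¹-cong V≈)))) (multiple n eq))

    natural₁ : ∀ v → to (label₁ H U V e v) ≈ label₁ G U′ V′ e′ v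
    natural₁ (row 0F)   = ε-homo
    natural₁ (row 1F)   = V≈
    natural₁ (column j) = progression (toℕ j) V≈
    natural₁ (symbol j) = trans (⁻¹-homo _) (⁻¹-cong (progression (toℕ j) V≈))

    natural₂ : ∀ v → to (label₂ H U V e v) ≈ label₂ G U′ V′ e′ v
    natural₂ (row 0F)               = ε-homo
    natural₂ (row 1F)               = U≈
    natural₂ (column 0F)            = ε-homo
    natural₂ (column (suc j))       = progression (toℕ j) U≈
    natural₂ (symbol 0F)            = e≈
    natural₂ (symbol 1F)            = trans (⁻¹-homo U) (⁻¹-cong U≈)
    natural₂ (symbol (suc (suc j))) = trans (⁻¹-homo _) (⁻¹-cong (progression (suc (toℕ j)) U≈))

    natural : ∀ v → to (blockLabel H U V e v) ≈ blockLabel G U′ V′ e′ v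
    natural (row r) with X.cover r
    ... | inj₁ (i , _) = natural₁ (row i)
    ... | inj₂ (i , _) = natural₂ (row i)
    natural (column c) with Y.cover c
    ... | inj₁ (i , _) = natural₁ (column i)
    ... | inj₂ (i , _) = natural₂ (column i)
    natural (symbol s) with Z.cover s
    ... | inj₁ (i , _) = natural₁ (symbol i)
    ... | inj₂ (i , _) = natural₂ (symbol i)

  module _ (G : AbelianGroup 0ℓ 0ℓ) where

    open AbelianGroup G
    open IntegerMultiples G

    -- Normalising one row and one column removes the two free parameters of a labelling. Walking
    -- along the equator of each dipole then determines every label from the rows U and V, and
    -- closing each walk yields a relation.
    module Uniqueness
      (f : Vertex 3 (b ℕ.+ suc a′) (b ℕ.+ suc a′) → Carrier) (f-labelling : Labelling White G f)
      (f-x₀ : f (row x₀) ≈ ε) (f-y₀ : f (column y₀) ≈ ε) where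

      U V : Carrier
      U = f (row (X.ι₂ 1F))
      V = f (row (X.ι₁ 1F))

      private
        f₁ : Vertex 2 b b → Carrier
        f₁ = f ∘ embed₁ S
        f₂ : Vertex 2 a a → Carrier
        f₂ = f ∘ embed₂ S

        lab₁ : Labelling B.White G f₁
        lab₁ w = f-labelling (IsSum.white₁ S w)

        lab₂ : ∀ {r c s} → A.White r c s → ¬ (r ≡ 0F × c ≡ 1F × s ≡ 1F) →
               f₂ (row r) ∙ f₂ (column c) ∙ f₂ (symbol s) ≈ ε
        lab₂ w ne = f-labelling (inj₂ (_ , _ , _ , (w , ne) , ≡.refl , ≡.refl , ≡.refl))

        f₁-x₀ : f₁ (row 0F) ≈ ε
        f₁-x₀ = trans (reflexive (cong (f ∘ row) X.glued)) f-x₀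

        solve₁ : ∀ {x y z} → x ∙ y ∙ z ≈ ε → z ≈ (y ∙ x) ⁻¹
        solve₁ {x} {y} {z} eq = begin
          z                           ≈⟨ linear (x ∷ y ∷ z ∷ []) (var 2F)
                                          (:- (var 1F :+ var 0F) :+ (var 0F :+ var 1F :+ var 2F)) ≡.refl ⟩
          (y ∙ x) ⁻¹ ∙ (x ∙ y ∙ z)    ≈⟨ ∙-congˡ eq ⟩
          (y ∙ x) ⁻¹ ∙ ε              ≈⟨ identityʳ _ ⟩
          (y ∙ x) ⁻¹                  ∎
          where open SetoidReasoning setoid

        ⁻¹-cancel : ∀ {x y} → x ⁻¹ ≈ y ⁻¹ → x ≈ y
        ⁻¹-cancel {x} {y} eq = trans (linear (x ∷ []) (var 0F) (:- (:- var 0F)) ≡.refl)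
          (trans (⁻¹-cong eq) (linear (y ∷ []) (:- (:- var 0F)) (var 0F) ≡.refl))

        symbol₁ : ∀ j → f₁ (symbol j) ≈ f₁ (column j) ⁻¹
        symbol₁ j = trans (solve₁ (lab₁ {0F} ≡.refl)) (⁻¹-cong (trans (∙-congˡ f₁-x₀) (identityʳ _)))

        next₁ : ∀ j → f₁ (column (next j)) ≈ f₁ (column j) ∙ V
        next₁ j = ⁻¹-cancel (trans (sym (symbol₁ (next j))) (solve₁ (lab₁ {1F} ≡.refl)))

        column₁ : ∀ j → f₁ (column j) ≈ f₁ (column 0F) ∙ toℕ j ×ℕ V
        column₁ = arithmetic-progression G (f₁ ∘ column) V
          (λ i → trans (reflexive (cong (f₁ ∘ column) (≡.sym (next-inject₁ i)))) (next₁ (inject₁ i)))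

      -- Each of the b steps around the columns of the first dipole adds V.
      bV≈ε : (+ b) • V ≈ ε
      bV≈ε = begin
        b ×ℕ V
          ≈⟨ linear (V ∷ suc b′ ×ℕ V ∷ f₁ (column 0F) ∷ []) (var 0F :+ var 1F)
               (:- var 2F :+ (var 2F :+ var 1F :+ var 0F)) ≡.refl ⟩
        f₁ (column 0F) ⁻¹ ∙ (f₁ (column 0F) ∙ suc b′ ×ℕ V ∙ V)
          ≡⟨ cong (λ k → f₁ (column 0F) ⁻¹ ∙ (f₁ (column 0F) ∙ k ×ℕ V ∙ V)) (Fin.toℕ-fromℕ (suc b′)) ⟨
        _ ≈⟨ ∙-congˡ (∙-congʳ (column₁ (fromℕ (suc b′)))) ⟨
        f₁ (column 0F) ⁻¹ ∙ (f₁ (column (fromℕ (suc b′))) ∙ V)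
          ≈⟨ ∙-congˡ (next₁ (fromℕ (suc b′))) ⟨
        f₁ (column 0F) ⁻¹ ∙ f₁ (column (next (fromℕ (suc b′))))
          ≡⟨ cong (λ i → f₁ (column 0F) ⁻¹ ∙ f₁ (column i)) (next-fromℕ (suc b′)) ⟩
        f₁ (column 0F) ⁻¹ ∙ f₁ (column 0F)
          ≈⟨ inverseˡ _ ⟩
        ε ∎
        where open SetoidReasoning setoid

      private
        symbol₂-0 : f₂ (symbol 0F) ≈ ε
        symbol₂-0 = trans (solve₁ (lab₂ {0F} {0F} ≡.refl (λ { (_ , () , _) })))
          (trans (⁻¹-cong (∙-cong f-y₀ f-x₀)) (linear [] (:- (:0 :+ :0)) :0 ≡.refl))

        symbol₂-1 : f₂ (symbol 1F) ≈ U ⁻¹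
        symbol₂-1 = trans (solve₁ (lab₂ {1F} {0F} ≡.refl (λ { (() , _) })))
          (⁻¹-cong (trans (∙-congʳ f-y₀) (identityˡ _)))

        symbol₂ : ∀ j → f₂ (symbol (suc (suc j))) ≈ f₂ (column (suc (suc j))) ⁻¹
        symbol₂ j = trans (solve₁ (lab₂ {0F} ≡.refl (λ { (_ , () , _) })))
          (⁻¹-cong (trans (∙-congˡ f-x₀) (identityʳ _)))

        -- The two sides of the seam: κ₀ = − σ₁ − V on the first dipole and σ₁ = − U on the second.
        column₁-0 : f₁ (column 0F) ≈ U ∙ V ⁻¹
        column₁-0 = begin
          f₁ (column 0F)
            ≈⟨ linear (f₁ (column 0F) ∷ V ∷ []) (var 0F) (:- (:- (var 0F :+ var 1F)) :+ :- var 1F) ≡.refl ⟩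
          ((f₁ (column 0F) ∙ V) ⁻¹) ⁻¹ ∙ V ⁻¹
            ≈⟨ ∙-congʳ (⁻¹-cong (trans (symbol₁ 1F) (⁻¹-cong (next₁ 0F)))) ⟨
          f₁ (symbol 1F) ⁻¹ ∙ V ⁻¹
            ≈⟨ ∙-congʳ (⁻¹-cong (trans (reflexive (cong (f ∘ symbol) Z.glued)) symbol₂-1)) ⟩
          (U ⁻¹) ⁻¹ ∙ V ⁻¹
            ≈⟨ linear (U ∷ V ∷ []) (:- (:- var 0F) :+ :- var 1F) (var 0F :+ :- var 1F) ≡.refl ⟩
          U ∙ V ⁻¹ ∎
          where open SetoidReasoning setoid

        column₂-1 : f₂ (column 1F) ≈ U ∙ V ⁻¹
        column₂-1 = trans (reflexive (cong (f ∘ column) (≡.sym Y.glued))) column₁-0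

        next₂ : ∀ j → f₂ (symbol (next (suc j))) ≈ (f₂ (column (suc j)) ∙ U) ⁻¹
        next₂ j = solve₁ (lab₂ {1F} ≡.refl (λ { (() , _) }))

        column₂ : ∀ j → f₂ (column (suc j)) ≈ U ∙ V ⁻¹ ∙ toℕ j ×ℕ U
        column₂ j = trans (arithmetic-progression G (f₂ ∘ column ∘ suc) U step j) (∙-congʳ column₂-1)
          where
          step : ∀ i → f₂ (column (suc (suc i))) ≈ f₂ (column (suc (inject₁ i))) ∙ U
          step i = ⁻¹-cancel (trans (sym (symbol₂ i))
            (trans (reflexive (cong (f₂ ∘ symbol) (≡.sym (next-inject₁ (suc i))))) (next₂ (inject₁ i))))

      -- The walk in the second dipole starts at U - V in column 1 and closes at symbol 0, which is
      -- zero by the relation of the white mark.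
      aU≈V : (+ a) • U ≈ V
      aU≈V = begin
        a ×ℕ U
          ≈⟨ linear (U ∷ V ∷ a′ ×ℕ U ∷ []) (var 0F :+ (var 0F :+ var 2F))
               (var 1F :+ (var 0F :+ :- var 1F :+ var 2F :+ var 0F)) ≡.refl ⟩
        V ∙ (U ∙ V ⁻¹ ∙ a′ ×ℕ U ∙ U)
          ≡⟨ cong (λ k → V ∙ (U ∙ V ⁻¹ ∙ k ×ℕ U ∙ U)) (Fin.toℕ-fromℕ a′) ⟨
        _ ≈⟨ ∙-congˡ (∙-congʳ (column₂ (fromℕ a′))) ⟨
        V ∙ (f₂ (column (suc (fromℕ a′))) ∙ U)
          ≈⟨ ∙-congˡ (⁻¹-cancel (begin
               _ ≈⟨ next₂ (fromℕ a′) ⟨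
               f₂ (symbol (next (suc (fromℕ a′)))) ≡⟨ cong (f₂ ∘ symbol) (next-fromℕ (suc a′)) ⟩
               f₂ (symbol 0F)                      ≈⟨ symbol₂-0 ⟩
               ε                                   ≈⟨ linear [] :0 (:- :0) ≡.refl ⟩
               ε ⁻¹                                ∎)) ⟩
        V ∙ ε
          ≈⟨ identityʳ V ⟩
        V ∎
        where open SetoidReasoning setoid

      private
        unique₁ : ∀ v → label₁ G U V ε v ≈ f₁ v
        unique₁ (row 0F)   = sym f₁-x₀
        unique₁ (row 1F)   = refl
        unique₁ (column j) = sym (trans (column₁ j) (∙-congʳ column₁-0))
        unique₁ (symbol j) = trans (⁻¹-cong (unique₁ (column j))) (sym (symbol₁ j))

        unique₂ : ∀ v → label₂ G U V ε v ≈ f₂ v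
        unique₂ (row 0F)               = sym f-x₀
        unique₂ (row 1F)               = refl
        unique₂ (column 0F)            = sym f-y₀
        unique₂ (column (suc j))       = sym (column₂ j)
        unique₂ (symbol 0F)            = sym symbol₂-0
        unique₂ (symbol 1F)            = sym symbol₂-1
        unique₂ (symbol (suc (suc j))) = trans (⁻¹-cong (unique₂ (column (suc (suc j))))) (sym (symbol₂ j))

      blockLabel-unique : ∀ v → blockLabel G U V ε v ≈ f v
      blockLabel-unique (row r) with X.cover r
      ... | inj₁ (i , ≡.refl) = unique₁ (row i)
      ... | inj₂ (i , ≡.refl) = unique₂ (row i)
      blockLabel-unique (column c) with Y.cover c
      ... | inj₁ (i , ≡.refl) = unique₁ (column i)
      ... | inj₂ (i , ≡.refl) = unique₂ (column i)
      blockLabel-unique (symbol s) with Z.cover s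
      ... | inj₁ (i , ≡.refl) = unique₁ (symbol i)
      ... | inj₂ (i , ≡.refl) = unique₂ (symbol i)

  n : ℕ
  n = b ℕ.* a

  private
    module ℤ/n = AbelianGroup (ℤ/ n)
    module M = IntegerMultiples (ℤ/ n)

    n≈0 : (+ b) ℤ.* (+ a) ℤ/n.≈ 0ℤ
    n≈0 = divides 1ℤ (≡.trans (ℤ.+-identityʳ _) (≡.trans (≡.sym (ℤ.pos-* b a)) (≡.sym (ℤ.*-identityˡ (+ n)))))

    a1≈a : (+ a) M.• 1ℤ ℤ.+ 0ℤ ℤ/n.≈ + a
    a1≈a = ℤ/n.trans {(+ a) M.• 1ℤ ℤ.+ 0ℤ} {(+ a) M.• 1ℤ} {+ a} (ℤ/n.identityʳ ((+ a) M.• 1ℤ))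
      (ℤ/n.trans {(+ a) M.• 1ℤ} {(+ a) ℤ.* 1ℤ} {+ a} (•-ℤ/ n (+ a) 1ℤ) (ℤ/n.reflexive (ℤ.*-identityʳ (+ a))))

    ba≈0 : (+ b) M.• (+ a) ℤ/n.≈ 0ℤ
    ba≈0 = ℤ/n.trans {(+ b) M.• (+ a)} {(+ b) ℤ.* (+ a)} {0ℤ} (•-ℤ/ n (+ b) (+ a)) n≈0

  label : Vertex 3 (b ℕ.+ suc a′) (b ℕ.+ suc a′) → ℤ.ℤ
  label = blockLabel (ℤ/ n) 1ℤ (+ a) 0ℤ

  label-labelling : Labelling White (ℤ/ n) label
  label-labelling = blockLabelling (ℤ/ n) 1ℤ (+ a) 0ℤ a1≈a ba≈0 (ℤ/n.refl {0ℤ})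

  black-mark-torsion : (+ b) M.• (label (row x₀) ℤ.+ label (column y₁) ℤ.+ label (symbol z₁)) ℤ/n.≈ 0ℤ
  black-mark-torsion = begin
    (+ b) M.• (label (row x₀) ℤ.+ label (column y₁) ℤ.+ label (symbol z₁))
      ≈⟨ M.•-congˡ (+ b) {label (row x₀) ℤ.+ label (column y₁) ℤ.+ label (symbol z₁)} {ℤ.- (+ a)}
           (blockLabel-black-mark (ℤ/ n) 1ℤ (+ a) 0ℤ a1≈a ba≈0) ⟩
    (+ b) M.• (ℤ.- (+ a))
      ≈⟨ •-ℤ/ n (+ b) (ℤ.- (+ a)) ⟩
    (+ b) ℤ.* (ℤ.- (+ a))
      ≡⟨ ℤ.neg-distribʳ-* (+ b) (+ a) ⟨
    ℤ.- ((+ b) ℤ.* (+ a))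
      ≈⟨ ℤ/n.⁻¹-cong {(+ b) ℤ.* (+ a)} {0ℤ} n≈0 ⟩
    0ℤ ∎
    where open SetoidReasoning ℤ/n.setoid

  E : Enumeration ⟪ White ⟫ (Sphere.area sphere)
  E = Sphere.whites sphere

  private
    open Presentation (Vertex 3 (b ℕ.+ suc a′) (b ℕ.+ suc a′))
    open AbelianGroup (𝒜ₑ E)
    open IntegerMultiples (𝒜ₑ E)

    x y : Term
    x = gen (row x₀)
    y = gen (column y₀)

    -- The universal labelling `gen`, shifted so that it vanishes at `x₀` and `y₀` and `Uniqueness`
    -- applies.
    π : Vertex 3 (b ℕ.+ suc a′) (b ℕ.+ suc a′) → Term
    π v@(row _)    = gen v ⊕ ⊝ x
    π v@(column _) = gen v ⊕ ⊝ y
    π v@(symbol _) = gen v ⊕ (x ⊕ y)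

    π-labelling : Labelling White (𝒜ₑ E) π
    π-labelling {r} {c} {s} w = trans
      (linear (gen (row r) ∷ gen (column c) ∷ gen (symbol s) ∷ x ∷ y ∷ [])
        ((var 0F :+ :- var 3F) :+ (var 1F :+ :- var 4F) :+ (var 2F :+ (var 3F :+ var 4F)))
        (var 0F :+ var 1F :+ var 2F) ≡.refl)
      (relation E w)

    open Uniqueness (𝒜ₑ E) π π-labelling (inverseʳ x) (inverseʳ y)

    nU≈ε : (+ n) • U ≈ ε
    nU≈ε = begin
      (+ n) • U                ≡⟨ cong (_• U) (ℤ.pos-* b a) ⟩
      (+ b ℤ.* + a) • U        ≈⟨ *-• (+ b) (+ a) U ⟩
      (+ b) • ((+ a) • U)      ≈⟨ •-congˡ (+ b) aU≈V ⟩
      (+ b) • V                ≈⟨ bV≈ε ⟩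
      ε                        ∎
      where open SetoidReasoning setoid

    section : Hom (ℤ/ n) (𝒜ₑ E)
    section = record
      { to     = _• U
      ; cong-≈ = λ {i} {j} → •-mod (𝒜ₑ E) nU≈ε i j
      ; homo   = •-additive U
      }

    -- Naturality turns `label` into the block label with parameters U, V and `ε`, using aU = V;
    -- uniqueness identifies it with `π`.
    section-label : ∀ v → label v • U ≈ π v
    section-label v = trans (blockLabel-natural section (1•x≈x U) aU≈V refl v) (blockLabel-unique v)

  block-coordinates : Coordinates E (ℤ/ n) (gen (row x₀)) (gen (column y₀))
  block-coordinates = record
    { label     = label
    ; labelling = label-labelling
    ; section   = section
    ; label-ψ   = label-section
    ; ψ-row     = λ r → section-label (row r)
    ; ψ-column  = λ c → section-label (column c)
    ; ψ-symbol  = λ s → section-label (symbol s)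
    }
    where
    φ : Hom (𝒜ₑ E) (ℤ/ n)
    φ = labelHom E (ℤ/ n) label label-labelling

    φU : Hom.to φ U ℤ/n.≈ 1ℤ
    φU = begin
      label (row (X.ι₂ 1F)) ℤ.- label (row x₀)
        ≈⟨ ℤ/n.∙-cong {label (row (X.ι₂ 1F))} {1ℤ} {ℤ.- label (row x₀)} {ℤ.- 0ℤ}
             (blockLabel-embed₂ (ℤ/ n) 1ℤ (+ a) 0ℤ (row 1F))
             (ℤ/n.⁻¹-cong {label (row x₀)} {0ℤ} (blockLabel-embed₂ (ℤ/ n) 1ℤ (+ a) 0ℤ (row 0F))) ⟩
      1ℤ ℤ.- 0ℤ  ∎
      where open SetoidReasoning ℤ/n.setoid

    label-section : ∀ k → Hom.to φ (k • U) ℤ/n.≈ k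
    label-section k = begin
      Hom.to φ (k • U)      ≈⟨ Hom.•-homo φ k U ⟩
      k M.• Hom.to φ U      ≈⟨ M.•-congˡ k {Hom.to φ U} {1ℤ} φU ⟩
      k M.• 1ℤ              ≈⟨ •-ℤ/ n k 1ℤ ⟩
      k ℤ.* 1ℤ              ≡⟨ ℤ.*-identityʳ k ⟩
      k                     ∎
      where open SetoidReasoning ℤ/n.setoid

-- Inverses and composites of group isomorphisms

≅-sym : ∀ {a b ℓ₁ ℓ₂} {G : Group a ℓ₁} {H : Group b ℓ₂} → G ≅ H → H ≅ G
≅-sym {G = G} {H} (f , iso) = g , record
  { isGroupMonomorphism = record
    { isGroupHomomorphism = record
      { isMonoidHomomorphism = record
        { isMagmaHomomorphism = record
          { isRelHomomorphism = record
            { cong = λ p → injective (H.trans (fg _) (H.trans p (H.sym (fg _)))) }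
          ; homo = λ x y → injective (H.trans (fg _)
              (H.trans (H.∙-cong (H.sym (fg x)) (H.sym (fg y))) (H.sym (∙-homo _ _))))
          }
        ; ε-homo = injective (H.trans (fg _) (H.sym ε-homo))
        }
      ; ⁻¹-homo = λ x → injective (H.trans (fg _) (H.trans (H.⁻¹-cong (H.sym (fg x))) (H.sym (⁻¹-homo _))))
      }
    ; injective = λ p → H.trans (H.sym (fg _)) (H.trans (⟦⟧-cong p) (fg _))
    }
  ; surjective = λ x → f x , λ p → injective (H.trans (fg _) p)
  }
  where
  module G = Group G
  module H = Group H
  open GroupMorphisms.IsGroupIsomorphism iso
  g : H.Carrier → G.Carrier
  g y = proj₁ (surjective y)
  fg : ∀ y → f (g y) H.≈ y
  fg y = proj₂ (surjective y) G.refl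

≅-trans : ∀ {a b c ℓ₁ ℓ₂ ℓ₃} {G : Group a ℓ₁} {H : Group b ℓ₂} {K : Group c ℓ₃} → G ≅ H → H ≅ K → G ≅ K
≅-trans {K = K} (f , f-iso) (g , g-iso) =
  g ∘ f , Composition.isGroupIsomorphism (Group.trans K) f-iso g-iso

-- Induction on the number of summands

prime-divisor : ∀ {n} → Composite n → ∃ λ p → Prime p × p ℕ∣.∣ n
prime-divisor {n} c with factorise n {{composite⇒nonZero c}}
... | record { factors = [] ; isFactorisation = ≡.refl } = contradiction c ¬composite[1]
... | record { factors = p ∷ ps ; isFactorisation = ≡.refl ; factorsPrime = p-prime ∷ _ } =
  p , p-prime , ℕ∣.m∣m*n _

-- Compositeness excludes the cofactors 0 and 1, so both factors are large enough to be the number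
-- of columns of a dipole.
cofactor : ∀ {n p} → Composite n → Prime p → p ℕ∣.∣ n →
           ∃₂ λ a′ b′ → p ≡ suc (suc b′) × n ≡ suc (suc b′) ℕ.* suc (suc a′)
cofactor {p = suc (suc b′)} c _ (ℕ∣.divides zero ≡.refl) = contradiction ≡.refl (ℕ.≢-nonZero⁻¹ _ {{composite⇒nonZero c}})
cofactor {p = suc (suc b′)} c p-prime (ℕ∣.divides 1 ≡.refl) =
  contradiction (subst Prime (≡.sym (ℕ.*-identityˡ _)) p-prime) (composite⇒¬prime c)
cofactor {p = suc (suc b′)} c _ (ℕ∣.divides (suc (suc a′)) ≡.refl) =
  a′ , b′ , ≡.refl , ℕ.*-comm (suc (suc a′)) (suc (suc b′))
cofactor {p = 0} c p _ = contradiction (prime⇒nonTrivial p) λ ()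
cofactor {p = 1} c p _ = contradiction (prime⇒nonTrivial p) λ ()

coprime : ∀ {q a} → Prime q → ¬ q ℕ∣.∣ a → Coprime a q
coprime q-prime q∤a (d∣a , d∣q) with prime⇒irreducible q-prime d∣q
... | inj₁ d≡1    = d≡1
... | inj₂ ≡.refl = contradiction d∣a q∤a

negative-inverse : ∀ {q a} → Prime q → ¬ q ℕ∣.∣ a → ∃ λ U → (+ a) ℤ.* U ℤ.+ 1ℤ ≡ 0ℤ [mod q ]
negative-inverse {q} {a} q-prime q∤a with coprime-Bézout (coprime q-prime q∤a)
... | Bézout.Identity.-+ x y 1+xa≡yq = + x , divides (+ y) (begin
  (+ a) ℤ.* (+ x) ℤ.+ 1ℤ ℤ.- 0ℤ  ≡⟨ rearrange (+ a) (+ x) ⟩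
  1ℤ ℤ.+ (+ x) ℤ.* (+ a)         ≡⟨ cong (λ k → 1ℤ ℤ.+ k) (ℤ.pos-* x a) ⟨
  + (1 ℕ.+ x ℕ.* a)              ≡⟨ cong +_ 1+xa≡yq ⟩
  + (y ℕ.* q)                    ≡⟨ ℤ.pos-* y q ⟩
  (+ y) ℤ.* (+ q)                ∎)
  where
  open ≡.≡-Reasoning
  rearrange : ∀ a x → a ℤ.* x ℤ.+ 1ℤ ℤ.- 0ℤ ≡ 1ℤ ℤ.+ x ℤ.* a
  rearrange = solve-∀
... | Bézout.Identity.+- x y 1+yq≡xa = ℤ.- (+ x) , divides (ℤ.- (+ y)) (begin
  (+ a) ℤ.* (ℤ.- (+ x)) ℤ.+ 1ℤ ℤ.- 0ℤ          ≡⟨ rearrange (+ a) (+ x) ⟩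
  1ℤ ℤ.- (+ x) ℤ.* (+ a)                       ≡⟨ cong (λ k → 1ℤ ℤ.- k) (ℤ.pos-* x a) ⟨
  1ℤ ℤ.- + (x ℕ.* a)                           ≡⟨ cong (λ k → 1ℤ ℤ.- + k) 1+yq≡xa ⟨
  1ℤ ℤ.- (1ℤ ℤ.+ + (y ℕ.* q))                  ≡⟨ cong (λ k → 1ℤ ℤ.- (1ℤ ℤ.+ k)) (ℤ.pos-* y q) ⟩
  1ℤ ℤ.- (1ℤ ℤ.+ (+ y) ℤ.* (+ q))              ≡⟨ cancel (+ y) (+ q) ⟩
  (ℤ.- (+ y)) ℤ.* (+ q)                        ∎)
  where
  open ≡.≡-Reasoning
  rearrange : ∀ a x → a ℤ.* (ℤ.- x) ℤ.+ 1ℤ ℤ.- 0ℤ ≡ 1ℤ ℤ.- x ℤ.* a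
  rearrange = solve-∀
  cancel : ∀ y q → 1ℤ ℤ.- (1ℤ ℤ.+ y ℤ.* q) ≡ (ℤ.- y) ℤ.* q
  cancel = solve-∀

-- The congruences allow a labelling of the block modulo q whose only defect is 1 at its white mark.
record Splitting (q n : ℕ) : Set where
  field
    a′ b′ : ℕ
    prime-b : Prime (suc (suc b′))
    n≡ba : n ≡ suc (suc b′) ℕ.* suc (suc a′)
    U V : ℤ
    aU+1≡V : (+ suc (suc a′)) ℤ.* U ℤ.+ 1ℤ ≡ V [mod q ]
    bV≡0   : (+ suc (suc b′)) ℤ.* V ≡ 0ℤ [mod q ]

-- If q divides n take b = q, U = 0 and V = 1; otherwise take any prime factor b of n, V = 0, and
-- U from the inverse of a modulo q.
splitting : ∀ {q n} → Prime q → Composite n → Splitting q n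
splitting {q} {n} prime-q c with q ∣? n
... | yes q∣n with a′ , b′ , ≡.refl , n≡ba ← cofactor c prime-q q∣n = record
  { a′ = a′ ; b′ = b′ ; prime-b = prime-q ; n≡ba = n≡ba ; U = 0ℤ ; V = 1ℤ
  ; aU+1≡V = divides 0ℤ (cong (λ i → i ℤ.+ 1ℤ ℤ.- 1ℤ) (ℤ.*-zeroʳ (+ suc (suc a′))))
  ; bV≡0   = divides 1ℤ (≡.trans (ℤ.+-identityʳ _) (ℤ.*-comm (+ q) 1ℤ))
  }
... | no q∤n with p , prime-p , p∣n ← prime-divisor c
             with a′ , b′ , ≡.refl , n≡ba ← cofactor c prime-p p∣n
             with U , aU+1≡0 ← negative-inverse {q} {suc (suc a′)} prime-q
                    (λ q∣a → q∤n (subst (q ℕ∣.∣_) (≡.sym n≡ba) (ℕ∣.∣n⇒∣m*n (suc (suc b′)) q∣a))) = record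
  { a′ = a′ ; b′ = b′ ; prime-b = prime-p ; n≡ba = n≡ba ; U = U ; V = 0ℤ
  ; aU+1≡V = aU+1≡0
  ; bV≡0   = divides 0ℤ (≡.trans (ℤ.+-identityʳ _) (ℤ.*-zeroʳ (+ suc (suc b′))))
  }

-- The induction invariant: a sphere with group `K` and a black triple, free for the next gluing,
-- whose value is killed by `q`. That `q` is prime is carried beside it.
record Stage (K : AbelianGroup 0ℓ 0ℓ) (q : ℕ) : Set₁ where
  open AbelianGroup K
  open IntegerMultiples K
  field
    {l m n} : ℕ
    {W B}   : Rel3 (Fin l) (Fin m) (Fin n)
    sphere  : Sphere W B
    {X Y}   : Presentation.Term (Vertex l m n)
    coords  : Coordinates (Sphere.whites sphere) K X Y
    {r} : Fin l
    {c} : Fin m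
    {s} : Fin n
    mark    : B r c s
  open Coordinates coords public using (label)
  field
    mark-torsion : (+ q) • (label (row r) ∙ label (column c) ∙ label (symbol s)) ≈ ε

𝟙 : AbelianGroup 0ℓ 0ℓ
𝟙 = Terminal.abelianGroup

-- `⨁` ends in the trivial group, so even a single summand is a product with `𝟙`.
_×𝟙 : ∀ {K q} → Stage K q → Stage (DirectProduct.abelianGroup K 𝟙) q
_×𝟙 {K} {q} T = record
  { sphere = sphere
  ; coords = record
    { label     = label×
    ; labelling = λ w → C.labelling w , _
    ; section   = record
      { to     = λ (k , _) → C.ψ k
      ; cong-≈ = λ (p , _) → C.section.cong-≈ p
      ; homo   = λ (i , _) (j , _) → C.section.homo i j
      }
    ; label-ψ   = λ (k , _) → K.trans (hom-eval (fst K 𝟙) label× (C.ψ k)) (C.label-ψ k) , _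
    ; ψ-row     = C.ψ-row
    ; ψ-column  = C.ψ-column
    ; ψ-symbol  = C.ψ-symbol
    }
  ; mark = mark
  ; mark-torsion = K.trans (Hom.•-homo (fst K 𝟙) (+ q) (_ , _)) mark-torsion , _
  }
  where
  open Stage T
  module C = Coordinates coords
  module K = AbelianGroup K
  label× : Vertex l m n → K.Carrier × AbelianGroup.Carrier 𝟙
  label× v = label v , _

first-stage : ∀ {n} → Composite n → ∃ λ q → Prime q × Stage (ℤ/ n) q
-- There is no previous mark, so the prime 2 is an arbitrary choice; only the factorisation of n
-- with a prime b is taken from the splitting.
first-stage c with record { a′ = a′ ; b′ = b′ ; prime-b = prime-b ; n≡ba = ≡.refl } ← splitting prime[2] c =
  _ , prime-b , record
    { sphere       = E.sphere
    ; coords       = E.block-coordinates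
    ; mark         = E.black-mark
    ; mark-torsion = E.black-mark-torsion
    }
  where module E = Block a′ b′ (Fin-amalgam 0F 0F) (Fin-amalgam 0F 1F) (Fin-amalgam 1F 1F)

module _ {K : AbelianGroup 0ℓ 0ℓ} {q : ℕ} (T : Stage K q) {n : ℕ} (P : Splitting q n) where

  private
    open Splitting P
    module T = Stage T
    module E = Block a′ b′ (Fin-amalgam 0F 0F) (Fin-amalgam 0F 1F) (Fin-amalgam 1F 1F)
    module K = AbelianGroup K
    module ℤ/q = AbelianGroup (ℤ/ q)
    module M = IntegerMultiples (ℤ/ q)

    𝒳 : Amalgam T.r E.x₀ (Fin (T.l ℕ.+ 2))
    𝒳 = Fin-amalgam T.r E.x₀
    𝒴 : Amalgam T.c E.y₀ (Fin (T.m ℕ.+ suc (b′ ℕ.+ suc a′)))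
    𝒴 = Fin-amalgam T.c E.y₀
    𝒵 : Amalgam T.s E.z₀ (Fin (T.n ℕ.+ suc (b′ ℕ.+ suc a′)))
    𝒵 = Fin-amalgam T.s E.z₀

    next-sphere : Sphere (SumWhite 𝒳 𝒴 𝒵 T.W E.White) (SumBlack 𝒳 𝒴 𝒵 T.B E.Black)
    next-sphere = sum-sphere 𝒳 𝒴 𝒵 T.sphere E.sphere T.mark E.white-mark

    aU+1≈V : (+ E.a) M.• U ℤ.+ 1ℤ ℤ/q.≈ V
    aU+1≈V = ℤ/q.trans {(+ E.a) M.• U ℤ.+ 1ℤ} {(+ E.a) ℤ.* U ℤ.+ 1ℤ} {V}
      (ℤ/q.∙-congʳ {1ℤ} {(+ E.a) M.• U} {(+ E.a) ℤ.* U} (•-ℤ/ q (+ E.a) U)) aU+1≡V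

    bV≈0 : (+ E.b) M.• V ℤ/q.≈ 0ℤ
    bV≈0 = ℤ/q.trans {(+ E.b) M.• V} {(+ E.b) ℤ.* V} {0ℤ} (•-ℤ/ q (+ E.b) V) bV≡0

    h : Vertex 3 (E.b ℕ.+ suc a′) (E.b ℕ.+ suc a′) → ℤ.ℤ
    h = E.blockLabel (ℤ/ q) U V 1ℤ

    h-mark : ℤ.ℤ
    h-mark = h (row E.x₀) ℤ.+ h (column E.y₁) ℤ.+ h (symbol E.z₁)

    bh≡0 : (+ E.b) ℤ.* h-mark ≡ 0ℤ [mod q ]
    bh≡0 = begin
      (+ E.b) ℤ.* h-mark    ≈⟨ •-ℤ/ q (+ E.b) h-mark ⟨
      (+ E.b) M.• h-mark    ≈⟨ M.•-congˡ (+ E.b) {h-mark} {ℤ.- V}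
                                 (E.blockLabel-black-mark (ℤ/ q) U V 1ℤ aU+1≈V bV≈0) ⟩
      (+ E.b) M.• (ℤ.- V)   ≈⟨ •-ℤ/ q (+ E.b) (ℤ.- V) ⟩
      (+ E.b) ℤ.* (ℤ.- V)   ≡⟨ ℤ.neg-distribʳ-* (+ E.b) V ⟨
      ℤ.- ((+ E.b) ℤ.* V)   ≈⟨ ℤ/q.⁻¹-cong {(+ E.b) ℤ.* V} {0ℤ} bV≡0 ⟩
      0ℤ                    ∎
      where open SetoidReasoning ℤ/q.setoid

    S : IsSum 𝒳 𝒴 𝒵 T.W T.B E.White E.Black (SumWhite 𝒳 𝒴 𝒵 T.W E.White) (SumBlack 𝒳 𝒴 𝒵 T.B E.Black)
    S = isSum 𝒳 𝒴 𝒵 T.mark E.white-mark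

    open SumCoordinates S
      (Sphere.whites T.sphere) E.E (Sphere.whites next-sphere) T.coords E.block-coordinates
      q h (E.blockLabelling° (ℤ/ q) U V 1ℤ aU+1≈V bV≈0)
      (E.blockLabel-embed₂ (ℤ/ q) U V 1ℤ (row 0F))
      (E.blockLabel-embed₂ (ℤ/ q) U V 1ℤ (column 0F))
      (E.blockLabel-embed₂ (ℤ/ q) U V 1ℤ (symbol 0F))
      using (mark-torsion₂; sum-coordinates)

    f-row : E.label (row E.x₀) ≡ 0ℤ [mod E.n ]
    f-row = E.blockLabel-embed₂ (ℤ/ E.n) 1ℤ (+ E.a) 0ℤ (row 0F)
    f-column : E.label (column E.y₀) ≡ 0ℤ [mod E.n ]
    f-column = E.blockLabel-embed₂ (ℤ/ E.n) 1ℤ (+ E.a) 0ℤ (column 0F)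
    f-symbol : E.label (symbol E.z₀) ≡ 0ℤ [mod E.n ]
    f-symbol = E.blockLabel-embed₂ (ℤ/ E.n) 1ℤ (+ E.a) 0ℤ (symbol 0F)

  -- The new mark has value - a in `ℤ/ E.n` and - V times the old mark's value in `K`. Both are
  -- killed by b, the second because b V ≡ 0 modulo `q` and `q` kills the old value.
  next-stage : Stage (DirectProduct.abelianGroup (ℤ/ E.n) K) E.b
  next-stage = record
    { sphere       = next-sphere
    ; coords       = sum-coordinates f-row f-column f-symbol T.mark-torsion
    ; mark         = IsSum.black₂ S E.black-mark
    ; mark-torsion = mark-torsion₂ f-row f-column f-symbol T.mark-torsion E.b E.x₀ E.y₁ E.z₁
                       E.black-mark-torsion bh≡0
    }

extend-stage : ∀ {K q n} → Prime q → Composite n → Stage K q →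
               ∃ λ q′ → Prime q′ × Stage (DirectProduct.abelianGroup (ℤ/ n) K) q′
extend-stage {K} prime-q c T with splitting prime-q c
... | P = _ , Splitting.prime-b P ,
  subst (λ m → Stage (DirectProduct.abelianGroup (ℤ/ m) K) _) (≡.sym (Splitting.n≡ba P)) (next-stage T P)

stages : ∀ k (n : Fin (suc k) → ℕ) → (∀ i → Composite (n i)) →
         ∃ λ q → Prime q × Stage (⨁ (λ i → ℤ/ (n i))) q
stages zero    n n-composite = let q , prime-q , T = first-stage (n-composite zero) in q , prime-q , T ×𝟙
-- The head is glued last, since a new block enters as the left factor and `⨁` is a right fold.
stages (suc k) n n-composite =
  let _ , prime-q , T = stages k (n ∘ suc) (n-composite ∘ suc)
  in extend-stage prime-q (n-composite zero) T

-- Torsion of the direct sum and the conclusion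

Hom-torsion : ∀ {H K} (φ : Hom H K) {x} → Torsion.IsTorsion H x → Torsion.IsTorsion K (Hom.to φ x)
Hom-torsion {H} {K} φ (j , j≢0 , jx≈ε) = j , j≢0 ,
  trans (sym (Hom.•-homo φ (+ j) _)) (trans (Hom.cong-≈ φ jx≈ε) (Hom.ε-homo φ))
  where open AbelianGroup K

-- A pair is (x, 0) + (0, y), and the torsion subgroup is closed under addition.
×-torsion : ∀ H K → (∀ x → Torsion.IsTorsion H x) → (∀ y → Torsion.IsTorsion K y) →
            ∀ z → Torsion.IsTorsion (DirectProduct.abelianGroup H K) z
×-torsion H K tH tK (x , y) =
  let j , j≢0 , eq = proj₂ (AbelianGroup._∙_ (torsionSubgroup H×K)
                             (_ , Hom-torsion (inl H K) (tH x)) (_ , Hom-torsion (inr H K) (tK y)))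
  in j , j≢0 , H×K.trans (•-congˡ (+ j) (H.sym (H.identityʳ x) , K.sym (K.identityˡ y))) eq
  where
  H×K = DirectProduct.abelianGroup H K
  module H×K = AbelianGroup H×K
  module H = AbelianGroup H
  module K = AbelianGroup K
  open IntegerMultiples H×K

ℤ/-torsion : ∀ n → NonZero n → ∀ i → Torsion.IsTorsion (ℤ/ n) i
ℤ/-torsion n n≢0 i = n , n≢0 , trans {(+ n) • i} {(+ n) ℤ.* i} {0ℤ} (•-ℤ/ n (+ n) i)
  (divides i (≡.trans (ℤ.+-identityʳ _) (ℤ.*-comm (+ n) i)))
  where
  open AbelianGroup (ℤ/ n)
  open IntegerMultiples (ℤ/ n)

⨁-torsion : ∀ k (n : Fin k → ℕ) → (∀ i → NonZero (n i)) → ∀ x → Torsion.IsTorsion (⨁ (λ i → ℤ/ (n i))) x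
⨁-torsion zero    n n≢0 _ = 1 , _ , _
⨁-torsion (suc k) n n≢0 =
  ×-torsion (ℤ/ (n zero)) (⨁ (λ i → ℤ/ (n (suc i)))) (ℤ/-torsion (n zero) (n≢0 zero)) (⨁-torsion k (n ∘ suc) (n≢0 ∘ suc))

theorem2p5 : ∀ {a ℓ : Level} (k : ℕ) → k ≥ 1 →
    (n : Fin k → ℕ) → (∀ i → Composite (n i)) →
    (Γ : Group a ℓ) → Γ ≅ AbelianGroup.group (⨁ (λ i → ℤ/ (n i))) →
    ∃ λ (T : SphericalLatinBitrade) → AbelianGroup.group (canonicalGroup T) ≅ Γ
theorem2p5 (suc k) _ n n-composite Γ Γ≅ =
  let _ , _ , stage = stages k n n-composite
      open Stage stage using (sphere; coords; mark)
      open Sphere sphere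
      -- The white mate of the last mark witnesses that the bitrade is non-empty.
      _ , w = Axis.black-mate (Trade.axis₁ trade) mark
      T = bitrade trade (_ , _ , _ , w) whites blacks euler
      G = AbelianGroup.group (⨁ (λ i → ℤ/ (n i)))
  in T , ≅-trans {G = AbelianGroup.group (canonicalGroup T)} {H = G} {K = Γ}
           (torsion≅ whites coords (⨁-torsion (suc k) n (composite⇒nonZero ∘ n-composite)))
           (≅-sym {G = Γ} {H = G} Γ≅)
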